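{- Let $\zeta_5=e^{2\pi i/5}$. For every $\tau\in\mathbb{H}^2$, $$\zeta_5\,\theta[\tfrac15;\tfrac15]^5+\zeta_5^3\,\theta[\tfrac35;\tfrac15]^5+\theta[1;\tfrac15]^5-\zeta_5^2\,\theta[\tfrac35;\tfrac95]^5-\zeta_5^4\,\theta[\tfrac15;\tfrac95]^5=0,$$ and $$\zeta_5^3\,\theta[\tfrac15;\tfrac35]^5+\zeta_5^4\,\theta[\tfrac35;\tfrac35]^5+\theta[1;\tfrac35]^5-\zeta_5\,\theta[\tfrac35;\tfrac75]^5-\zeta_5^2\,\theta[\tfrac15;\tfrac75]^5=0.$$
   Context: Let $\mathbb{H}^2=\{\tau\in\mathbb{C}:\Im\tau>0\}$. For a characteristic $(\epsilon,\epsilon')\in\mathbb{R}^2$, the theta function with characteristic is $$\theta[\epsilon;\epsilon'](\zeta,\tau)=\sum_{n\in\mathbb{Z}}\exp\Big(2\pi i\Big[\tfrac12\big(n+\tfrac{\epsilon}{2}\big)^2\tau+\big(n+\tfrac{\epsilon}{2}\big)\big(\zeta+\tfrac{\epsilon'}{2}\big)\Big]\Big),\quad (\zeta,\tau)\in\mathbb{C}\times\mathbb{H}^2,$$ (usually written with the column $\left[\begin{smallmatrix}\epsilon\\ \epsilon'\end{smallmatrix}\right]$), and the theta constant is $\theta[\epsilon;\epsilon']=\theta[\epsilon;\epsilon'](0,\tau)$, regarded as a function of $\tau$. -}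

module Defs where

open import Algebra.Bundles.Raw using (RawMonoid; RawRing)
import Algebra.Definitions.RawSemiring as RawSemiringDefs
open import Data.Integer.Base as ℤ using (ℤ; -[1+_])
import Data.Integer.Properties as ℤ
open import Data.Nat.Base as ℕ using (ℕ; zero; suc)
import Data.Nat.Properties as ℕ
open import Data.Product.Base using (∃; _×_; _,_; proj₁; proj₂)
open import Data.Rational.Base
open import Data.Rational.Properties
import Data.Rational.Unnormalised.Base as ℚᵘ
import Data.Rational.Unnormalised.Properties as ℚᵘ
open import Data.Sum.Base using (_⊎_; inj₁; inj₂)
open import Level using (0ℓ)
open import Relation.Binary.PropositionalEquality using (_≡_; refl; sym; trans; cong; cong₂; subst; subst₂; module ≡-Reasoning)
open import Relation.Nullary.Decidable using (dec⇒maybe)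
open import Tactic.RingSolver using (solve-∀)
open import Tactic.RingSolver.Core.AlmostCommutativeRing using (AlmostCommutativeRing; fromCommutativeRing)

open RawSemiringDefs (RawRing.rawSemiring +-*-rawRing) using (_^_)

ℚ-ring : AlmostCommutativeRing 0ℓ 0ℓ
ℚ-ring = fromCommutativeRing +-*-commutativeRing (λ x → dec⇒maybe (0ℚ ≟ x))

ι : ℕ → ℚ
ι zero    = 0ℚ
ι (suc n) = 1ℚ + ι n

n/1≡ι : ∀ n → ℤ.+ n / 1 ≡ ι n
n/1≡ι zero = refl
n/1≡ι (suc n) = toℚᵘ-injective (begin
  toℚᵘ (ℤ.+ suc n / 1)              ≈⟨ toℚᵘ-fromℚᵘ (ℚᵘ.mkℚᵘ (ℤ.+ suc n) 0) ⟩
  ℚᵘ.mkℚᵘ (ℤ.+ suc n) 0             ≈⟨ ℚᵘ.*≡* (cong (ℤ._* (ℤ.+ 1)) (sym (cong (ℤ._+_ (ℤ.+ 1)) (ℤ.*-identityʳ (ℤ.+ n))))) ⟩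
  toℚᵘ 1ℚ ℚᵘ.+ ℚᵘ.mkℚᵘ (ℤ.+ n) 0    ≈⟨ ℚᵘ.+-congʳ (toℚᵘ 1ℚ) (toℚᵘ-fromℚᵘ (ℚᵘ.mkℚᵘ (ℤ.+ n) 0)) ⟨
  toℚᵘ 1ℚ ℚᵘ.+ toℚᵘ (ℤ.+ n / 1)     ≡⟨ cong (λ p → toℚᵘ 1ℚ ℚᵘ.+ toℚᵘ p) (n/1≡ι n) ⟩
  toℚᵘ 1ℚ ℚᵘ.+ toℚᵘ (ι n)           ≈⟨ toℚᵘ-homo-+ 1ℚ (ι n) ⟨
  toℚᵘ (1ℚ + ι n)                   ∎)
  where open import Relation.Binary.Reasoning.Setoid ℚᵘ.≃-setoid

0≤1 : 0ℚ ≤ 1ℚ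
0≤1 = nonNegative⁻¹ 1ℚ

0<1 : 0ℚ < 1ℚ
0<1 = positive⁻¹ 1ℚ

0≤½ : 0ℚ ≤ ½
0≤½ = nonNegative⁻¹ ½

by-diff : ∀ {p q} e → 0ℚ ≤ e → p + e ≡ q → p ≤ q
by-diff {p} {q} e 0≤e eq = subst₂ _≤_ (+-identityʳ p) eq (+-monoʳ-≤ p 0≤e)

diff : ∀ {p q} → p ≤ q → 0ℚ ≤ q - p
diff {p} {q} p≤q = subst (_≤ q - p) (+-inverseʳ p) (+-monoˡ-≤ (- p) p≤q)

+-nn : ∀ {p q} → 0ℚ ≤ p → 0ℚ ≤ q → 0ℚ ≤ p + q
+-nn = +-mono-≤

*-nn : ∀ {p q} → 0ℚ ≤ p → 0ℚ ≤ q → 0ℚ ≤ p * q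
*-nn {p} {q} 0≤p 0≤q = subst (_≤ p * q) (*-zeroʳ p)
  (*-monoˡ-≤-nonNeg p {{nonNegative 0≤p}} 0≤q)

*-pos : ∀ {p q} → 0ℚ < p → 0ℚ < q → 0ℚ < p * q
*-pos {p} {q} 0<p 0<q = subst (_< p * q) (*-zeroʳ p)
  (*-monoʳ-<-pos p {{positive 0<p}} 0<q)

*-monoˡ : ∀ {p q r} → 0ℚ ≤ p → q ≤ r → p * q ≤ p * r
*-monoˡ {p} 0≤p = *-monoˡ-≤-nonNeg p {{nonNegative 0≤p}}

*-monoʳ : ∀ {p q r} → 0ℚ ≤ p → q ≤ r → q * p ≤ r * p
*-monoʳ {p} 0≤p = *-monoʳ-≤-nonNeg p {{nonNegative 0≤p}}

*-mono : ∀ {p q r s} → 0ℚ ≤ r → 0ℚ ≤ p → p ≤ q → r ≤ s → p * r ≤ q * s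
*-mono 0≤r 0≤p p≤q r≤s = ≤-trans (*-monoʳ 0≤r p≤q) (*-monoˡ (≤-trans 0≤p p≤q) r≤s)

sq-nn : ∀ p → 0ℚ ≤ p * p
sq-nn p with ≤-total 0ℚ p
... | inj₁ 0≤p = *-nn 0≤p 0≤p
... | inj₂ p≤0 = subst (0ℚ ≤_) (eq p) (*-nn 0≤-p 0≤-p)
  where
  0≤-p : 0ℚ ≤ - p
  0≤-p = neg-antimono-≤ p≤0
  eq : ∀ p → - p * - p ≡ p * p
  eq = solve-∀ ℚ-ring

0≤ι : ∀ n → 0ℚ ≤ ι n
0≤ι zero = ≤-refl
0≤ι (suc n) = +-nn 0≤1 (0≤ι n)

ι-+ : ∀ m n → ι (m ℕ.+ n) ≡ ι m + ι n
ι-+ zero n = sym (+-identityˡ (ι n))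
ι-+ (suc m) n = trans (cong (1ℚ +_) (ι-+ m n)) (sym (+-assoc 1ℚ (ι m) (ι n)))

ι-mono : ∀ {m n} → m ℕ.≤ n → ι m ≤ ι n
ι-mono {m} {n} m≤n = by-diff (ι (n ℕ.∸ m)) (0≤ι (n ℕ.∸ m))
  (trans (sym (ι-+ m (n ℕ.∸ m))) (cong ι (ℕ.m+[n∸m]≡n m≤n)))

abs-≤ : ∀ {p r} → p ≤ r → - p ≤ r → ∣ p ∣ ≤ r
abs-≤ {p} p≤r -p≤r with ∣p∣≡p∨∣p∣≡-p p
... | inj₁ eq = subst (_≤ _) (sym eq) p≤r
... | inj₂ eq = subst (_≤ _) (sym eq) -p≤r

p≤∣p∣ : ∀ p → p ≤ ∣ p ∣
p≤∣p∣ p with ≤-total 0ℚ p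
... | inj₁ 0≤p = ≤-reflexive (sym (0≤p⇒∣p∣≡p 0≤p))
... | inj₂ p≤0 = ≤-trans p≤0 (0≤∣p∣ p)

-p≤∣p∣ : ∀ p → - p ≤ ∣ p ∣
-p≤∣p∣ p = subst (- p ≤_) (∣-p∣≡∣p∣ p) (p≤∣p∣ (- p))

∣∣² : ∀ p → ∣ p ∣ * ∣ p ∣ ≡ p * p
∣∣² p = trans (sym (∣p*q∣≡∣p∣*∣q∣ p p)) (0≤p⇒∣p∣≡p (sq-nn p))

∣-∣-sym : ∀ p q → ∣ p - q ∣ ≡ ∣ q - p ∣
∣-∣-sym p q = trans (sym (∣-p∣≡∣p∣ (p - q))) (cong ∣_∣ (eq p q))
  where
  eq : ∀ p q → - (p - q) ≡ q - p
  eq = solve-∀ ℚ-ring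

∣-∣-tri : ∀ p q r → ∣ p - r ∣ ≤ ∣ p - q ∣ + ∣ q - r ∣
∣-∣-tri p q r = subst (λ x → ∣ x ∣ ≤ ∣ p - q ∣ + ∣ q - r ∣) (eq p q r) (∣p+q∣≤∣p∣+∣q∣ (p - q) (q - r))
  where
  eq : ∀ p q r → p - q + (q - r) ≡ p - r
  eq = solve-∀ ℚ-ring

^-nn : ∀ {p} n → 0ℚ ≤ p → 0ℚ ≤ p ^ n
^-nn zero 0≤p = 0≤1
^-nn (suc n) 0≤p = *-nn 0≤p (^-nn n 0≤p)

^-mono : ∀ {p q} n → 0ℚ ≤ p → p ≤ q → p ^ n ≤ q ^ n
^-mono zero 0≤p p≤q = ≤-refl
^-mono (suc n) 0≤p p≤q = *-mono (^-nn n 0≤p) 0≤p p≤q (^-mono n 0≤p p≤q)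

1≤^ : ∀ {p} n → 1ℚ ≤ p → 1ℚ ≤ p ^ n
1≤^ zero 1≤p = ≤-refl
1≤^ (suc n) 1≤p = *-mono 0≤1 0≤1 1≤p (1≤^ n 1≤p)

^-+ : ∀ p m n → p ^ (m ℕ.+ n) ≡ p ^ m * p ^ n
^-+ p zero n = sym (*-identityˡ _)
^-+ p (suc m) n = trans (cong (p *_) (^-+ p m n)) (sym (*-assoc p _ _))

^-* : ∀ p m n → p ^ (m ℕ.* n) ≡ (p ^ n) ^ m
^-* p zero n = refl
^-* p (suc m) n = trans (^-+ p n (m ℕ.* n)) (cong (p ^ n *_) (^-* p m n))

*-^ : ∀ p q n → (p * q) ^ n ≡ p ^ n * q ^ n
*-^ p q zero = refl
*-^ p q (suc n) = trans (cong (p * q *_) (*-^ p q n)) (eq p q (p ^ n) (q ^ n))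
  where
  eq : ∀ p q r s → p * q * (r * s) ≡ p * r * (q * s)
  eq = solve-∀ ℚ-ring

≤1-^ : ∀ {p} n → 0ℚ ≤ p → p ≤ 1ℚ → p ^ n ≤ 1ℚ
≤1-^ zero 0≤p p≤1 = ≤-refl
≤1-^ (suc n) 0≤p p≤1 = *-mono (^-nn n 0≤p) 0≤p p≤1 (≤1-^ n 0≤p p≤1)

bernoulli : ∀ p n → 0ℚ ≤ 1ℚ + p → 1ℚ + ι n * p ≤ (1ℚ + p) ^ n
bernoulli p zero _ = ≤-reflexive (eq p)
  where
  eq : ∀ p → 1ℚ + 0ℚ * p ≡ 1ℚ
  eq = solve-∀ ℚ-ring
bernoulli p (suc n) 0≤1+p = begin
  1ℚ + (1ℚ + ι n) * p        ≤⟨ by-diff _ (*-nn (0≤ι n) (sq-nn p)) (eq p (ι n)) ⟩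
  (1ℚ + p) * (1ℚ + ι n * p)  ≤⟨ *-monoˡ 0≤1+p (bernoulli p n 0≤1+p) ⟩
  (1ℚ + p) * (1ℚ + p) ^ n    ∎
  where
  open ≤-Reasoning
  eq : ∀ p x → 1ℚ + (1ℚ + x) * p + x * (p * p) ≡ (1ℚ + p) * (1ℚ + x * p)
  eq = solve-∀ ℚ-ring

h : ℕ → ℚ
h k = ½ ^ k

2^_ : ℕ → ℕ
2^ k = 2 ℕ.^ k

0≤h : ∀ k → 0ℚ ≤ h k
0≤h k = ^-nn k 0≤½

h≤1 : ∀ k → h k ≤ 1ℚ
h≤1 k = ≤1-^ k 0≤½ (by-diff ½ 0≤½ refl)

h-anti : ∀ {m n} → m ℕ.≤ n → h n ≤ h m
h-anti {m} {n} m≤n = subst₂ _≤_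
  (trans (sym (^-+ ½ m (n ℕ.∸ m))) (cong h (ℕ.m+[n∸m]≡n m≤n))) (*-identityʳ (h m))
  (*-monoˡ (0≤h m) (h≤1 (n ℕ.∸ m)))

ι-double : ∀ n → ι (2 ℕ.* n) ≡ ι n + ι n
ι-double n = trans (ι-+ n (n ℕ.+ 0)) (cong (λ m → ι n + ι m) (ℕ.+-identityʳ n))

2^*h : ∀ k → ι (2^ k) * h k ≡ 1ℚ
2^*h zero = refl
2^*h (suc k) = begin
  ι (2 ℕ.* 2^ k) * (½ * h k)        ≡⟨ cong (_* (½ * h k)) (ι-double (2^ k)) ⟩
  (ι (2^ k) + ι (2^ k)) * (½ * h k) ≡⟨ eq (ι (2^ k)) (h k) ⟩
  ι (2^ k) * h k                    ≡⟨ 2^*h k ⟩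
  1ℚ                                ∎
  where
  open ≡-Reasoning
  eq : ∀ x y → (x + x) * (½ * y) ≡ x * y
  eq = solve-∀ ℚ-ring

ι*h≤1 : ∀ {n} k → n ℕ.≤ 2^ k → ι n * h k ≤ 1ℚ
ι*h≤1 {n} k n≤ = subst (ι n * h k ≤_) (2^*h k) (*-monoʳ (0≤h k) (ι-mono n≤))

arch : ∀ p → ∃ λ n → p ≤ ι n
arch p@(mkℚ (ℤ.+ n) d _) = n , subst (p ≤_) (n/1≡ι n)
  (toℚᵘ-cancel-≤ (ℚᵘ.≤-trans (ℚᵘ.*≤* le) (ℚᵘ.≤-reflexive (ℚᵘ.≃-sym (toℚᵘ-fromℚᵘ (ℚᵘ.mkℚᵘ (ℤ.+ n) 0))))))
  where
  le : ℤ.+ n ℤ.* ℤ.+ 1 ℤ.≤ ℤ.+ n ℤ.* ℤ.+ suc d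
  le = ℤ.*-monoˡ-≤-nonNeg (ℤ.+ n) (ℤ.+≤+ (ℕ.s≤s ℕ.z≤n))
arch p@(mkℚ -[1+ n ] d _) = 0 , <⇒≤ (negative⁻¹ p)

inverse : ∀ {p} → 0ℚ < p → ∃ λ q → 0ℚ < q × p * q ≡ 1ℚ
inverse {p} 0<p = 1/_ p , positive⁻¹ (1/ p) {{1/pos⇒pos p}} , *-inverseʳ p
  where
  instance
    p-pos : Positive p
    p-pos = positive 0<p
    p-nz : NonZero p
    p-nz = pos⇒nonZero p

n≤2^n : ∀ n → n ℕ.≤ 2^ n
n≤2^n zero = ℕ.z≤n
n≤2^n (suc n) = subst (suc n ℕ.≤_) (cong (2^ n ℕ.+_) (sym (ℕ.+-identityʳ (2^ n))))
  (ℕ.+-mono-≤ (ℕ.m^n>0 2 n) (n≤2^n n))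

IsCauchy : (ℕ → ℚ) → Set
IsCauchy s = ∀ ε → 0ℚ < ε → ∃ λ N → ∀ m n → N ℕ.≤ m → N ℕ.≤ n → ∣ s m - s n ∣ ≤ ε

-- Real numbers are Cauchy sequences of rationals (with modulus of convergence),
-- considered up to the equality _≃ᴿ_ below; the operations act termwise.
record ℝ : Set where
  constructor mkℝ
  field
    seq    : ℕ → ℚ
    cauchy : IsCauchy seq
open ℝ public

shrink : ∀ {K ε} → 0ℚ ≤ K → 0ℚ < ε → ∃ λ δ → 0ℚ < δ × K * δ ≤ ε
shrink {K} {ε} 0≤K 0<ε =
  let q , 0<q , eq = inverse (<-≤-trans 0<1 (by-diff {1ℚ} {1ℚ + K} K 0≤K refl))
  in q * ε , *-pos 0<q 0<ε , (begin
  K * (q * ε)          ≤⟨ by-diff (q * ε) (<⇒≤ (*-pos 0<q 0<ε)) (assoc K q ε) ⟩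
  (1ℚ + K) * q * ε     ≡⟨ cong (_* ε) eq ⟩
  1ℚ * ε               ≡⟨ *-identityˡ ε ⟩
  ε                    ∎)
  where
  open ≤-Reasoning
  assoc : ∀ K q ε → K * (q * ε) + q * ε ≡ (1ℚ + K) * q * ε
  assoc = solve-∀ ℚ-ring

cauchy-intro : ∀ (s : ℕ → ℚ) K → 0ℚ ≤ K →
  (∀ ε → 0ℚ < ε → ∃ λ N → ∀ n → N ℕ.≤ n → ∣ s n - s N ∣ ≤ K * ε) → IsCauchy s
cauchy-intro s K 0≤K f ε 0<ε =
  let δ , 0<δ , le = shrink {K + K} (+-nn 0≤K 0≤K) 0<ε
      N , close = f δ 0<δ
  in N , λ m n N≤m N≤n → begin
  ∣ s m - s n ∣                  ≤⟨ ∣-∣-tri (s m) (s N) (s n) ⟩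
  ∣ s m - s N ∣ + ∣ s N - s n ∣  ≡⟨ cong (∣ s m - s N ∣ +_) (∣-∣-sym (s N) (s n)) ⟩
  ∣ s m - s N ∣ + ∣ s n - s N ∣  ≤⟨ +-mono-≤ (close m N≤m) (close n N≤n) ⟩
  K * δ + K * δ                  ≡⟨ *-distribʳ-+ δ K K ⟨
  (K + K) * δ                    ≤⟨ le ⟩
  ε                              ∎
  where open ≤-Reasoning

bounded : ∀ s → IsCauchy s → ∃ λ B → 0ℚ ≤ B × ∃ λ N → ∀ n → N ℕ.≤ n → ∣ s n ∣ ≤ B
bounded s c =
  let N , close = c 1ℚ 0<1 in 1ℚ + ∣ s N ∣ , +-nn 0≤1 (0≤∣p∣ (s N)) , N , λ n N≤n → begin
  ∣ s n ∣                ≡⟨ cong ∣_∣ (eq (s n) (s N)) ⟩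
  ∣ s n - s N + s N ∣    ≤⟨ ∣p+q∣≤∣p∣+∣q∣ (s n - s N) (s N) ⟩
  ∣ s n - s N ∣ + ∣ s N ∣ ≤⟨ +-monoˡ-≤ ∣ s N ∣ (close n N N≤n ℕ.≤-refl) ⟩
  1ℚ + ∣ s N ∣           ∎
  where
  open ≤-Reasoning
  eq : ∀ p q → p ≡ p - q + q
  eq = solve-∀ ℚ-ring

h-small : ∀ ε → 0ℚ < ε → ∃ λ N → ∀ n → N ℕ.≤ n → h n ≤ ε
h-small ε 0<ε =
  let q , 0<q , εq≡1 = inverse 0<ε
      N , q≤N = arch q
  in N , λ n N≤n → begin
  h n                   ≤⟨ h-anti N≤n ⟩
  h N                   ≡⟨ *-identityˡ (h N) ⟨
  1ℚ * h N              ≡⟨ cong (_* h N) εq≡1 ⟨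
  ε * q * h N           ≤⟨ *-monoʳ (0≤h N) (*-monoˡ (<⇒≤ 0<ε) q≤N) ⟩
  ε * ι N * h N         ≡⟨ *-assoc ε (ι N) (h N) ⟩
  ε * (ι N * h N)       ≤⟨ *-monoˡ (<⇒≤ 0<ε) (ι*h≤1 N (n≤2^n N)) ⟩
  ε * 1ℚ                ≡⟨ *-identityʳ ε ⟩
  ε                     ∎
  where open ≤-Reasoning

const-cauchy : ∀ p → IsCauchy (λ _ → p)
const-cauchy p ε 0<ε = 0 , λ _ _ _ _ → ≤-trans (≤-reflexive (cong ∣_∣ (+-inverseʳ p))) (<⇒≤ 0<ε)

2ℚ : ℚ
2ℚ = 1ℚ + 1ℚ

0≤2 : 0ℚ ≤ 2ℚ
0≤2 = nonNegative⁻¹ 2ℚ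

+-cauchy : ∀ s t → IsCauchy s → IsCauchy t → IsCauchy (λ n → s n + t n)
+-cauchy s t cs ct = cauchy-intro (λ n → s n + t n) 2ℚ 0≤2 go
  where
  open ≤-Reasoning
  eq : ∀ a b c d → a + b - (c + d) ≡ (a - c) + (b - d)
  eq = solve-∀ ℚ-ring
  go : ∀ ε → 0ℚ < ε → ∃ λ N → ∀ n → N ℕ.≤ n → ∣ s n + t n - (s N + t N) ∣ ≤ 2ℚ * ε
  go ε 0<ε =
   let N₁ , close₁ = cs ε 0<ε
       N₂ , close₂ = ct ε 0<ε
       N = N₁ ℕ.⊔ N₂
       N₁≤N = ℕ.m≤m⊔n N₁ N₂
       N₂≤N = ℕ.m≤n⊔m N₁ N₂
   in N , λ n N≤n → begin
    ∣ s n + t n - (s N + t N) ∣    ≡⟨ cong ∣_∣ (eq (s n) (t n) (s N) (t N)) ⟩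
    ∣ s n - s N + (t n - t N) ∣    ≤⟨ ∣p+q∣≤∣p∣+∣q∣ (s n - s N) (t n - t N) ⟩
    ∣ s n - s N ∣ + ∣ t n - t N ∣  ≤⟨ +-mono-≤ (close₁ n N (ℕ.≤-trans N₁≤N N≤n) N₁≤N)
                                              (close₂ n N (ℕ.≤-trans N₂≤N N≤n) N₂≤N) ⟩
    ε + ε                          ≡⟨ dbl ε ⟩
    2ℚ * ε                         ∎
    where
    dbl : ∀ ε → ε + ε ≡ (1ℚ + 1ℚ) * ε
    dbl = solve-∀ ℚ-ring

neg-cauchy : ∀ s → IsCauchy s → IsCauchy (λ n → - s n)
neg-cauchy s c ε 0<ε = let N , close = c ε 0<ε in N , λ m n N≤m N≤n →
  subst (_≤ ε) (trans (sym (∣-p∣≡∣p∣ (s m - s n))) (cong ∣_∣ (eq (s m) (s n)))) (close m n N≤m N≤n)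
  where
  eq : ∀ a b → - (a - b) ≡ - a - - b
  eq = solve-∀ ℚ-ring

*-cauchy : ∀ s t → IsCauchy s → IsCauchy t → IsCauchy (λ n → s n * t n)
*-cauchy s t cs ct =
  let A , 0≤A , Nₐ , bdₐ = bounded s cs
      B , 0≤B , Nᵦ , bdᵦ = bounded t ct
  in cauchy-intro (λ n → s n * t n) (A + B) (+-nn 0≤A 0≤B) λ ε 0<ε →
  let N₁ , close₁ = cs ε 0<ε
      N₂ , close₂ = ct ε 0<ε
      N = (N₁ ℕ.⊔ N₂) ℕ.⊔ (Nₐ ℕ.⊔ Nᵦ)
      N₁≤N = ℕ.≤-trans (ℕ.m≤m⊔n N₁ N₂) (ℕ.m≤m⊔n (N₁ ℕ.⊔ N₂) (Nₐ ℕ.⊔ Nᵦ))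
      N₂≤N = ℕ.≤-trans (ℕ.m≤n⊔m N₁ N₂) (ℕ.m≤m⊔n (N₁ ℕ.⊔ N₂) (Nₐ ℕ.⊔ Nᵦ))
      Nₐ≤N = ℕ.≤-trans (ℕ.m≤m⊔n Nₐ Nᵦ) (ℕ.m≤n⊔m (N₁ ℕ.⊔ N₂) (Nₐ ℕ.⊔ Nᵦ))
      Nᵦ≤N = ℕ.≤-trans (ℕ.m≤n⊔m Nₐ Nᵦ) (ℕ.m≤n⊔m (N₁ ℕ.⊔ N₂) (Nₐ ℕ.⊔ Nᵦ))
  in N , λ n N≤n → begin
    ∣ s n * t n - s N * t N ∣                            ≡⟨ cong ∣_∣ (eq (s n) (t n) (s N) (t N)) ⟩
    ∣ s n * (t n - t N) + (s n - s N) * t N ∣            ≤⟨ ∣p+q∣≤∣p∣+∣q∣ (s n * (t n - t N)) ((s n - s N) * t N) ⟩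
    ∣ s n * (t n - t N) ∣ + ∣ (s n - s N) * t N ∣        ≡⟨ cong₂ _+_ (∣p*q∣≡∣p∣*∣q∣ (s n) (t n - t N)) (∣p*q∣≡∣p∣*∣q∣ (s n - s N) (t N)) ⟩
    ∣ s n ∣ * ∣ t n - t N ∣ + ∣ s n - s N ∣ * ∣ t N ∣    ≤⟨ +-mono-≤
        (*-mono (0≤∣p∣ (t n - t N)) (0≤∣p∣ (s n)) (bdₐ n (ℕ.≤-trans Nₐ≤N N≤n)) (close₂ n N (ℕ.≤-trans N₂≤N N≤n) N₂≤N))
        (*-mono (0≤∣p∣ (t N)) (0≤∣p∣ (s n - s N)) (close₁ n N (ℕ.≤-trans N₁≤N N≤n) N₁≤N) (bdᵦ N Nᵦ≤N)) ⟩
    A * ε + ε * B                                        ≡⟨ fin A ε B ⟩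
    (A + B) * ε                                          ∎
  where
  open ≤-Reasoning
  eq : ∀ a b c d → a * b - c * d ≡ a * (b - d) + (a - c) * d
  eq = solve-∀ ℚ-ring
  fin : ∀ A ε B → A * ε + ε * B ≡ (A + B) * ε
  fin = solve-∀ ℚ-ring

-- Near ε x y says that |x - y| ≤ ε holds eventually for the rational approximants.
Near : ℚ → ℝ → ℝ → Set
Near ε x y = ∃ λ K → ∀ k → K ℕ.≤ k → ∣ seq x k - seq y k ∣ ≤ ε

infix 4 _≃ᴿ_ _<ᴿ_
_≃ᴿ_ : ℝ → ℝ → Set
x ≃ᴿ y = ∀ ε → 0ℚ < ε → Near ε x y

-- x <ᴿ y provides a positive rational lower bound of y - x.
_<ᴿ_ : ℝ → ℝ → Set
x <ᴿ y = ∃ λ ε → 0ℚ < ε × ∃ λ K → ∀ k → K ℕ.≤ k → seq x k + ε ≤ seq y k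

fromℚ : ℚ → ℝ
fromℚ p = mkℝ (λ _ → p) (const-cauchy p)

ℝ-rawRing : RawRing 0ℓ 0ℓ
ℝ-rawRing = record
  { Carrier = ℝ
  ; _≈_ = _≃ᴿ_
  ; _+_ = λ x y → mkℝ (λ k → seq x k + seq y k) (+-cauchy (seq x) (seq y) (cauchy x) (cauchy y))
  ; _*_ = λ x y → mkℝ (λ k → seq x k * seq y k) (*-cauchy (seq x) (seq y) (cauchy x) (cauchy y))
  ; -_  = λ x → mkℝ (λ k → - seq x k) (neg-cauchy (seq x) (cauchy x))
  ; 0#  = fromℚ 0ℚ
  ; 1#  = fromℚ 1ℚ
  }

IsCauchyᴿ : (ℕ → ℝ) → Set
IsCauchyᴿ x = ∀ ε → 0ℚ < ε → ∃ λ N → ∀ m n → N ℕ.≤ m → N ℕ.≤ n → Near ε (x m) (x n)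

_⟶_ : (ℕ → ℝ) → ℝ → Set
x ⟶ l = ∀ ε → 0ℚ < ε → ∃ λ N → ∀ n → N ℕ.≤ n → Near ε (x n) l

0<h : ∀ k → 0ℚ < h k
0<h zero = 0<1
0<h (suc k) = *-pos (positive⁻¹ ½) (0<h k)

module Lim (x : ℕ → ℝ) (c : IsCauchyᴿ x) where
  N : ℕ → ℕ
  N k = proj₁ (c (h k) (0<h k))
  M : ℕ → ℕ
  M k = proj₁ (cauchy (x (N k)) (h k) (0<h k))

  l : ℕ → ℚ
  l k = seq (x (N k)) (M k)

  near : ∀ k m → N k ℕ.≤ m → ∃ λ P → ∀ p → P ℕ.≤ p → ∣ l k - seq (x m) p ∣ ≤ 2ℚ * h k
  near k m Nk≤m =
   let Q , close = proj₂ (c (h k) (0<h k)) (N k) m ℕ.≤-refl Nk≤m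
   in M k ℕ.⊔ Q , λ p P≤p → begin
    ∣ l k - seq (x m) p ∣                                        ≤⟨ ∣-∣-tri (l k) (seq (x (N k)) p) (seq (x m) p) ⟩
    ∣ l k - seq (x (N k)) p ∣ + ∣ seq (x (N k)) p - seq (x m) p ∣ ≤⟨ +-mono-≤
       (proj₂ (cauchy (x (N k)) (h k) (0<h k)) (M k) p ℕ.≤-refl (ℕ.≤-trans (ℕ.m≤m⊔n (M k) Q) P≤p))
       (close p (ℕ.≤-trans (ℕ.m≤n⊔m (M k) Q) P≤p)) ⟩
    h k + h k                                                    ≡⟨ dbl (h k) ⟩
    2ℚ * h k                                                     ∎
    where
    open ≤-Reasoning
    dbl : ∀ ε → ε + ε ≡ (1ℚ + 1ℚ) * ε
    dbl = solve-∀ ℚ-ring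

  close : ∀ j k → ∣ l j - l k ∣ ≤ 2ℚ * h j + 2ℚ * h k
  close j k =
   let P , f = near j (N j ℕ.⊔ N k) (ℕ.m≤m⊔n (N j) (N k))
       Q , g = near k (N j ℕ.⊔ N k) (ℕ.m≤n⊔m (N j) (N k))
       y = seq (x (N j ℕ.⊔ N k)) (P ℕ.⊔ Q)
   in begin
    ∣ l j - l k ∣              ≤⟨ ∣-∣-tri (l j) y (l k) ⟩
    ∣ l j - y ∣ + ∣ y - l k ∣  ≡⟨ cong (∣ l j - y ∣ +_) (∣-∣-sym y (l k)) ⟩
    ∣ l j - y ∣ + ∣ l k - y ∣  ≤⟨ +-mono-≤ (f (P ℕ.⊔ Q) (ℕ.m≤m⊔n P Q)) (g (P ℕ.⊔ Q) (ℕ.m≤n⊔m P Q)) ⟩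
    2ℚ * h j + 2ℚ * h k        ∎
    where
    open ≤-Reasoning

  l-cauchy : IsCauchy l
  l-cauchy = cauchy-intro l (2ℚ + 2ℚ) (nonNegative⁻¹ (2ℚ + 2ℚ)) go
    where
    open ≤-Reasoning
    go : ∀ ε → 0ℚ < ε → ∃ λ N → ∀ n → N ℕ.≤ n → ∣ l n - l N ∣ ≤ (2ℚ + 2ℚ) * ε
    go ε 0<ε = let N , small = h-small ε 0<ε in N , λ n N≤n → begin
      ∣ l n - l N ∣        ≤⟨ close n N ⟩
      2ℚ * h n + 2ℚ * h N  ≤⟨ +-mono-≤ (*-monoˡ 0≤2 (small n N≤n)) (*-monoˡ 0≤2 (small N ℕ.≤-refl)) ⟩
      2ℚ * ε + 2ℚ * ε      ≡⟨ *-distribʳ-+ ε 2ℚ 2ℚ ⟨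
      (2ℚ + 2ℚ) * ε        ∎

-- The limit of a Cauchy sequence of reals; lim-correct shows that it is one.
lim : (x : ℕ → ℝ) → IsCauchyᴿ x → ℝ
lim x c = mkℝ (Lim.l x c) (Lim.l-cauchy x c)

lim-correct : ∀ x c → x ⟶ lim x c
lim-correct x c ε 0<ε =
  let δ , 0<δ , le = shrink {2ℚ + (2ℚ + 2ℚ)} {ε} (nonNegative⁻¹ (2ℚ + (2ℚ + 2ℚ))) 0<ε
      K , small = h-small δ 0<δ
  in N K , λ m NK≤m → let P , f = near K m NK≤m in P ℕ.⊔ K , λ p P≤p → begin
    ∣ seq (x m) p - l p ∣              ≤⟨ ∣-∣-tri (seq (x m) p) (l K) (l p) ⟩
    ∣ seq (x m) p - l K ∣ + ∣ l K - l p ∣  ≡⟨ cong (_+ ∣ l K - l p ∣) (∣-∣-sym (seq (x m) p) (l K)) ⟩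
    ∣ l K - seq (x m) p ∣ + ∣ l K - l p ∣  ≤⟨ +-mono-≤ (f p (ℕ.≤-trans (ℕ.m≤m⊔n P K) P≤p)) (close K p) ⟩
    2ℚ * h K + (2ℚ * h K + 2ℚ * h p)   ≤⟨ +-mono-≤ (*-monoˡ 0≤2 (small K ℕ.≤-refl)) (+-mono-≤ (*-monoˡ 0≤2 (small K ℕ.≤-refl)) (*-monoˡ 0≤2 (small p (ℕ.≤-trans (ℕ.m≤n⊔m P K) P≤p)))) ⟩
    2ℚ * δ + (2ℚ * δ + 2ℚ * δ)         ≡⟨ six 2ℚ δ ⟩
    (2ℚ + (2ℚ + 2ℚ)) * δ ≤⟨ le ⟩
    ε ∎
  where
  open ≤-Reasoning
  open Lim x c
  six : ∀ a δ → a * δ + (a * δ + a * δ) ≡ (a + (a + a)) * δ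
  six = solve-∀ ℚ-ring

record Complex (A : Set) : Set where
  constructor _+i_
  field
    re im : A
open Complex public

complexRawRing : RawRing 0ℓ 0ℓ → RawRing 0ℓ 0ℓ
complexRawRing R = record
  { Carrier = Complex Carrier
  ; _≈_ = λ z w → re z ≈ᴿ re w × im z ≈ᴿ im w
  ; _+_ = λ z w → (re z +ᴿ re w) +i (im z +ᴿ im w)
  ; _*_ = λ z w → (re z *ᴿ re w +ᴿ -ᴿ (im z *ᴿ im w)) +i (re z *ᴿ im w +ᴿ im z *ᴿ re w)
  ; -_  = λ z → (-ᴿ re z) +i (-ᴿ im z)
  ; 0#  = 0# +i 0#
  ; 1#  = 1# +i 0#
  }
  where open RawRing R renaming (_≈_ to _≈ᴿ_; _+_ to _+ᴿ_; _*_ to _*ᴿ_; -_ to -ᴿ_)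

module Summation (M : RawMonoid 0ℓ 0ℓ) where
  open RawMonoid M
  ∑< : ℕ → (ℕ → Carrier) → Carrier
  ∑< zero    a = ε
  ∑< (suc n) a = ∑< n a ∙ a n

open RawRing (complexRawRing +-*-rawRing) using () renaming (_+_ to _+ⁱ_; _*_ to _*ⁱ_; -_ to -ⁱ_)
open RawSemiringDefs (RawRing.rawSemiring (complexRawRing +-*-rawRing)) using () renaming (_^_ to _^ⁱ_)

infixl 6 _-ⁱ_
_-ⁱ_ : Complex ℚ → Complex ℚ → Complex ℚ
z -ⁱ w = z +ⁱ (-ⁱ w)

ℚ[i] : Set
ℚ[i] = Complex ℚ

N1 : ℚ[i] → ℚ
N1 z = ∣ re z ∣ + ∣ im z ∣

0≤N1 : ∀ z → 0ℚ ≤ N1 z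
0≤N1 z = +-nn (0≤∣p∣ (re z)) (0≤∣p∣ (im z))

N1-+ : ∀ z w → N1 (z +ⁱ w) ≤ N1 z + N1 w
N1-+ (a +i b) (c +i d) = ≤-trans
  (+-mono-≤ (∣p+q∣≤∣p∣+∣q∣ a c) (∣p+q∣≤∣p∣+∣q∣ b d))
  (≤-reflexive (eq (∣ a ∣) (∣ b ∣) (∣ c ∣) (∣ d ∣)))
  where
  eq : ∀ a b c d → a + c + (b + d) ≡ a + b + (c + d)
  eq = solve-∀ ℚ-ring

N1-* : ∀ z w → N1 (z *ⁱ w) ≤ N1 z * N1 w
N1-* (a +i b) (c +i d) = begin
  ∣ a * c - b * d ∣ + ∣ a * d + b * c ∣  ≤⟨ +-mono-≤ (∣p-q∣≤∣p∣+∣q∣ (a * c) (b * d)) (∣p+q∣≤∣p∣+∣q∣ (a * d) (b * c)) ⟩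
  ∣ a * c ∣ + ∣ b * d ∣ + (∣ a * d ∣ + ∣ b * c ∣) ≡⟨ cong₂ _+_ (cong₂ _+_ (∣p*q∣≡∣p∣*∣q∣ a c) (∣p*q∣≡∣p∣*∣q∣ b d)) (cong₂ _+_ (∣p*q∣≡∣p∣*∣q∣ a d) (∣p*q∣≡∣p∣*∣q∣ b c)) ⟩
  ∣ a ∣ * ∣ c ∣ + ∣ b ∣ * ∣ d ∣ + (∣ a ∣ * ∣ d ∣ + ∣ b ∣ * ∣ c ∣) ≡⟨ eq (∣ a ∣) (∣ b ∣) (∣ c ∣) (∣ d ∣) ⟩
  (∣ a ∣ + ∣ b ∣) * (∣ c ∣ + ∣ d ∣) ∎
  where
  open ≤-Reasoning
  eq : ∀ a b c d → a * c + b * d + (a * d + b * c) ≡ (a + b) * (c + d)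
  eq = solve-∀ ℚ-ring

N1-neg : ∀ z → N1 (-ⁱ z) ≡ N1 z
N1-neg z = cong₂ _+_ (∣-p∣≡∣p∣ (re z)) (∣-p∣≡∣p∣ (im z))

N1-^ : ∀ z M n → N1 z ≤ M → N1 (z ^ⁱ n) ≤ M ^ n
N1-^ z M zero le = ≤-refl
N1-^ z M (suc n) le = ≤-trans (N1-* z (z ^ⁱ n))
  (*-mono (0≤N1 (z ^ⁱ n)) (0≤N1 z) le (N1-^ z M n le))

dist : ℚ[i] → ℚ[i] → ℚ
dist z w = N1 (z -ⁱ w)

dist-tri : ∀ u v w → dist u w ≤ dist u v + dist v w
dist-tri u v w = begin
  ∣ re u - re w ∣ + ∣ im u - im w ∣ ≤⟨ +-mono-≤ (∣-∣-tri (re u) (re v) (re w)) (∣-∣-tri (im u) (im v) (im w)) ⟩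
  (∣ re u - re v ∣ + ∣ re v - re w ∣) + (∣ im u - im v ∣ + ∣ im v - im w ∣) ≡⟨ eq (∣ re u - re v ∣) (∣ re v - re w ∣) (∣ im u - im v ∣) (∣ im v - im w ∣) ⟩
  dist u v + dist v w ∎
  where
  open ≤-Reasoning
  eq : ∀ a b c d → a + b + (c + d) ≡ a + c + (b + d)
  eq = solve-∀ ℚ-ring

pow-diff : ∀ a b M → 1ℚ ≤ M → N1 a ≤ M → N1 b ≤ M → ∀ n →
  dist (a ^ⁱ n) (b ^ⁱ n) ≤ ι n * M ^ n * dist a b
pow-diff a b M 1≤M a≤M b≤M zero = by-diff 0ℚ ≤-refl (eq (dist a b))
  where
  eq : ∀ p → 0ℚ + 0ℚ ≡ 0ℚ * 1ℚ * p
  eq = solve-∀ ℚ-ring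
pow-diff a b M 1≤M a≤M b≤M (suc n) = begin
  dist (a *ⁱ A) (b *ⁱ B)                        ≡⟨ cong₂ (λ x y → ∣ x ∣ + ∣ y ∣)
                                                    (eq-re (re a) (im a) (re b) (im b) (re A) (im A) (re B) (im B))
                                                    (eq-im (re a) (im a) (re b) (im b) (re A) (im A) (re B) (im B)) ⟩
  N1 (a *ⁱ (A -ⁱ B) +ⁱ (a -ⁱ b) *ⁱ B)           ≤⟨ N1-+ (a *ⁱ (A -ⁱ B)) ((a -ⁱ b) *ⁱ B) ⟩
  N1 (a *ⁱ (A -ⁱ B)) + N1 ((a -ⁱ b) *ⁱ B)       ≤⟨ +-mono-≤ (N1-* a (A -ⁱ B)) (N1-* (a -ⁱ b) B) ⟩
  N1 a * dist A B + δ * N1 B                    ≤⟨ +-mono-≤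
      (*-mono (0≤N1 (A -ⁱ B)) (0≤N1 a) a≤M (pow-diff a b M 1≤M a≤M b≤M n))
      (*-monoˡ 0≤δ (N1-^ b M n b≤M)) ⟩
  M * (ι n * P * δ) + δ * P                     ≤⟨ by-diff _ (*-nn (*-nn (diff 1≤M) (^-nn n 0≤M)) 0≤δ) (fin M (ι n) P δ) ⟩
  (1ℚ + ι n) * (M * P) * δ                      ∎
  where
  open ≤-Reasoning
  A = a ^ⁱ n
  B = b ^ⁱ n
  P = M ^ n
  δ = dist a b
  0≤M : 0ℚ ≤ M
  0≤M = ≤-trans 0≤1 1≤M
  0≤δ : 0ℚ ≤ δ
  0≤δ = 0≤N1 (a -ⁱ b)
  eq-re : ∀ a a' b b' A A' B B' → a * A - a' * A' - (b * B - b' * B') ≡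
    (a * (A - B) - a' * (A' - B')) + ((a - b) * B - (a' - b') * B')
  eq-re = solve-∀ ℚ-ring
  eq-im : ∀ a a' b b' A A' B B' → a * A' + a' * A - (b * B' + b' * B) ≡
    (a * (A' - B') + a' * (A - B)) + ((a - b) * B' + (a' - b') * B)
  eq-im = solve-∀ ℚ-ring
  fin : ∀ M x P δ → M * (x * P * δ) + δ * P + (M - 1ℚ) * P * δ ≡ (1ℚ + x) * (M * P) * δ
  fin = solve-∀ ℚ-ring

½^*2^ : ∀ J → ½ ^ J * 2ℚ ^ J ≡ 1ℚ
½^*2^ J = trans (sym (*-^ ½ 2ℚ J)) (one J)
  where
  one : ∀ J → 1ℚ ^ J ≡ 1ℚ
  one zero = refl
  one (suc J) = trans (*-identityˡ _) (one J)

exp-bound : ∀ B → 0ℚ ≤ B → ∃ λ j → ∃ λ C → 0ℚ ≤ C × ∀ d →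
  (1ℚ + B * h (j ℕ.+ d)) ^ (2^ (j ℕ.+ d)) ≤ C
exp-bound B 0≤B = let b , B≤b = arch B in suc b , 2ℚ ^ (2^ suc b) , ^-nn (2^ suc b) 0≤2 , go b B≤b
  where
  open ≤-Reasoning
  go : ∀ b → B ≤ ι b → ∀ d → (1ℚ + B * h (suc b ℕ.+ d)) ^ (2^ (suc b ℕ.+ d)) ≤ 2ℚ ^ (2^ suc b)
  go b B≤b d = begin
    (1ℚ + u) ^ N                     ≡⟨ *-identityʳ _ ⟨
    (1ℚ + u) ^ N * 1ℚ                ≡⟨ cong ((1ℚ + u) ^ N *_) (½^*2^ J) ⟨
    (1ℚ + u) ^ N * (½ ^ J * 2ℚ ^ J)  ≡⟨ *-assoc ((1ℚ + u) ^ N) (½ ^ J) (2ℚ ^ J) ⟨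
    (1ℚ + u) ^ N * ½ ^ J * 2ℚ ^ J    ≤⟨ *-monoʳ (^-nn J 0≤2) (*-monoˡ (^-nn N 0≤1+u) half) ⟩
    (1ℚ + u) ^ N * (1ℚ + - u) ^ N * 2ℚ ^ J ≡⟨ cong (_* 2ℚ ^ J) (*-^ (1ℚ + u) (1ℚ + - u) N) ⟨
    ((1ℚ + u) * (1ℚ + - u)) ^ N * 2ℚ ^ J   ≤⟨ *-monoʳ (^-nn J 0≤2) (≤1-^ N (*-nn 0≤1+u 0≤1-u) (by-diff (u * u) (sq-nn u) (sq u))) ⟩
    1ℚ * 2ℚ ^ J                      ≡⟨ *-identityˡ _ ⟩
    2ℚ ^ J                           ∎
    where
    J = 2^ suc b
    N = 2^ (suc b ℕ.+ d)
    u = B * h (suc b ℕ.+ d)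
    0≤u : 0ℚ ≤ u
    0≤u = *-nn 0≤B (0≤h (suc b ℕ.+ d))
    Bh≤½ : B * h (suc b) ≤ ½
    Bh≤½ = begin
      B * (½ * h b)  ≡⟨ e B ½ (h b) ⟩
      ½ * (B * h b)  ≤⟨ *-monoˡ 0≤½ (≤-trans (*-monoʳ (0≤h b) B≤b) (ι*h≤1 b (n≤2^n b))) ⟩
      ½ * 1ℚ         ≡⟨ *-identityʳ ½ ⟩
      ½              ∎
      where
      e : ∀ a b c → a * (b * c) ≡ b * (a * c)
      e = solve-∀ ℚ-ring
    u-eq : ι (2^ d) * u ≡ B * h (suc b)
    u-eq = begin-equality
      ι (2^ d) * (B * h (suc b ℕ.+ d))     ≡⟨ cong (λ x → ι (2^ d) * (B * x)) (^-+ ½ (suc b) d) ⟩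
      ι (2^ d) * (B * (h (suc b) * h d))   ≡⟨ e (ι (2^ d)) B (h (suc b)) (h d) ⟩
      (ι (2^ d) * h d) * (B * h (suc b))   ≡⟨ cong (_* (B * h (suc b))) (2^*h d) ⟩
      1ℚ * (B * h (suc b))                 ≡⟨ *-identityˡ _ ⟩
      B * h (suc b)                        ∎
      where
      e : ∀ x B p q → x * (B * (p * q)) ≡ (x * q) * (B * p)
      e = solve-∀ ℚ-ring
    u≤½ : u ≤ ½
    u≤½ = ≤-trans (*-monoˡ 0≤B (h-anti (ℕ.m≤m+n (suc b) d))) Bh≤½
    0≤1+u : 0ℚ ≤ 1ℚ + u
    0≤1+u = +-nn 0≤1 0≤u
    0≤1-u : 0ℚ ≤ 1ℚ + - u
    0≤1-u = diff (≤-trans u≤½ (by-diff ½ 0≤½ refl))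
    sq : ∀ u → (1ℚ + u) * (1ℚ + - u) + u * u ≡ 1ℚ
    sq = solve-∀ ℚ-ring
    one-half : ½ ≤ (1ℚ + - u) ^ (2^ d)
    one-half = begin
      ½                         ≤⟨ by-diff (½ - B * h (suc b)) (diff Bh≤½) (e (B * h (suc b))) ⟩
      1ℚ + - (B * h (suc b))    ≡⟨ cong (λ x → 1ℚ + - x) u-eq ⟨
      1ℚ + - (ι (2^ d) * u)     ≡⟨ cong (1ℚ +_) (neg-distribʳ-* (ι (2^ d)) u) ⟩
      1ℚ + ι (2^ d) * - u       ≤⟨ bernoulli (- u) (2^ d) 0≤1-u ⟩
      (1ℚ + - u) ^ (2^ d)       ∎
      where
      e : ∀ x → ½ + (½ - x) ≡ 1ℚ + - x
      e = solve-∀ ℚ-ring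
    half : ½ ^ J ≤ (1ℚ + - u) ^ N
    half = begin
      ½ ^ J                               ≤⟨ ^-mono J 0≤½ one-half ⟩
      ((1ℚ + - u) ^ (2^ d)) ^ J           ≡⟨ ^-* (1ℚ + - u) J (2^ d) ⟨
      (1ℚ + - u) ^ (J ℕ.* (2^ d))         ≡⟨ cong ((1ℚ + - u) ^_) (ℕ.^-distribˡ-+-* 2 (suc b) d) ⟨
      (1ℚ + - u) ^ N                      ∎

lin : ℕ → ℚ[i] → ℚ[i]
lin k z = (1ℚ + h k * re z) +i (h k * im z)

-- E k z = (1 + z / 2ᵏ) ^ 2ᵏ, since h k = 2⁻ᵏ.
E : ℕ → ℚ[i] → ℚ[i]
E k z = lin k z ^ⁱ (2^ k)

N1-lin : ∀ k z B → N1 z ≤ B → N1 (lin k z) ≤ 1ℚ + B * h k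
N1-lin k z B z≤B = begin
  ∣ 1ℚ + h k * re z ∣ + ∣ h k * im z ∣  ≤⟨ +-monoˡ-≤ ∣ h k * im z ∣ (∣p+q∣≤∣p∣+∣q∣ 1ℚ (h k * re z)) ⟩
  1ℚ + ∣ h k * re z ∣ + ∣ h k * im z ∣  ≡⟨ cong₂ (λ x y → 1ℚ + x + y) (habs (re z)) (habs (im z)) ⟩
  1ℚ + h k * ∣ re z ∣ + h k * ∣ im z ∣  ≡⟨ eq (h k) (∣ re z ∣) (∣ im z ∣) ⟩
  1ℚ + N1 z * h k                       ≤⟨ +-monoʳ-≤ 1ℚ (*-monoʳ (0≤h k) z≤B) ⟩
  1ℚ + B * h k                          ∎
  where
  open ≤-Reasoning
  habs : ∀ p → ∣ h k * p ∣ ≡ h k * ∣ p ∣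
  habs p = trans (∣p*q∣≡∣p∣*∣q∣ (h k) p) (cong (_* ∣ p ∣) (0≤p⇒∣p∣≡p (0≤h k)))
  eq : ∀ h a b → 1ℚ + h * a + h * b ≡ 1ℚ + (a + b) * h
  eq = solve-∀ ℚ-ring

*ⁱ-assoc : ∀ a b c → (a *ⁱ b) *ⁱ c ≡ a *ⁱ (b *ⁱ c)
*ⁱ-assoc a b c = cong₂ _+i_
  (e₁ (re a) (im a) (re b) (im b) (re c) (im c)) (e₂ (re a) (im a) (re b) (im b) (re c) (im c))
  where
  e₁ : ∀ a a' b b' c c' → (a * b - a' * b') * c - (a * b' + a' * b) * c' ≡ a * (b * c - b' * c') - a' * (b * c' + b' * c)
  e₁ = solve-∀ ℚ-ring
  e₂ : ∀ a a' b b' c c' → (a * b - a' * b') * c' + (a * b' + a' * b) * c ≡ a * (b * c' + b' * c) + a' * (b * c - b' * c')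
  e₂ = solve-∀ ℚ-ring

^ⁱ-double : ∀ z n → z ^ⁱ (2 ℕ.* n) ≡ (z *ⁱ z) ^ⁱ n
^ⁱ-double z zero = refl
^ⁱ-double z (suc n) = begin
  z *ⁱ z ^ⁱ (n ℕ.+ suc (n ℕ.+ 0))    ≡⟨ cong (λ m → z *ⁱ z ^ⁱ m) (ℕ.+-suc n (n ℕ.+ 0)) ⟩
  z *ⁱ (z *ⁱ z ^ⁱ (2 ℕ.* n))         ≡⟨ *ⁱ-assoc z z _ ⟨
  (z *ⁱ z) *ⁱ z ^ⁱ (2 ℕ.* n)         ≡⟨ cong ((z *ⁱ z) *ⁱ_) (^ⁱ-double z n) ⟩
  (z *ⁱ z) *ⁱ (z *ⁱ z) ^ⁱ n          ∎
  where open ≡-Reasoning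

telescope : (δ : ℕ → ℕ → ℚ) → (∀ l m n → δ l n ≤ δ l m + δ m n) → (∀ n → δ n n ≤ 0ℚ) →
  ∀ K j → (∀ k → j ℕ.≤ k → δ (suc k) k ≤ K * h k) →
  ∀ k d → j ℕ.≤ k → δ (d ℕ.+ k) k ≤ 2ℚ * K * (h k - h (d ℕ.+ k))
telescope δ tri δ-refl K j step k zero j≤k = ≤-trans (δ-refl k) (≤-reflexive (eq K (h k)))
  where
  eq : ∀ K h → 0ℚ ≡ (1ℚ + 1ℚ) * K * (h - h)
  eq = solve-∀ ℚ-ring
telescope δ tri δ-refl K j step k (suc d) j≤k = begin
  δ (suc (d ℕ.+ k)) k                                ≤⟨ tri (suc (d ℕ.+ k)) (d ℕ.+ k) k ⟩
  δ (suc (d ℕ.+ k)) (d ℕ.+ k) + δ (d ℕ.+ k) k        ≤⟨ +-mono-≤ (step (d ℕ.+ k) (ℕ.≤-trans j≤k (ℕ.m≤n+m k d))) (telescope δ tri δ-refl K j step k d j≤k) ⟩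
  K * h (d ℕ.+ k) + 2ℚ * K * (h k - h (d ℕ.+ k))     ≡⟨ eq K (h (d ℕ.+ k)) (h k) ⟩
  2ℚ * K * (h k - ½ * h (d ℕ.+ k))                   ∎
  where
  open ≤-Reasoning
  eq : ∀ K x y → K * x + (1ℚ + 1ℚ) * K * (y - x) ≡ (1ℚ + 1ℚ) * K * (y - ½ * x)
  eq = solve-∀ ℚ-ring

telescope′ : (δ : ℕ → ℕ → ℚ) → (∀ l m n → δ l n ≤ δ l m + δ m n) → (∀ n → δ n n ≤ 0ℚ) →
  ∀ K j → 0ℚ ≤ K → (∀ k → j ℕ.≤ k → δ (suc k) k ≤ K * h k) →
  ∀ n k → j ℕ.≤ k → k ℕ.≤ n → δ n k ≤ 2ℚ * K * h k
telescope′ δ tri δ-refl K j 0≤K step n k j≤k k≤n = begin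
  δ n k                               ≡⟨ cong (λ m → δ m k) (ℕ.m∸n+n≡m k≤n) ⟨
  δ (n ℕ.∸ k ℕ.+ k) k                 ≤⟨ telescope δ tri δ-refl K j step k (n ℕ.∸ k) j≤k ⟩
  2ℚ * K * (h k - h (n ℕ.∸ k ℕ.+ k))  ≤⟨ *-monoˡ (*-nn 0≤2 0≤K) (by-diff (h (n ℕ.∸ k ℕ.+ k)) (0≤h (n ℕ.∸ k ℕ.+ k)) (eq (h k) _)) ⟩
  2ℚ * K * h k                        ∎
  where
  open ≤-Reasoning
  eq : ∀ x y → x - y + y ≡ x
  eq = solve-∀ ℚ-ring

dist-refl : ∀ z → dist z z ≤ 0ℚ
dist-refl z = ≤-reflexive (trans (cong₂ (λ x y → ∣ x ∣ + ∣ y ∣) (+-inverseʳ (re z)) (+-inverseʳ (im z))) refl)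

module ExpCauchy (s : ℕ → ℚ[i]) (B : ℚ) (0≤B : 0ℚ ≤ B) (j : ℕ) (C : ℚ) (0≤C : 0ℚ ≤ C)
  (bd : ∀ d → (1ℚ + B * h (j ℕ.+ d)) ^ (2^ (j ℕ.+ d)) ≤ C) where
  open ≤-Reasoning

  bd′ : ∀ k → j ℕ.≤ k → (1ℚ + B * h k) ^ (2^ k) ≤ C
  bd′ k j≤k = subst (λ k → (1ℚ + B * h k) ^ (2^ k) ≤ C) (ℕ.m+[n∸m]≡n j≤k) (bd (k ℕ.∸ j))

  lip : ∀ k → j ℕ.≤ k → ∀ z w → N1 z ≤ B → N1 w ≤ B → dist (E k z) (E k w) ≤ C * dist z w
  lip k j≤k z w z≤B w≤B = begin
    dist (E k z) (E k w)                             ≤⟨ pow-diff (lin k z) (lin k w) M (by-diff (B * h k) (*-nn 0≤B (0≤h k)) refl)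
                                                         (N1-lin k z B z≤B) (N1-lin k w B w≤B) (2^ k) ⟩
    ι (2^ k) * M ^ (2^ k) * dist (lin k z) (lin k w) ≡⟨ cong (ι (2^ k) * M ^ (2^ k) *_) dist-lin ⟩
    ι (2^ k) * M ^ (2^ k) * (h k * dist z w)         ≡⟨ e (ι (2^ k)) (M ^ (2^ k)) (h k) (dist z w) ⟩
    (ι (2^ k) * h k) * (M ^ (2^ k) * dist z w)       ≡⟨ cong (_* (M ^ (2^ k) * dist z w)) (2^*h k) ⟩
    1ℚ * (M ^ (2^ k) * dist z w)                     ≡⟨ *-identityˡ (M ^ (2^ k) * dist z w) ⟩
    M ^ (2^ k) * dist z w                            ≤⟨ *-monoʳ (0≤N1 (z -ⁱ w)) (bd′ k j≤k) ⟩
    C * dist z w                                     ∎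
    where
    M = 1ℚ + B * h k
    e : ∀ n m h d → n * m * (h * d) ≡ (n * h) * (m * d)
    e = solve-∀ ℚ-ring
    e₁ : ∀ h a b → 1ℚ + h * a - (1ℚ + h * b) ≡ h * (a - b)
    e₁ = solve-∀ ℚ-ring
    e₂ : ∀ h a b → h * a - h * b ≡ h * (a - b)
    e₂ = solve-∀ ℚ-ring
    habs : ∀ p → ∣ h k * p ∣ ≡ h k * ∣ p ∣
    habs p = trans (∣p*q∣≡∣p∣*∣q∣ (h k) p) (cong (_* ∣ p ∣) (0≤p⇒∣p∣≡p (0≤h k)))
    dist-lin : dist (lin k z) (lin k w) ≡ h k * dist z w
    dist-lin = trans (cong₂ _+_ (trans (cong ∣_∣ (e₁ (h k) (re z) (re w))) (habs (re z - re w)))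
                                (trans (cong ∣_∣ (e₂ (h k) (im z) (im w))) (habs (im z - im w))))
                     (sym (*-distribˡ-+ (h k) _ _))

  step : ∀ z → N1 z ≤ B → ∀ k → j ℕ.≤ k → dist (E (suc k) z) (E k z) ≤ C * (B * B) * h k
  step z z≤B k j≤k = begin
    dist (E (suc k) z) (E k z)                          ≡⟨ cong (λ x → dist x (E k z)) (^ⁱ-double c (2^ k)) ⟩
    dist ((c *ⁱ c) ^ⁱ (2^ k)) (E k z)                   ≤⟨ pow-diff (c *ⁱ c) b M 1≤M cc≤M b≤M (2^ k) ⟩
    ι (2^ k) * M ^ (2^ k) * dist (c *ⁱ c) b             ≤⟨ *-mono (0≤N1 (c *ⁱ c -ⁱ b)) (*-nn (0≤ι (2^ k)) (^-nn (2^ k) (≤-trans 0≤1 1≤M)))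
                                                             (*-monoˡ (0≤ι (2^ k)) M^≤C) cc-b ⟩
    ι (2^ k) * C * (h′ * h′ * (B * B))                  ≡⟨ e (ι (2^ k)) C (h k) B ⟩
    (ι (2^ k) * h k) * (C * (B * B) * (½ * (½ * h k)))  ≡⟨ cong (_* (C * (B * B) * (½ * (½ * h k)))) (2^*h k) ⟩
    1ℚ * (C * (B * B) * (½ * (½ * h k)))                ≡⟨ *-identityˡ _ ⟩
    C * (B * B) * h (2 ℕ.+ k)                           ≤⟨ *-monoˡ (*-nn 0≤C (*-nn 0≤B 0≤B)) (h-anti (ℕ.m≤n+m k 2)) ⟩
    C * (B * B) * h k                                   ∎
    where
    h′ = h (suc k)
    c = lin (suc k) z
    b = lin k z
    m = 1ℚ + B * h′
    M = m * m
    1≤m : 1ℚ ≤ m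
    1≤m = by-diff (B * h′) (*-nn 0≤B (0≤h (suc k))) refl
    1≤M : 1ℚ ≤ M
    1≤M = *-mono 0≤1 0≤1 1≤m 1≤m
    cc≤M : N1 (c *ⁱ c) ≤ M
    cc≤M = ≤-trans (N1-* c c) (*-mono (0≤N1 c) (0≤N1 c) (N1-lin (suc k) z B z≤B) (N1-lin (suc k) z B z≤B))
    b≤M : N1 b ≤ M
    b≤M = ≤-trans (N1-lin k z B z≤B) (by-diff _ (sq-nn (B * h′)) (e₀ B (h k)))
      where
      e₀ : ∀ B h → 1ℚ + B * h + B * (½ * h) * (B * (½ * h)) ≡ (1ℚ + B * (½ * h)) * (1ℚ + B * (½ * h))
      e₀ = solve-∀ ℚ-ring
    M^≤C : M ^ (2^ k) ≤ C
    M^≤C = begin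
      (m * m) ^ (2^ k)           ≡⟨ *-^ m m (2^ k) ⟩
      m ^ (2^ k) * m ^ (2^ k)    ≡⟨ ^-+ m (2^ k) (2^ k) ⟨
      m ^ (2^ k ℕ.+ 2^ k)        ≡⟨ cong (λ n → m ^ (2^ k ℕ.+ n)) (ℕ.+-identityʳ (2^ k)) ⟨
      m ^ (2^ suc k)             ≤⟨ bd′ (suc k) (ℕ.m≤n⇒m≤1+n j≤k) ⟩
      C                          ∎
    r₁ : ∀ h a b → (1ℚ + ½ * h * a) * (1ℚ + ½ * h * a) - (½ * h * b) * (½ * h * b) - (1ℚ + h * a) ≡ ½ * h * (½ * h) * (a * a - b * b)
    r₁ = solve-∀ ℚ-ring
    r₂ : ∀ h a b → (1ℚ + ½ * h * a) * (½ * h * b) + (½ * h * b) * (1ℚ + ½ * h * a) - h * b ≡ ½ * h * (½ * h) * (a * b + b * a)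
    r₂ = solve-∀ ℚ-ring
    habs : ∀ p → ∣ h′ * h′ * p ∣ ≡ h′ * h′ * ∣ p ∣
    habs p = trans (∣p*q∣≡∣p∣*∣q∣ (h′ * h′) p) (cong (_* ∣ p ∣) (0≤p⇒∣p∣≡p (*-nn (0≤h (suc k)) (0≤h (suc k)))))
    cc-b : dist (c *ⁱ c) b ≤ h′ * h′ * (B * B)
    cc-b = begin
      dist (c *ⁱ c) b            ≡⟨ cong₂ _+_ (trans (cong ∣_∣ (r₁ (h k) (re z) (im z))) (habs (re (z *ⁱ z))))
                                              (trans (cong ∣_∣ (r₂ (h k) (re z) (im z))) (habs (im (z *ⁱ z)))) ⟩
      h′ * h′ * ∣ re (z *ⁱ z) ∣ + h′ * h′ * ∣ im (z *ⁱ z) ∣ ≡⟨ *-distribˡ-+ (h′ * h′) _ _ ⟨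
      h′ * h′ * N1 (z *ⁱ z)      ≤⟨ *-monoˡ (*-nn (0≤h (suc k)) (0≤h (suc k))) (≤-trans (N1-* z z) (*-mono (0≤N1 z) (0≤N1 z) z≤B z≤B)) ⟩
      h′ * h′ * (B * B)          ∎
    e : ∀ n C h B → n * C * (½ * h * (½ * h) * (B * B)) ≡ (n * h) * (C * (B * B) * (½ * (½ * h)))
    e = solve-∀ ℚ-ring

  exp-close : ∀ N n → j ℕ.≤ N → N ℕ.≤ n → N1 (s n) ≤ B → N1 (s N) ≤ B →
    dist (E n (s n)) (E N (s N)) ≤ 2ℚ * (C * (B * B)) * h N + C * dist (s n) (s N)
  exp-close N n j≤N N≤n sn≤B sN≤B = begin
    dist (E n (s n)) (E N (s N))                                ≤⟨ dist-tri (E n (s n)) (E N (s n)) (E N (s N)) ⟩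
    dist (E n (s n)) (E N (s n)) + dist (E N (s n)) (E N (s N)) ≤⟨ +-mono-≤
      (telescope′ (λ m n′ → dist (E m (s n)) (E n′ (s n))) (λ a b c → dist-tri (E a (s n)) (E b (s n)) (E c (s n))) (λ m → dist-refl (E m (s n)))
        (C * (B * B)) j (*-nn 0≤C (*-nn 0≤B 0≤B)) (step (s n) sn≤B) n N j≤N N≤n)
      (lip N j≤N (s n) (s N) sn≤B sN≤B) ⟩
    2ℚ * (C * (B * B)) * h N + C * dist (s n) (s N)             ∎

exp-cauchy : ∀ (s t : ℕ → ℚ) → IsCauchy s → IsCauchy t → ∃ λ K → 0ℚ ≤ K × ∀ ε → 0ℚ < ε →
  ∃ λ N → ∀ n → N ℕ.≤ n → dist (E n (s n +i t n)) (E N (s N +i t N)) ≤ K * ε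
exp-cauchy s t cs ct =
  let A , 0≤A , Nₐ , bdₐ = bounded s cs
      B , 0≤B , Nᵦ , bdᵦ = bounded t ct
      j , C , 0≤C , bd   = exp-bound (A + B) (+-nn 0≤A 0≤B)
      D = 2ℚ * (C * ((A + B) * (A + B)))
      0≤D : 0ℚ ≤ D
      0≤D = *-nn 0≤2 (*-nn 0≤C (*-nn (+-nn 0≤A 0≤B) (+-nn 0≤A 0≤B)))
  in D + C * 2ℚ , +-nn 0≤D (*-nn 0≤C 0≤2) , λ ε 0<ε →
  let N₁ , close₁ = cs ε 0<ε
      N₂ , close₂ = ct ε 0<ε
      N₃ , small = h-small ε 0<ε
      N = ((N₁ ℕ.⊔ N₂) ℕ.⊔ (Nₐ ℕ.⊔ Nᵦ)) ℕ.⊔ (N₃ ℕ.⊔ j)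
      L≤N = ℕ.m≤m⊔n ((N₁ ℕ.⊔ N₂) ℕ.⊔ (Nₐ ℕ.⊔ Nᵦ)) (N₃ ℕ.⊔ j)
      R≤N = ℕ.m≤n⊔m ((N₁ ℕ.⊔ N₂) ℕ.⊔ (Nₐ ℕ.⊔ Nᵦ)) (N₃ ℕ.⊔ j)
      12≤N = ℕ.≤-trans (ℕ.m≤m⊔n (N₁ ℕ.⊔ N₂) (Nₐ ℕ.⊔ Nᵦ)) L≤N
      ab≤N = ℕ.≤-trans (ℕ.m≤n⊔m (N₁ ℕ.⊔ N₂) (Nₐ ℕ.⊔ Nᵦ)) L≤N
      N₁≤N = ℕ.≤-trans (ℕ.m≤m⊔n N₁ N₂) 12≤N
      N₂≤N = ℕ.≤-trans (ℕ.m≤n⊔m N₁ N₂) 12≤N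
      Nₐ≤N = ℕ.≤-trans (ℕ.m≤m⊔n Nₐ Nᵦ) ab≤N
      Nᵦ≤N = ℕ.≤-trans (ℕ.m≤n⊔m Nₐ Nᵦ) ab≤N
      N₃≤N = ℕ.≤-trans (ℕ.m≤m⊔n N₃ j) R≤N
      j≤N  = ℕ.≤-trans (ℕ.m≤n⊔m N₃ j) R≤N
  in N , λ n N≤n → begin
    dist (E n (s n +i t n)) (E N (s N +i t N)) ≤⟨ ExpCauchy.exp-close (λ k → s k +i t k) (A + B) (+-nn 0≤A 0≤B) j C 0≤C bd N n j≤N N≤n
        (+-mono-≤ (bdₐ n (ℕ.≤-trans Nₐ≤N N≤n)) (bdᵦ n (ℕ.≤-trans Nᵦ≤N N≤n)))
        (+-mono-≤ (bdₐ N Nₐ≤N) (bdᵦ N Nᵦ≤N)) ⟩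
    D * h N + C * dist (s n +i t n) (s N +i t N) ≤⟨ +-mono-≤ (*-monoˡ 0≤D (small N N₃≤N))
        (*-monoˡ 0≤C (+-mono-≤ (close₁ n N (ℕ.≤-trans N₁≤N N≤n) N₁≤N) (close₂ n N (ℕ.≤-trans N₂≤N N≤n) N₂≤N))) ⟩
    D * ε + C * (ε + ε)                        ≡⟨ e D C ε ⟩
    (D + C * 2ℚ) * ε                           ∎
  where
  open ≤-Reasoning
  e : ∀ D C ε → D * ε + C * (ε + ε) ≡ (D + C * (1ℚ + 1ℚ)) * ε
  e = solve-∀ ℚ-ring

∣re∣≤N1 : ∀ z → ∣ re z ∣ ≤ N1 z
∣re∣≤N1 z = by-diff ∣ im z ∣ (0≤∣p∣ (im z)) refl
∣im∣≤N1 : ∀ z → ∣ im z ∣ ≤ N1 z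
∣im∣≤N1 z = by-diff ∣ re z ∣ (0≤∣p∣ (re z)) (+-comm (∣ im z ∣) (∣ re z ∣))

ℂ-rawRing : RawRing 0ℓ 0ℓ
ℂ-rawRing = complexRawRing ℝ-rawRing

ℂ : Set
ℂ = Complex ℝ

expSeq : ℂ → ℕ → ℚ[i]
expSeq z k = E k (seq (re z) k +i seq (im z) k)

-- e^z = lim (1 + z / n)ⁿ along n = 2ᵏ.  The k-th approximant of exp z is E k evaluated at
-- the k-th approximant of z: the maps E k are uniformly Lipschitz on bounded sets (lip),
-- so this diagonal sequence has the same limit as k ↦ (1 + z / 2ᵏ) ^ 2ᵏ.
exp : ℂ → ℂ
exp z = mkℝ (λ k → re (expSeq z k)) (part re (λ z w → ∣re∣≤N1 (z -ⁱ w)))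
     +i mkℝ (λ k → im (expSeq z k)) (part im (λ z w → ∣im∣≤N1 (z -ⁱ w)))
  where
  part : (f : ℚ[i] → ℚ) → (∀ z w → ∣ f z - f w ∣ ≤ dist z w) → IsCauchy (λ k → f (expSeq z k))
  part f f≤ =
    let K , 0≤K , close = exp-cauchy (seq (re z)) (seq (im z)) (cauchy (re z)) (cauchy (im z))
    in cauchy-intro (λ k → f (expSeq z k)) K 0≤K λ ε 0<ε →
       let N , g = close ε 0<ε
       in N , λ n N≤n → ≤-trans (f≤ (expSeq z n) (expSeq z N)) (g n N≤n)

0<1+sq : ∀ t → 0ℚ < 1ℚ + t * t
0<1+sq t = <-≤-trans 0<1 (by-diff (t * t) (sq-nn t) refl)

1/1+sq : ℚ → ℚ
1/1+sq t = 1/_ (1ℚ + t * t) {{pos⇒nonZero (1ℚ + t * t) {{positive (0<1+sq t)}}}}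

module _ (t : ℚ) where
  private
    instance
      1+t²-pos : Positive (1ℚ + t * t)
      1+t²-pos = positive (0<1+sq t)
      1+t²≢0 : NonZero (1ℚ + t * t)
      1+t²≢0 = pos⇒nonZero (1ℚ + t * t)

  f-inv : (1ℚ + t * t) * 1/1+sq t ≡ 1ℚ
  f-inv = *-inverseʳ (1ℚ + t * t)

  0≤f : 0ℚ ≤ 1/1+sq t
  0≤f = <⇒≤ (positive⁻¹ (1/1+sq t) {{1/pos⇒pos (1ℚ + t * t)}})

  f≤1 : 1/1+sq t ≤ 1ℚ
  f≤1 = subst₂ _≤_ (*-identityˡ (1/1+sq t)) f-inv (*-monoʳ {1/1+sq t} 0≤f (by-diff {1ℚ} {1ℚ + t * t} (t * t) (sq-nn t) refl))

  tf≤1 : t * 1/1+sq t ≤ 1ℚ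
  tf≤1 = subst (t * 1/1+sq t ≤_) f-inv (*-monoʳ 0≤f
    (by-diff {t} {1ℚ + t * t} ((t - ½) * (t - ½) + (½ + ½ * ½)) (+-nn (sq-nn (t - ½)) (nonNegative⁻¹ (½ + ½ * ½))) (eq t)))
    where
    eq : ∀ t → t + ((t - ½) * (t - ½) + (½ + ½ * ½)) ≡ 1ℚ + t * t
    eq = solve-∀ ℚ-ring

f-lip : ∀ s t → 0ℚ ≤ s → 0ℚ ≤ t → ∣ 1/1+sq s - 1/1+sq t ∣ ≤ 2ℚ * ∣ s - t ∣
f-lip s t 0≤s 0≤t = begin
  ∣ f - g ∣                                  ≡⟨ cong ∣_∣ diff-eq ⟩
  ∣ (t - s) * ((s * f) * g + (t * g) * f) ∣  ≡⟨ ∣p*q∣≡∣p∣*∣q∣ (t - s) _ ⟩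
  ∣ t - s ∣ * ∣ (s * f) * g + (t * g) * f ∣  ≡⟨ cong₂ _*_ (∣-∣-sym t s) (0≤p⇒∣p∣≡p (+-nn (*-nn (*-nn 0≤s (0≤f s)) (0≤f t)) (*-nn (*-nn 0≤t (0≤f t)) (0≤f s)))) ⟩
  ∣ s - t ∣ * ((s * f) * g + (t * g) * f)    ≤⟨ *-monoˡ (0≤∣p∣ (s - t)) (+-mono-≤
      (*-mono (0≤f t) (*-nn 0≤s (0≤f s)) (tf≤1 s) (f≤1 t))
      (*-mono (0≤f s) (*-nn 0≤t (0≤f t)) (tf≤1 t) (f≤1 s))) ⟩
  ∣ s - t ∣ * 2ℚ                             ≡⟨ *-comm (∣ s - t ∣) 2ℚ ⟩
  2ℚ * ∣ s - t ∣                             ∎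
  where
  open ≤-Reasoning
  f = 1/1+sq s
  g = 1/1+sq t
  e₁ : ∀ f g s t → f * ((1ℚ + t * t) * g) - g * ((1ℚ + s * s) * f) ≡ (t - s) * ((s * f) * g + (t * g) * f)
  e₁ = solve-∀ ℚ-ring
  diff-eq : f - g ≡ (t - s) * ((s * f) * g + (t * g) * f)
  diff-eq = trans (cong₂ _-_ (trans (sym (*-identityʳ f)) (cong (f *_) (sym (f-inv t))))
                             (trans (sym (*-identityʳ g)) (cong (g *_) (sym (f-inv s)))))
                  (e₁ f g s t)

open Summation +-0-rawMonoid using () renaming (∑< to ∑ℚ)

4ℚ : ℚ
4ℚ = 2ℚ * 2ℚ

-- Left Riemann sums of ∫₀¹ 4 / (1 + t²) dt = π, with 2ᵏ subintervals of length h k = 2⁻ᵏ.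
πSeq : ℕ → ℚ
πSeq k = ∑ℚ (2^ k) (λ j → h k * (4ℚ * 1/1+sq (ι j * h k)))

∑-double : ∀ n a → ∑ℚ (2 ℕ.* n) a ≡ ∑ℚ n (λ j → a (2 ℕ.* j) + a (suc (2 ℕ.* j)))
∑-double zero a = refl
∑-double (suc n) a = begin
  ∑ℚ (n ℕ.+ suc (n ℕ.+ 0)) a + a (n ℕ.+ suc (n ℕ.+ 0))       ≡⟨ cong (λ m → ∑ℚ m a + a m) (ℕ.+-suc n (n ℕ.+ 0)) ⟩
  ∑ℚ (2 ℕ.* n) a + a (2 ℕ.* n) + a (suc (2 ℕ.* n))           ≡⟨ +-assoc (∑ℚ (2 ℕ.* n) a) _ _ ⟩
  ∑ℚ (2 ℕ.* n) a + (a (2 ℕ.* n) + a (suc (2 ℕ.* n)))         ≡⟨ cong (_+ (a (2 ℕ.* n) + a (suc (2 ℕ.* n)))) (∑-double n a) ⟩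
  ∑ℚ (suc n) (λ j → a (2 ℕ.* j) + a (suc (2 ℕ.* j)))         ∎
  where open ≡-Reasoning

∑-close : ∀ n a b D → (∀ j → ∣ a j - b j ∣ ≤ D) → ∣ ∑ℚ n a - ∑ℚ n b ∣ ≤ ι n * D
∑-close zero a b D le = ≤-reflexive (sym (*-zeroˡ D))
∑-close (suc n) a b D le = begin
  ∣ ∑ℚ n a + a n - (∑ℚ n b + b n) ∣        ≡⟨ cong ∣_∣ (e₁ (∑ℚ n a) (a n) (∑ℚ n b) (b n)) ⟩
  ∣ (a n - b n) + (∑ℚ n a - ∑ℚ n b) ∣      ≤⟨ ∣p+q∣≤∣p∣+∣q∣ (a n - b n) _ ⟩
  ∣ a n - b n ∣ + ∣ ∑ℚ n a - ∑ℚ n b ∣      ≤⟨ +-mono-≤ (le n) (∑-close n a b D le) ⟩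
  D + ι n * D                              ≡⟨ e₂ D (ι n) ⟩
  (1ℚ + ι n) * D                           ∎
  where
  open ≤-Reasoning
  e₁ : ∀ a b c d → a + b - (c + d) ≡ (b - d) + (a - c)
  e₁ = solve-∀ ℚ-ring
  e₂ : ∀ D x → D + x * D ≡ (1ℚ + x) * D
  e₂ = solve-∀ ℚ-ring

∑-lower : ∀ n a D → (∀ j → j ℕ.< n → D ≤ a j) → ι n * D ≤ ∑ℚ n a
∑-lower zero a D le = ≤-reflexive (*-zeroˡ D)
∑-lower (suc n) a D le = begin
  (1ℚ + ι n) * D  ≡⟨ e₂ D (ι n) ⟩
  ι n * D + D     ≤⟨ +-mono-≤ (∑-lower n a D (λ j j<n → le j (ℕ.m<n⇒m<1+n j<n))) (le n ℕ.≤-refl) ⟩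
  ∑ℚ n a + a n    ∎
  where
  open ≤-Reasoning
  e₂ : ∀ D x → (1ℚ + x) * D ≡ x * D + D
  e₂ = solve-∀ ℚ-ring

π-step : ∀ k → ∣ πSeq (suc k) - πSeq k ∣ ≤ 2ℚ * h k
π-step k = begin
  ∣ πSeq (suc k) - πSeq k ∣                    ≡⟨ cong (λ x → ∣ x - πSeq k ∣) (∑-double (2^ k) g′) ⟩
  ∣ ∑ℚ (2^ k) (λ j → g′ (2 ℕ.* j) + g′ (suc (2 ℕ.* j))) - πSeq k ∣ ≤⟨ ∑-close (2^ k) _ g (2ℚ * h k * h k) le ⟩
  ι (2^ k) * (2ℚ * h k * h k)                  ≡⟨ e₁ (ι (2^ k)) 2ℚ (h k) ⟩
  (ι (2^ k) * h k) * (2ℚ * h k)                ≡⟨ cong (_* (2ℚ * h k)) (2^*h k) ⟩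
  1ℚ * (2ℚ * h k)                              ≡⟨ *-identityˡ _ ⟩
  2ℚ * h k                                     ∎
  where
  open ≤-Reasoning
  h′ = h (suc k)
  g g′ : ℕ → ℚ
  g  j = h k * (4ℚ * 1/1+sq (ι j * h k))
  g′ j = h′ * (4ℚ * 1/1+sq (ι j * h′))
  e₁ : ∀ n a b → n * (a * b * b) ≡ (n * b) * (a * b)
  e₁ = solve-∀ ℚ-ring
  le : ∀ j → ∣ g′ (2 ℕ.* j) + g′ (suc (2 ℕ.* j)) - g j ∣ ≤ 2ℚ * h k * h k
  le j = begin
    ∣ g′ (2 ℕ.* j) + g′ (suc (2 ℕ.* j)) - g j ∣              ≡⟨ cong₂ (λ x y → ∣ h′ * (4ℚ * 1/1+sq x) + h′ * (4ℚ * 1/1+sq y) - g j ∣) even odd ⟩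
    ∣ h′ * (4ℚ * 1/1+sq t) + h′ * (4ℚ * 1/1+sq (t + h′)) - g j ∣ ≡⟨ cong ∣_∣ (e₂ (h k) 4ℚ (1/1+sq t) (1/1+sq (t + h′))) ⟩
    ∣ (h′ * 4ℚ) * (1/1+sq (t + h′) - 1/1+sq t) ∣             ≡⟨ ∣p*q∣≡∣p∣*∣q∣ (h′ * 4ℚ) _ ⟩
    ∣ h′ * 4ℚ ∣ * ∣ 1/1+sq (t + h′) - 1/1+sq t ∣             ≡⟨ cong (_* ∣ 1/1+sq (t + h′) - 1/1+sq t ∣) (0≤p⇒∣p∣≡p 0≤h4) ⟩
    h′ * 4ℚ * ∣ 1/1+sq (t + h′) - 1/1+sq t ∣                 ≤⟨ *-monoˡ 0≤h4 (f-lip (t + h′) t (+-nn 0≤t (0≤h (suc k))) 0≤t) ⟩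
    h′ * 4ℚ * (2ℚ * ∣ t + h′ - t ∣)                          ≡⟨ cong (λ x → h′ * 4ℚ * (2ℚ * x)) (trans (cong ∣_∣ (e₃ t h′)) (0≤p⇒∣p∣≡p (0≤h (suc k)))) ⟩
    h′ * 4ℚ * (2ℚ * h′)                                      ≡⟨ e₄ (h k) ⟩
    2ℚ * h k * h k                                           ∎
    where
    t = ι j * h k
    0≤t : 0ℚ ≤ t
    0≤t = *-nn (0≤ι j) (0≤h k)
    0≤h4 : 0ℚ ≤ h′ * 4ℚ
    0≤h4 = *-nn (0≤h (suc k)) (nonNegative⁻¹ 4ℚ)
    ev : ∀ x h → (x + x) * (½ * h) ≡ x * h
    ev = solve-∀ ℚ-ring
    od : ∀ x h → (1ℚ + (x + x)) * (½ * h) ≡ x * h + ½ * h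
    od = solve-∀ ℚ-ring
    even : ι (2 ℕ.* j) * h′ ≡ t
    even = trans (cong (_* h′) (ι-double j)) (ev (ι j) (h k))
    odd : ι (suc (2 ℕ.* j)) * h′ ≡ t + h′
    odd = trans (cong (λ x → (1ℚ + x) * h′) (ι-double j)) (od (ι j) (h k))
    e₂ : ∀ h q f g → ½ * h * (q * f) + ½ * h * (q * g) - h * (q * f) ≡ (½ * h * q) * (g - f)
    e₂ = solve-∀ ℚ-ring
    e₃ : ∀ t h → t + h - t ≡ h
    e₃ = solve-∀ ℚ-ring
    e₄ : ∀ h → ½ * h * ((1ℚ + 1ℚ) * (1ℚ + 1ℚ)) * ((1ℚ + 1ℚ) * (½ * h)) ≡ (1ℚ + 1ℚ) * h * h
    e₄ = solve-∀ ℚ-ring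

π-cauchy : IsCauchy πSeq
π-cauchy = cauchy-intro πSeq 4ℚ (nonNegative⁻¹ 4ℚ) λ ε 0<ε →
  let N , small = h-small ε 0<ε
  in N , λ n N≤n → ≤-trans
       (telescope′ (λ m n → ∣ πSeq m - πSeq n ∣) (λ l m n → ∣-∣-tri (πSeq l) (πSeq m) (πSeq n))
         (λ n → ≤-reflexive (trans (cong ∣_∣ (+-inverseʳ (πSeq n))) refl)) 2ℚ 0 0≤2 (λ k _ → π-step k) n N ℕ.z≤n N≤n)
       (*-monoˡ (nonNegative⁻¹ 4ℚ) (small N ℕ.≤-refl))

π : ℝ
π = mkℝ πSeq π-cauchy

1≤π : ∀ k → 1ℚ ≤ πSeq k
1≤π k = begin
  1ℚ                      ≡⟨ 2^*h k ⟨
  ι (2^ k) * h k          ≤⟨ ∑-lower (2^ k) _ (h k) term ⟩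
  πSeq k                  ∎
  where
  open ≤-Reasoning
  term : ∀ j → j ℕ.< 2^ k → h k ≤ h k * (4ℚ * 1/1+sq (ι j * h k))
  term j j<2^k = begin
    h k                                ≡⟨ *-identityʳ (h k) ⟨
    h k * 1ℚ                           ≤⟨ *-monoˡ (0≤h k) 1≤ ⟩
    h k * (4ℚ * 1/1+sq t)              ∎
    where
    t = ι j * h k
    0≤t : 0ℚ ≤ t
    0≤t = *-nn (0≤ι j) (0≤h k)
    t≤1 : t ≤ 1ℚ
    t≤1 = ι*h≤1 k (ℕ.<⇒≤ j<2^k)
    1≤ : 1ℚ ≤ 4ℚ * 1/1+sq t
    1≤ = begin
      1ℚ                      ≡⟨ f-inv t ⟨
      (1ℚ + t * t) * 1/1+sq t ≤⟨ *-monoʳ (0≤f t) (≤-trans (+-monoʳ-≤ 1ℚ (*-mono 0≤t 0≤t t≤1 t≤1)) (by-diff 2ℚ 0≤2 refl)) ⟩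
      4ℚ * 1/1+sq t           ∎

nm : ℚ[i] → ℚ
nm z = re z * re z + im z * im z

nm-* : ∀ z w → nm (z *ⁱ w) ≡ nm z * nm w
nm-* z w = eq (re z) (im z) (re w) (im w)
  where
  eq : ∀ a b c d → (a * c - b * d) * (a * c - b * d) + (a * d + b * c) * (a * d + b * c) ≡ (a * a + b * b) * (c * c + d * d)
  eq = solve-∀ ℚ-ring

nm-^ : ∀ z n → nm (z ^ⁱ n) ≡ nm z ^ n
nm-^ z zero = refl
nm-^ z (suc n) = trans (nm-* z (z ^ⁱ n)) (cong (nm z *_) (nm-^ z n))

0≤nm : ∀ z → 0ℚ ≤ nm z
0≤nm z = +-nn (sq-nn (re z)) (sq-nn (im z))

¼ : ℚ
¼ = ½ * ½

0≤¼ : 0ℚ ≤ ¼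
0≤¼ = nonNegative⁻¹ ¼

sq≤1 : ∀ {p} → 0ℚ ≤ p → p * p ≤ 1ℚ → p ≤ 1ℚ
sq≤1 {p} 0≤p pp≤1 with ≤-total p 1ℚ
... | inj₁ le = le
... | inj₂ 1≤p = ≤-trans (subst (_≤ p * p) (*-identityʳ p) (*-monoˡ 0≤p 1≤p)) pp≤1

nm-small : ∀ s t → IsCauchy s → IsCauchy t → ∃ λ K → ∀ k → K ℕ.≤ k → nm (s k +i t k) * h k ≤ 1ℚ
nm-small s t cs ct =
  let A , 0≤A , K₁ , s≤A = bounded s cs
      B , 0≤B , K₂ , t≤B = bounded t ct
      δ , 0<δ , le = shrink {A * A + B * B} {1ℚ} (+-nn (sq-nn A) (sq-nn B)) 0<1
      K₃ , small = h-small δ 0<δ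
  in (K₁ ℕ.⊔ K₂) ℕ.⊔ K₃ , λ k K≤k →
  let K₁₂≤k = ℕ.≤-trans (ℕ.m≤m⊔n (K₁ ℕ.⊔ K₂) K₃) K≤k
  in ≤-trans
    (*-mono (0≤h k) (0≤nm (s k +i t k))
      (+-mono-≤ (sq-bd (s k) A (s≤A k (ℕ.≤-trans (ℕ.m≤m⊔n K₁ K₂) K₁₂≤k)))
                (sq-bd (t k) B (t≤B k (ℕ.≤-trans (ℕ.m≤n⊔m K₁ K₂) K₁₂≤k))))
      (small k (ℕ.≤-trans (ℕ.m≤n⊔m (K₁ ℕ.⊔ K₂) K₃) K≤k)))
    le
  where
  sq-bd : ∀ p A → ∣ p ∣ ≤ A → p * p ≤ A * A
  sq-bd p A le = subst (_≤ A * A) (∣∣² p) (*-mono (0≤∣p∣ p) (0≤∣p∣ p) le le)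

module Decay (w : ℚ[i]) (k : ℕ) (x : ℚ) (re≡ : re w ≡ - x) (0≤x : 0ℚ ≤ x)
  (small : nm w * h (2 ℕ.+ k) ≤ x) where
  open ≤-Reasoning
  H = h (2 ℕ.+ k)
  N = 2^ (2 ℕ.+ k)
  y = 1ℚ + ¼ * x
  u = nm (lin (2 ℕ.+ k) w)
  v = 1ℚ + x * H

  0≤H : 0ℚ ≤ H
  0≤H = 0≤h (2 ℕ.+ k)

  0≤y : 0ℚ ≤ y
  0≤y = +-nn 0≤1 (*-nn 0≤¼ 0≤x)

  0≤v : 0ℚ ≤ v
  0≤v = +-nn 0≤1 (*-nn 0≤x 0≤H)

  u≤ : u ≤ 1ℚ + - (x * H)
  u≤ = begin
    u                                          ≡⟨ e₁ H (re w) (im w) ⟩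
    1ℚ + 2ℚ * (re w * H) + nm w * H * H        ≡⟨ cong (λ p → 1ℚ + 2ℚ * (p * H) + nm w * H * H) re≡ ⟩
    1ℚ + 2ℚ * (- x * H) + nm w * H * H         ≤⟨ +-monoʳ-≤ (1ℚ + 2ℚ * (- x * H)) (*-monoʳ 0≤H small) ⟩
    1ℚ + 2ℚ * (- x * H) + x * H                ≡⟨ e₂ x H ⟩
    1ℚ + - (x * H)                             ∎
    where
    e₁ : ∀ h a b → (1ℚ + h * a) * (1ℚ + h * a) + h * b * (h * b) ≡ 1ℚ + (1ℚ + 1ℚ) * (a * h) + (a * a + b * b) * h * h
    e₁ = solve-∀ ℚ-ring
    e₂ : ∀ x h → 1ℚ + (1ℚ + 1ℚ) * (- x * h) + x * h ≡ 1ℚ + - (x * h)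
    e₂ = solve-∀ ℚ-ring

  uv≤1 : u * v ≤ 1ℚ
  uv≤1 = ≤-trans (*-monoʳ 0≤v u≤) (by-diff (x * H * (x * H)) (sq-nn (x * H)) (e x H))
    where
    e : ∀ x h → (1ℚ + - (x * h)) * (1ℚ + x * h) + x * h * (x * h) ≡ 1ℚ
    e = solve-∀ ℚ-ring

  y⁴≤v^N : y * y * (y * y) ≤ v ^ N
  y⁴≤v^N = begin
    y * y * (y * y)             ≤⟨ *-mono (*-nn 0≤y 0≤y) (*-nn 0≤y 0≤y) yy yy ⟩
    v ^ n₁ * v ^ n₁             ≡⟨ dbl n₁ ⟨
    v ^ N                       ∎
    where
    n₁ = 2^ suc k
    dbl : ∀ n → v ^ (2 ℕ.* n) ≡ v ^ n * v ^ n
    dbl n = trans (^-+ v n (n ℕ.+ 0)) (cong (λ m → v ^ n * v ^ m) (ℕ.+-identityʳ n))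
    y≤ : y ≤ v ^ (2^ k)
    y≤ = begin
      1ℚ + ¼ * x                       ≡⟨ cong (λ p → 1ℚ + p * x) (trans (cong (¼ *_) (2^*h k)) (*-identityʳ ¼)) ⟨
      1ℚ + ¼ * (ι (2^ k) * h k) * x    ≡⟨ cong (1ℚ +_) (e (ι (2^ k)) (h k) x) ⟩
      1ℚ + ι (2^ k) * (x * H)          ≤⟨ bernoulli (x * H) (2^ k) 0≤v ⟩
      v ^ (2^ k)                       ∎
      where
      e : ∀ n h x → ½ * ½ * (n * h) * x ≡ n * (x * (½ * (½ * h)))
      e = solve-∀ ℚ-ring
    yy : y * y ≤ v ^ n₁
    yy = ≤-trans (*-mono 0≤y 0≤y y≤ y≤) (≤-reflexive (sym (dbl (2^ k))))

  nm-bound : nm (E (2 ℕ.+ k) w) * (y * y * (y * y)) ≤ 1ℚ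
  nm-bound = begin
    nm (E (2 ℕ.+ k) w) * (y * y * (y * y))  ≡⟨ cong (_* (y * y * (y * y))) (nm-^ (lin (2 ℕ.+ k) w) N) ⟩
    u ^ N * (y * y * (y * y))               ≤⟨ *-monoˡ (^-nn N 0≤u) y⁴≤v^N ⟩
    u ^ N * v ^ N                           ≡⟨ *-^ u v N ⟨
    (u * v) ^ N                             ≤⟨ ≤1-^ N (*-nn 0≤u 0≤v) uv≤1 ⟩
    1ℚ                                      ∎
    where
    0≤u : 0ℚ ≤ u
    0≤u = 0≤nm (lin (2 ℕ.+ k) w)

  part-bound : ∀ p → p * p ≤ nm (E (2 ℕ.+ k) w) → ∣ p ∣ * (y * y) ≤ 1ℚ
  part-bound p pp≤ = sq≤1 (*-nn (0≤∣p∣ p) (*-nn 0≤y 0≤y)) (begin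
    ∣ p ∣ * (y * y) * (∣ p ∣ * (y * y))     ≡⟨ e (∣ p ∣) (y * y) ⟩
    ∣ p ∣ * ∣ p ∣ * (y * y * (y * y))       ≡⟨ cong (_* (y * y * (y * y))) (∣∣² p) ⟩
    p * p * (y * y * (y * y))               ≤⟨ *-monoʳ (*-nn (*-nn 0≤y 0≤y) (*-nn 0≤y 0≤y)) pp≤ ⟩
    nm (E (2 ℕ.+ k) w) * (y * y * (y * y))  ≤⟨ nm-bound ⟩
    1ℚ                                      ∎)
    where
    e : ∀ a b → a * b * (a * b) ≡ a * a * (b * b)
    e = solve-∀ ℚ-ring

0<ι : ∀ i → 0ℚ < ι (suc i)
0<ι i = <-≤-trans 0<1 (by-diff (ι i) (0≤ι i) refl)

r : ℕ → ℚ
r i = proj₁ (inverse (0<ι i))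

0<r : ∀ i → 0ℚ < r i
0<r i = proj₁ (proj₂ (inverse (0<ι i)))

ι*r : ∀ i → ι (suc i) * r i ≡ 1ℚ
ι*r i = proj₂ (proj₂ (inverse (0<ι i)))

0≤r : ∀ i → 0ℚ ≤ r i
0≤r i = <⇒≤ (0<r i)

r-diff : ∀ i → r i - r (suc i) ≡ r i * r (suc i)
r-diff i = begin
  r i - r (suc i)                                            ≡⟨ cong₂ _-_ (trans (sym (*-identityʳ (r i))) (cong (r i *_) (sym (ι*r (suc i)))))
                                                                         (trans (sym (*-identityʳ (r (suc i)))) (cong (r (suc i) *_) (sym (ι*r i)))) ⟩
  r i * ((1ℚ + (1ℚ + ι i)) * r (suc i)) - r (suc i) * ((1ℚ + ι i) * r i) ≡⟨ e (r i) (r (suc i)) (ι i) ⟩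
  r i * r (suc i)                                            ∎
  where
  open ≡-Reasoning
  e : ∀ a b x → a * ((1ℚ + (1ℚ + x)) * b) - b * ((1ℚ + x) * a) ≡ a * b
  e = solve-∀ ℚ-ring

r-small : ∀ ε → 0ℚ < ε → ∃ λ i → r i ≤ ε
r-small ε 0<ε =
  let q , 0<q , εq≡1 = inverse 0<ε
      i , q≤i = arch q
  in i , (begin
    r i                      ≡⟨ *-identityʳ (r i) ⟨
    r i * 1ℚ                 ≡⟨ cong (r i *_) εq≡1 ⟨
    r i * (ε * q)            ≤⟨ *-monoˡ (0≤r i) (*-monoˡ (<⇒≤ 0<ε) (≤-trans q≤i (by-diff {ι i} {ι (suc i)} 1ℚ 0≤1 (+-comm (ι i) 1ℚ)))) ⟩
    r i * (ε * ι (suc i))    ≡⟨ e (r i) ε (ι (suc i)) ⟩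
    ε * (ι (suc i) * r i)    ≡⟨ cong (ε *_) (ι*r i) ⟩
    ε * 1ℚ                   ≡⟨ *-identityʳ ε ⟩
    ε                        ∎)
  where
  open ≤-Reasoning
  e : ∀ a b c → a * (b * c) ≡ b * (c * a)
  e = solve-∀ ℚ-ring

16ℚ : ℚ
16ℚ = 4ℚ * 4ℚ

0≤16 : 0ℚ ≤ 16ℚ
0≤16 = nonNegative⁻¹ 16ℚ

final-bound : ∀ i x p → 1ℚ + ι i ≤ x → ∣ p ∣ * ((1ℚ + ¼ * x) * (1ℚ + ¼ * x)) ≤ 1ℚ → ∣ p ∣ ≤ 16ℚ * (r i - r (suc i))
final-bound i x p i≤x bd = begin
  ∣ p ∣                                          ≡⟨ *-identityʳ (∣ p ∣) ⟨
  ∣ p ∣ * 1ℚ                                     ≤⟨ *-monoˡ (0≤∣p∣ p) (*-mono 0≤1 0≤1 one₁ one₂) ⟩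
  ∣ p ∣ * ((4ℚ * y * r i) * (4ℚ * y * r (suc i))) ≡⟨ e (∣ p ∣) 4ℚ y (r i) (r (suc i)) ⟩
  ∣ p ∣ * (y * y) * (16ℚ * (r i * r (suc i)))    ≤⟨ *-monoʳ (*-nn 0≤16 (*-nn (0≤r i) (0≤r (suc i)))) bd ⟩
  1ℚ * (16ℚ * (r i * r (suc i)))                 ≡⟨ *-identityˡ _ ⟩
  16ℚ * (r i * r (suc i))                        ≡⟨ cong (16ℚ *_) (r-diff i) ⟨
  16ℚ * (r i - r (suc i))                        ∎
  where
  open ≤-Reasoning
  y = 1ℚ + ¼ * x
  e : ∀ p f y a b → p * ((f * y * a) * (f * y * b)) ≡ p * (y * y) * (f * f * (a * b))
  e = solve-∀ ℚ-ring
  4y≥ : ι (2 ℕ.+ i) ≤ 4ℚ * y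
  4y≥ = begin
    1ℚ + (1ℚ + ι i)      ≤⟨ +-monoʳ-≤ 1ℚ i≤x ⟩
    1ℚ + x               ≤⟨ by-diff (1ℚ + 2ℚ) (nonNegative⁻¹ (1ℚ + 2ℚ)) (e′ x) ⟩
    4ℚ * y               ∎
    where
    e′ : ∀ x → 1ℚ + x + (1ℚ + (1ℚ + 1ℚ)) ≡ (1ℚ + 1ℚ) * (1ℚ + 1ℚ) * (1ℚ + ½ * ½ * x)
    e′ = solve-∀ ℚ-ring
  one₁ : 1ℚ ≤ 4ℚ * y * r i
  one₁ = subst (_≤ 4ℚ * y * r i) (ι*r i) (*-monoʳ (0≤r i)
    (≤-trans (by-diff {ι (suc i)} {ι (2 ℕ.+ i)} 1ℚ 0≤1 (+-comm (ι (suc i)) 1ℚ)) 4y≥))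
  one₂ : 1ℚ ≤ 4ℚ * y * r (suc i)
  one₂ = subst (_≤ 4ℚ * y * r (suc i)) (ι*r (suc i)) (*-monoʳ (0≤r (suc i)) 4y≥)

module Series (S a : ℕ → ℝ)
  (S-step : ∀ n k → seq (S (suc n)) k ≡ seq (S n) k + seq (a n) k)
  (J : ℕ) (bd : ∀ i → ∃ λ K → ∀ k → K ℕ.≤ k → ∣ seq (a (i ℕ.+ J)) k ∣ ≤ 16ℚ * (r i - r (suc i))) where
  open ≤-Reasoning

  tail : ∀ i d → Near (16ℚ * (r i - r (d ℕ.+ i))) (S (d ℕ.+ (i ℕ.+ J))) (S (i ℕ.+ J))
  tail i zero = 0 , λ k _ → ≤-reflexive (trans (cong ∣_∣ (+-inverseʳ (seq (S (i ℕ.+ J)) k))) (e 16ℚ (r i)))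
    where
    e : ∀ a x → 0ℚ ≡ a * (x - x)
    e = solve-∀ ℚ-ring
  tail i (suc d) =
    let K₁ , f = tail i d
        K₂ , g = bd (d ℕ.+ i)
    in K₁ ℕ.⊔ K₂ , λ k K≤k → begin
      ∣ seq (S (suc (d ℕ.+ (i ℕ.+ J)))) k - s₀ k ∣                         ≡⟨ cong (λ x → ∣ x - s₀ k ∣) (S-step (d ℕ.+ (i ℕ.+ J)) k) ⟩
      ∣ s₁ k + seq (a (d ℕ.+ (i ℕ.+ J))) k - s₀ k ∣                        ≡⟨ cong (λ m → ∣ s₁ k + seq (a m) k - s₀ k ∣) (ℕ.+-assoc d i J) ⟨
      ∣ s₁ k + seq (a (d ℕ.+ i ℕ.+ J)) k - s₀ k ∣                          ≡⟨ cong ∣_∣ (e₁ (s₁ k) (seq (a (d ℕ.+ i ℕ.+ J)) k) (s₀ k)) ⟩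
      ∣ seq (a (d ℕ.+ i ℕ.+ J)) k + (s₁ k - s₀ k) ∣                        ≤⟨ ∣p+q∣≤∣p∣+∣q∣ (seq (a (d ℕ.+ i ℕ.+ J)) k) (s₁ k - s₀ k) ⟩
      ∣ seq (a (d ℕ.+ i ℕ.+ J)) k ∣ + ∣ s₁ k - s₀ k ∣                      ≤⟨ +-mono-≤ (g k (ℕ.≤-trans (ℕ.m≤n⊔m K₁ K₂) K≤k)) (f k (ℕ.≤-trans (ℕ.m≤m⊔n K₁ K₂) K≤k)) ⟩
      16ℚ * (r (d ℕ.+ i) - r (suc d ℕ.+ i)) + 16ℚ * (r i - r (d ℕ.+ i))    ≡⟨ e₂ 16ℚ (r (d ℕ.+ i)) (r (suc d ℕ.+ i)) (r i) ⟩
      16ℚ * (r i - r (suc d ℕ.+ i))                                        ∎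
    where
    s₀ s₁ : ℕ → ℚ
    s₀ = seq (S (i ℕ.+ J))
    s₁ = seq (S (d ℕ.+ (i ℕ.+ J)))
    e₁ : ∀ a b c → a + b - c ≡ b + (a - c)
    e₁ = solve-∀ ℚ-ring
    e₂ : ∀ a x y z → a * (x - y) + a * (z - x) ≡ a * (z - y)
    e₂ = solve-∀ ℚ-ring

  tail′ : ∀ i m → i ℕ.+ J ℕ.≤ m → Near (16ℚ * r i) (S m) (S (i ℕ.+ J))
  tail′ i m le =
    let d = m ℕ.∸ (i ℕ.+ J)
        K , f = tail i d
    in K , λ k K≤k → begin
      ∣ seq (S m) k - seq (S (i ℕ.+ J)) k ∣                  ≡⟨ cong (λ n → ∣ seq (S n) k - seq (S (i ℕ.+ J)) k ∣) (ℕ.m∸n+n≡m le) ⟨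
      ∣ seq (S (d ℕ.+ (i ℕ.+ J))) k - seq (S (i ℕ.+ J)) k ∣  ≤⟨ f k K≤k ⟩
      16ℚ * (r i - r (d ℕ.+ i))                              ≤⟨ *-monoˡ {16ℚ} {r i - r (d ℕ.+ i)} {r i} 0≤16 (by-diff (r (d ℕ.+ i)) (0≤r (d ℕ.+ i)) (e (r i) (r (d ℕ.+ i)))) ⟩
      16ℚ * r i                                              ∎
    where
    e : ∀ a b → a - b + b ≡ a
    e = solve-∀ ℚ-ring

  S-cauchy : IsCauchyᴿ S
  S-cauchy ε 0<ε =
    let δ , 0<δ , le = shrink {16ℚ + 16ℚ} {ε} (nonNegative⁻¹ (16ℚ + 16ℚ)) 0<ε
        i , ri≤δ = r-small δ 0<δ
    in i ℕ.+ J , λ m n N≤m N≤n →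
    let K₁ , f = tail′ i m N≤m
        K₂ , g = tail′ i n N≤n
    in K₁ ℕ.⊔ K₂ , λ k K≤k → begin
      ∣ seq (S m) k - seq (S n) k ∣                                                        ≤⟨ ∣-∣-tri (seq (S m) k) (seq (S (i ℕ.+ J)) k) (seq (S n) k) ⟩
      ∣ seq (S m) k - seq (S (i ℕ.+ J)) k ∣ + ∣ seq (S (i ℕ.+ J)) k - seq (S n) k ∣        ≡⟨ cong (∣ seq (S m) k - seq (S (i ℕ.+ J)) k ∣ +_) (∣-∣-sym (seq (S (i ℕ.+ J)) k) (seq (S n) k)) ⟩
      ∣ seq (S m) k - seq (S (i ℕ.+ J)) k ∣ + ∣ seq (S n) k - seq (S (i ℕ.+ J)) k ∣        ≤⟨ +-mono-≤ (f k (ℕ.≤-trans (ℕ.m≤m⊔n K₁ K₂) K≤k)) (g k (ℕ.≤-trans (ℕ.m≤n⊔m K₁ K₂) K≤k)) ⟩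
      16ℚ * r i + 16ℚ * r i                                                                ≤⟨ +-mono-≤ (*-monoˡ 0≤16 ri≤δ) (*-monoˡ 0≤16 ri≤δ) ⟩
      16ℚ * δ + 16ℚ * δ                                                                    ≡⟨ *-distribʳ-+ δ 16ℚ 16ℚ ⟨
      (16ℚ + 16ℚ) * δ                                                                      ≤⟨ le ⟩
      ε                                                                                    ∎

open RawRing ℝ-rawRing public using () renaming (_+_ to _+ᴿ_; _*_ to _*ᴿ_; -_ to -ᴿ_; 0# to 0ᴿ; 1# to 1ᴿ)
open RawRing ℂ-rawRing public using () renaming (_≈_ to _≃ℂ_; _+_ to _+ℂ_; _*_ to _*ℂ_; -_ to -ℂ_; 0# to 0ℂ; 1# to 1ℂ)
open RawSemiringDefs (RawRing.rawSemiring ℂ-rawRing) public using () renaming (_^_ to _^ℂ_)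

infixl 6 _-ℂ_
_-ℂ_ : ℂ → ℂ → ℂ
z -ℂ w = z +ℂ (-ℂ w)

record ℍ : Set where
  constructor upper
  field
    point  : ℂ
    0<im   : 0ᴿ <ᴿ im point
open ℍ public

ofℝ : ℝ → ℂ
ofℝ x = x +i 0ᴿ

2πi : ℂ
2πi = 0ᴿ +i (fromℚ 2ℚ *ᴿ π)

½ᴿ : ℝ
½ᴿ = fromℚ ½

-- 2πi [ ½ (n + ε/2)² τ + (n + ε/2) (ζ + ε′/2) ]
θ-exponent : ℝ → ℝ → ℂ → ℂ → ℤ → ℂ
θ-exponent ε ε′ ζ τ n =
  2πi *ℂ (ofℝ (½ᴿ *ᴿ (s *ᴿ s)) *ℂ τ +ℂ ofℝ s *ℂ (ζ +ℂ ofℝ (½ᴿ *ᴿ ε′)))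
  where
  s : ℝ
  s = fromℚ (n / 1) +ᴿ (½ᴿ *ᴿ ε)

θ-term : ℝ → ℝ → ℂ → ℂ → ℤ → ℂ
θ-term ε ε′ ζ τ n = exp (θ-exponent ε ε′ ζ τ n)

open Summation (RawRing.+-rawMonoid ℂ-rawRing) using () renaming (∑< to ∑ℂ)

module θ-Convergence (ε ε′ : ℝ) (ζ : ℂ) (τ : ℍ) where
  open ≤-Reasoning

  W : ℤ → ℕ → ℚ[i]
  W n k = seq (re (θ-exponent ε ε′ ζ (point τ) n)) k +i seq (im (θ-exponent ε ε′ ζ (point τ) n)) k

  s : ℤ → ℕ → ℚ
  s n k = n / 1 + ½ * seq ε k

  y v : ℕ → ℚ
  y k = seq (im (point τ)) k
  v k = seq (im ζ) k

  X : ℤ → ℕ → ℚ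
  X n k = πSeq k * (s n k * s n k * y k + 2ℚ * (s n k * v k))

  re-W : ∀ n k → re (W n k) ≡ - X n k
  re-W n k = e (πSeq k) (s n k) (seq (re (point τ)) k) (y k) (seq (re ζ) k) (v k) (½ * seq ε′ k)
    where
    e : ∀ p s τr τi ζr ζi e → 0ℚ * ((½ * (s * s) * τr + - (0ℚ * τi)) + (s * (ζr + e) + - (0ℚ * (ζi + 0ℚ))))
      + - ((1ℚ + 1ℚ) * p * ((½ * (s * s) * τi + 0ℚ * τr) + (s * (ζi + 0ℚ) + 0ℚ * (ζr + e))))
      ≡ - (p * (s * s * τi + (1ℚ + 1ℚ) * (s * ζi)))
    e = solve-∀ ℚ-ring

  growth : ∀ {b c V c⁻¹ i : ℚ} (p m e y v : ℚ) → 0ℚ ≤ c → 0ℚ ≤ V → 0ℚ ≤ i → c⁻¹ * c ≡ 1ℚ → 0ℚ ≤ c⁻¹ →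
    1ℚ ≤ p → ∣ e ∣ ≤ b → c ≤ y → ∣ v ∣ ≤ V →
    1ℚ + i + b + (1ℚ + 2ℚ * V) * c⁻¹ ≤ ∣ m ∣ →
    1ℚ + i ≤ p * ((m + e) * (m + e) * y + 2ℚ * ((m + e) * v))
  growth {b} {c} {V} {c⁻¹} {i} p m e y v 0≤c 0≤V 0≤i c⁻¹c≡1 0≤c⁻¹ 1≤p e≤b c≤y v≤V m≥ = begin
    1ℚ + i                       ≤⟨ by-diff ((1ℚ + 2ℚ * V) * c⁻¹) 0≤D refl ⟩
    1ℚ + i + D                   ≤⟨ σ≥ ⟩
    σ                            ≤⟨ σ≤T ⟩
    T                            ≡⟨ *-identityˡ T ⟨
    1ℚ * T                       ≤⟨ *-monoʳ (≤-trans 0≤σ σ≤T) 1≤p ⟩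
    p * T                        ∎
    where
    D = (1ℚ + 2ℚ * V) * c⁻¹
    q = m + e
    σ = ∣ q ∣
    T = q * q * y + 2ℚ * (q * v)
    0≤σ : 0ℚ ≤ σ
    0≤σ = 0≤∣p∣ q
    0≤D : 0ℚ ≤ D
    0≤D = *-nn (+-nn 0≤1 (*-nn 0≤2 0≤V)) 0≤c⁻¹
    e₁ : ∀ i b D → 1ℚ + i + D + b ≡ 1ℚ + i + b + D
    e₁ = solve-∀ ℚ-ring
    e₂ : ∀ m e → m + e - e ≡ m
    e₂ = solve-∀ ℚ-ring
    m≤ : ∣ m ∣ ≤ σ + b
    m≤ = begin
      ∣ m ∣          ≡⟨ cong ∣_∣ (e₂ m e) ⟨
      ∣ q - e ∣      ≤⟨ ∣p-q∣≤∣p∣+∣q∣ q e ⟩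
      σ + ∣ e ∣      ≤⟨ +-monoʳ-≤ σ e≤b ⟩
      σ + b          ∎
    σ≥ : 1ℚ + i + D ≤ σ
    σ≥ = subst₂ _≤_ (e₃ (1ℚ + i + D) b) (e₃ σ b) (+-monoˡ-≤ (- b) (subst (_≤ σ + b) (sym (e₁ i b D)) (≤-trans m≥ m≤)))
      where
      e₃ : ∀ x b → x + b + - b ≡ x
      e₃ = solve-∀ ℚ-ring
    D≤σ : D ≤ σ
    D≤σ = ≤-trans (by-diff (1ℚ + i) (+-nn 0≤1 0≤i) (+-comm D (1ℚ + i))) σ≥
    σc≥ : 1ℚ + 2ℚ * V ≤ σ * c
    σc≥ = begin
      1ℚ + 2ℚ * V                ≡⟨ *-identityʳ _ ⟨
      (1ℚ + 2ℚ * V) * 1ℚ         ≡⟨ cong ((1ℚ + 2ℚ * V) *_) c⁻¹c≡1 ⟨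
      (1ℚ + 2ℚ * V) * (c⁻¹ * c)  ≡⟨ *-assoc (1ℚ + 2ℚ * V) c⁻¹ c ⟨
      D * c                      ≤⟨ *-monoʳ 0≤c D≤σ ⟩
      σ * c                      ∎
    qv≥ : - (σ * V) ≤ q * v
    qv≥ = begin
      - (σ * V)            ≤⟨ neg-antimono-≤ (*-monoˡ 0≤σ v≤V) ⟩
      - (σ * ∣ v ∣)        ≡⟨ cong -_ (∣p*q∣≡∣p∣*∣q∣ q v) ⟨
      - ∣ q * v ∣          ≤⟨ neg-antimono-≤ (-p≤∣p∣ (q * v)) ⟩
      - (- (q * v))        ≡⟨ e₄ (q * v) ⟩
      q * v                ∎
      where
      e₄ : ∀ x → - (- x) ≡ x
      e₄ = solve-∀ ℚ-ring
    σ≤T : σ ≤ T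
    σ≤T = begin
      σ                                    ≡⟨ e₅ σ V ⟩
      σ * (1ℚ + 2ℚ * V) + 2ℚ * - (σ * V)   ≤⟨ +-mono-≤ (*-monoˡ 0≤σ σc≥) (*-monoˡ 0≤2 qv≥) ⟩
      σ * (σ * c) + 2ℚ * (q * v)           ≡⟨ cong (_+ 2ℚ * (q * v)) (trans (sym (*-assoc σ σ c)) (cong (_* c) (∣∣² q))) ⟩
      q * q * c + 2ℚ * (q * v)             ≤⟨ +-monoˡ-≤ (2ℚ * (q * v)) (*-monoˡ (sq-nn q) c≤y) ⟩
      T                                    ∎
      where
      e₅ : ∀ s V → s ≡ s * (1ℚ + (1ℚ + 1ℚ) * V) + (1ℚ + 1ℚ) * - (s * V)
      e₅ = solve-∀ ℚ-ring

  Grows : ℕ → Set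
  Grows J = ∃ λ K → ∀ n i k → K ℕ.≤ k → ι (i ℕ.+ J) ≤ ∣ n / 1 ∣ → 1ℚ + ι i ≤ X n k

  grows : ∃ Grows
  grows =
    let c , 0<c , K₁ , c≤y = 0<im τ
        c⁻¹ , 0<c⁻¹ , cc⁻¹≡1 = inverse 0<c
        b , 0≤b , K₂ , e≤b = bounded (λ k → ½ * seq ε k) (cauchy (½ᴿ *ᴿ ε))
        V , 0≤V , K₃ , v≤V = bounded v (cauchy (im ζ))
        J , J≥ = arch (1ℚ + b + (1ℚ + 2ℚ * V) * c⁻¹)
    in J , (K₁ ℕ.⊔ K₂) ℕ.⊔ K₃ , λ n i k K≤k n≥ →
    let K₁₂≤k = ℕ.≤-trans (ℕ.m≤m⊔n (K₁ ℕ.⊔ K₂) K₃) K≤k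
        K₃≤k = ℕ.≤-trans (ℕ.m≤n⊔m (K₁ ℕ.⊔ K₂) K₃) K≤k
    in growth {b} {c} {V} {c⁻¹} {ι i} (πSeq k) (n / 1) (½ * seq ε k) (y k) (v k)
         (<⇒≤ 0<c) 0≤V (0≤ι i) (trans (*-comm c⁻¹ c) cc⁻¹≡1) (<⇒≤ 0<c⁻¹) (1≤π k)
         (e≤b k (ℕ.≤-trans (ℕ.m≤n⊔m K₁ K₂) K₁₂≤k))
         (subst (_≤ y k) (+-identityˡ c) (c≤y k (ℕ.≤-trans (ℕ.m≤m⊔n K₁ K₂) K₁₂≤k)))
         (v≤V k K₃≤k)
         (≤-trans (≤-reflexive (e (ι i) b ((1ℚ + 2ℚ * V) * c⁻¹)))
           (≤-trans (+-monoʳ-≤ (ι i) J≥) (≤-trans (≤-reflexive (sym (ι-+ i J))) n≥)))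
    where
    e : ∀ i b D → 1ℚ + i + b + D ≡ i + (1ℚ + b + D)
    e = solve-∀ ℚ-ring

  term-bound : ∀ n i → (∃ λ K → ∀ k → K ℕ.≤ k → 1ℚ + ι i ≤ X n k) →
    ∃ λ K → ∀ k → K ℕ.≤ k → ∀ p → p * p ≤ nm (E k (W n k)) → ∣ p ∣ ≤ 16ℚ * (r i - r (suc i))
  term-bound n i (K₀ , big) = combine (nm-small (seq (re z)) (seq (im z)) (cauchy (re z)) (cauchy (im z)))
    where
    z = θ-exponent ε ε′ ζ (point τ) n
    go : ∀ k → 2 ℕ.≤ k → ∀ p → p * p ≤ nm (E k (W n k)) → 1ℚ + ι i ≤ X n k → 1ℚ ≤ X n k →
      nm (W n k) * h k ≤ X n k → ∣ p ∣ ≤ 16ℚ * (r i - r (suc i))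
    go (suc zero) (ℕ.s≤s ())
    go (suc (suc k)) _ p pp≤ x≥ 1≤x small =
      final-bound i (X n (2 ℕ.+ k)) p x≥
        (Decay.part-bound (W n (2 ℕ.+ k)) k (X n (2 ℕ.+ k)) (re-W n (2 ℕ.+ k)) (≤-trans 0≤1 1≤x) small p pp≤)
    combine : (∃ λ K → ∀ k → K ℕ.≤ k → nm (W n k) * h k ≤ 1ℚ) →
      ∃ λ K → ∀ k → K ℕ.≤ k → ∀ p → p * p ≤ nm (E k (W n k)) → ∣ p ∣ ≤ 16ℚ * (r i - r (suc i))
    combine (K₁ , small) = (K₀ ℕ.⊔ K₁) ℕ.⊔ 2 , λ k K≤k p pp≤ →
      let K₀₁≤k = ℕ.≤-trans (ℕ.m≤m⊔n (K₀ ℕ.⊔ K₁) 2) K≤k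
          x≥    = big k (ℕ.≤-trans (ℕ.m≤m⊔n K₀ K₁) K₀₁≤k)
          1≤x   = ≤-trans (by-diff {1ℚ} {1ℚ + ι i} (ι i) (0≤ι i) refl) x≥
      in go k (ℕ.≤-trans (ℕ.m≤n⊔m (K₀ ℕ.⊔ K₁) 2) K≤k) p pp≤ x≥ 1≤x
           (≤-trans (small k (ℕ.≤-trans (ℕ.m≤n⊔m K₀ K₁) K₀₁≤k)) 1≤x)

  re²≤nm : ∀ z → re z * re z ≤ nm z
  re²≤nm z = by-diff (im z * im z) (sq-nn (im z)) refl
  im²≤nm : ∀ z → im z * im z ≤ nm z
  im²≤nm z = by-diff (re z * re z) (sq-nn (re z)) (+-comm (im z * im z) (re z * re z))

  module _ (σ : ℕ → ℤ) (σ-large : ∀ j → ι j ≤ ∣ σ j / 1 ∣) where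
    terms : ℕ → ℂ
    terms j = θ-term ε ε′ ζ (point τ) (σ j)

    bound : ∃ λ J → ∀ i → ∃ λ K → ∀ k → K ℕ.≤ k → ∀ p → p * p ≤ nm (E k (W (σ (i ℕ.+ J)) k)) → ∣ p ∣ ≤ 16ℚ * (r i - r (suc i))
    bound =
      let J , K , big = grows
      in J , λ i → term-bound (σ (i ℕ.+ J)) i (K , λ k K≤k → big (σ (i ℕ.+ J)) i k K≤k (σ-large (i ℕ.+ J)))

    re-cauchy : IsCauchyᴿ (λ n → re (∑ℂ n terms))
    re-cauchy = Series.S-cauchy (λ n → re (∑ℂ n terms)) (λ n → re (terms n)) (λ n k → refl) (proj₁ bound)
      λ i → let K , f = proj₂ bound i in K , λ k K≤k → f k K≤k _ (re²≤nm (E k (W (σ (i ℕ.+ proj₁ bound)) k)))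

    im-cauchy : IsCauchyᴿ (λ n → im (∑ℂ n terms))
    im-cauchy = Series.S-cauchy (λ n → im (∑ℂ n terms)) (λ n → im (terms n)) (λ n k → refl) (proj₁ bound)
      λ i → let K , f = proj₂ bound i in K , λ k K≤k → f k K≤k _ (im²≤nm (E k (W (σ (i ℕ.+ proj₁ bound)) k)))

IsCauchyℂ : (ℕ → ℂ) → Set
IsCauchyℂ s = IsCauchyᴿ (λ n → re (s n)) × IsCauchyᴿ (λ n → im (s n))

limℂ : (s : ℕ → ℂ) → IsCauchyℂ s → ℂ
limℂ s (c , d) = lim (λ n → re (s n)) c +i lim (λ n → im (s n)) d

+-large : ∀ j → ι j ≤ ∣ ℤ.+ j / 1 ∣
+-large j = subst (λ p → ι j ≤ ∣ p ∣) (sym (n/1≡ι j)) (p≤∣p∣ (ι j))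

neg-large : ∀ j → ι j ≤ ∣ -[1+ j ] / 1 ∣
neg-large j = subst (ι j ≤_) (trans (cong ∣_∣ (sym (n/1≡ι (suc j)))) (sym (∣-p∣≡∣p∣ (ℤ.+ suc j / 1))))
  (≤-trans (by-diff {ι j} {ι (suc j)} 1ℚ 0≤1 (+-comm (ι j) 1ℚ)) (p≤∣p∣ (ι (suc j))))

-- Σ_{n∈ℤ} is split as Σ_{n≥0} + Σ_{n≤-1}; the series converges absolutely,
-- so the value does not depend on the way it is summed.
θ : ℝ → ℝ → ℂ → ℍ → ℂ
θ ε ε′ ζ τ = limℂ nonneg-sums nonneg-cauchy +ℂ limℂ neg-sums neg-cauchyℂ
  where
  open θ-Convergence ε ε′ ζ τ
  nonneg-sums neg-sums : ℕ → ℂ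
  nonneg-sums N = ∑ℂ N (λ j → θ-term ε ε′ ζ (point τ) (ℤ.+ j))
  neg-sums    N = ∑ℂ N (λ j → θ-term ε ε′ ζ (point τ) -[1+ j ])
  nonneg-cauchy : IsCauchyℂ nonneg-sums
  nonneg-cauchy = re-cauchy ℤ.+_ +-large , im-cauchy ℤ.+_ +-large
  neg-cauchyℂ : IsCauchyℂ neg-sums
  neg-cauchyℂ = re-cauchy -[1+_] neg-large , im-cauchy -[1+_] neg-large

θ[_⨾_] : ℝ → ℝ → ℍ → ℂ
θ[ ε ⨾ ε′ ] τ = θ ε ε′ 0ℂ τ

infixl 7 _⁄_
_⁄_ : ℕ → (d : ℕ) .{{_ : ℕ.NonZero d}} → ℝ
m ⁄ d = fromℚ (ℤ.+ m / d)

ζ₅ : ℂ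
ζ₅ = exp (2πi *ℂ ofℝ (1 ⁄ 5))

{-# OPTIONS --safe #-}
-- Since θ[ε; ε′ + 2] and θ[-ε; -ε′] reduce to θ[ε; ε′] up to roots of unity, the two relations are
--   Σ_{k mod 5} ζ₅^((2k+1)J) θ[(2k+1)/5; J/5]^5 = 0   for J = 1 and J = 3.
-- Expanding the fifth powers, the left-hand side is a sum over the vectors s of five elements of
-- 1/10 + ℤ/5 whose differences are integers, with terms
--   exp (2πi (½ |s|² τ + (J/10) Σ s + 2 J s₀)).
-- The orthogonal reflection s ↦ s - ⅖ (Σ s) (1,1,1,1,1) maps these vectors to each other, preserves
-- |s|², and changes the sign of the term, because 5 s₀ is half an odd integer.  So the terms cancel
-- in pairs.  When each theta series is truncated to |s| < N, the pairs cut apart satisfy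
-- |s|² ≥ N²; there are O(N⁵) of them, and each is O(N⁻⁸).
module Submission where

open import Algebra.Bundles using (CommutativeRing)
open import Algebra.Bundles.Raw using (RawRing)
import Algebra.Definitions.RawSemiring as RawSemiringDefs
import Algebra.Properties.CommutativeSemigroup
import Algebra.Properties.Ring
import Algebra.Solver.CommutativeMonoid
open import Data.Integer.Base as ℤ using (ℤ; -[1+_])
import Data.Integer.Properties as ℤ
import Data.Integer.Tactic.RingSolver as ℤ-Solver
open import Data.Nat.Base as ℕ using (ℕ; zero; suc; nonZero)
import Data.Nat.Properties as ℕ
import Data.Nat.Tactic.RingSolver as ℕ-Solver
open import Data.Product.Base using (∃; _×_; _,_; proj₁; proj₂)
open import Data.Sum.Base using (_⊎_; inj₁; inj₂)
open import Data.Vec.Base as Vec using (Vec; []; _∷_)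
open import Data.Vec.Relation.Unary.All using (All; []; _∷_)
open import Data.Vec.Relation.Unary.Any using (Any; here; there)
open import Level using (0ℓ)
open import Relation.Binary.PropositionalEquality as ≡ using (_≡_)
import Relation.Binary.Reasoning.Setoid
open import Relation.Binary.Structures using (IsEquivalence)
open import Relation.Nullary.Decidable using (yes; no)
open import Relation.Nullary.Negation using (contradiction)
open import Tactic.RingSolver using (solve-∀)

-- Sums over windows of integers

-- A vector s is encoded as an integer l with s₀ = (2l + 1)/10 together with the four integer
-- differences v. The reflection adds one number to all coordinates, so it keeps v and acts on l
-- alone, by l ↦ -2D - 1 - l with D the sum of v; for fixed v the cancellation takes place in a
-- single sum over ℤ. That sum is added to its own reflected copy instead of choosing one member of
-- each pair, so the estimates concern twice the truncated sum. The reflection multiplies a term by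
-- exp (-2πi J (½ + l + D)), which is -1 for odd J. Since π is given as the integral of 4/(1 + t²)
-- and exp as a limit of powers, even exp (πi) = -1 needs an argument: Euler's method for the
-- equation satisfied by (1 + it)²/(1 + t²), on the grid of the Riemann sums for π, shows exp (πi/2)
-- = i, and all periods follow from it. The bound for exp in `Decay` falls only like the inverse
-- square of the exponent, that is O(N⁻⁴), too weak against O(N⁵) pairs; a term is the square of the
-- one with half the exponent, which improves this to O(N⁻⁸).

level : ℤ → ℕ
level (ℤ.+ n)  = n
level -[1+ n ] = n

-- The reflection n ↦ -1 - n about -½, the centre of the windows used below. An integer and its
-- image have the same level.
rev : ℤ → ℤ
rev (ℤ.+ n)  = -[1+ n ]
rev -[1+ n ] = ℤ.+ n

level-rev : ∀ n → level (rev n) ≡ level n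
level-rev (ℤ.+ n)  = ≡.refl
level-rev -[1+ n ] = ≡.refl

rev≡ : ∀ n → rev n ≡ -[1+ 0 ] ℤ.- n
rev≡ (ℤ.+ zero)  = ≡.refl
rev≡ (ℤ.+ suc n) = ≡.refl
rev≡ -[1+ n ]    = ≡.refl

rev-+ : ∀ a n → rev (a ℤ.+ n) ≡ ℤ.- a ℤ.+ rev n
rev-+ a n = ≡.trans (rev≡ (a ℤ.+ n)) (≡.trans (e a n -[1+ 0 ]) (≡.cong (λ x → ℤ.- a ℤ.+ x) (≡.sym (rev≡ n))))
  where
  e : ∀ a n c → c ℤ.- (a ℤ.+ n) ≡ ℤ.- a ℤ.+ (c ℤ.- n)
  e = ℤ-Solver.solve-∀

at : ℕ → ℤ → ℤ
at k n = n ℤ.* ℤ.+ 5 ℤ.+ ℤ.+ k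

at-+ : ∀ k N → at k (ℤ.+ N) ≡ ℤ.+ (k ℕ.+ N ℕ.* 5)
at-+ k N = ≡.trans (≡.cong (λ x → x ℤ.+ ℤ.+ k) (≡.sym (ℤ.pos-* N 5))) (≡.cong ℤ.+_ (ℕ.+-comm (N ℕ.* 5) k))

module IntegerSums (R : CommutativeRing 0ℓ 0ℓ) where
  open CommutativeRing R hiding (zero)
  open Relation.Binary.Reasoning.Setoid setoid
  open Algebra.Properties.CommutativeSemigroup +-commutativeSemigroup using (interchange)

  -- The sum over the window -N ≤ n < N, that is, over the integers of level below N.
  𝕊 : ℕ → (ℤ → Carrier) → Carrier
  𝕊 zero    f = 0#
  𝕊 (suc N) f = 𝕊 N f + (f (ℤ.+ N) + f -[1+ N ])

  𝕊-cong-< : ∀ N {f g} → (∀ n → level n ℕ.< N → f n ≈ g n) → 𝕊 N f ≈ 𝕊 N g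
  𝕊-cong-< zero    f≈g = refl
  𝕊-cong-< (suc N) f≈g = +-cong (𝕊-cong-< N (λ n n<N → f≈g n (ℕ.m<n⇒m<1+n n<N)))
    (+-cong (f≈g (ℤ.+ N) ℕ.≤-refl) (f≈g -[1+ N ] ℕ.≤-refl))

  𝕊-cong : ∀ N {f g} → (∀ n → f n ≈ g n) → 𝕊 N f ≈ 𝕊 N g
  𝕊-cong N f≈g = 𝕊-cong-< N (λ n _ → f≈g n)

  𝕊-0 : ∀ N → 𝕊 N (λ _ → 0#) ≈ 0#
  𝕊-0 zero    = refl
  𝕊-0 (suc N) = trans (+-cong (𝕊-0 N) (+-identityʳ 0#)) (+-identityʳ 0#)

  𝕊-+ : ∀ N f g → 𝕊 N (λ n → f n + g n) ≈ 𝕊 N f + 𝕊 N g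
  𝕊-+ zero    f g = sym (+-identityʳ 0#)
  𝕊-+ (suc N) f g = trans (+-cong (𝕊-+ N f g) (interchange _ _ _ _)) (interchange _ _ _ _)

  *-𝕊 : ∀ N c f → c * 𝕊 N f ≈ 𝕊 N (λ n → c * f n)
  *-𝕊 zero    c f = zeroʳ c
  *-𝕊 (suc N) c f = trans (distribˡ c _ _) (+-cong (*-𝕊 N c f) (distribˡ c _ _))

  𝕊-* : ∀ N f c → 𝕊 N f * c ≈ 𝕊 N (λ n → f n * c)
  𝕊-* N f c = trans (*-comm _ c) (trans (*-𝕊 N c f) (𝕊-cong N λ n → *-comm c (f n)))

  𝕊-swap : ∀ M N (f : ℤ → ℤ → Carrier) → 𝕊 M (λ m → 𝕊 N (λ n → f m n)) ≈ 𝕊 N (λ n → 𝕊 M (λ m → f m n))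
  𝕊-swap zero    N f = sym (𝕊-0 N)
  𝕊-swap (suc M) N f = begin
    𝕊 M (λ m → 𝕊 N (f m)) + (𝕊 N (f (ℤ.+ M)) + 𝕊 N (f -[1+ M ]))      ≈⟨ +-cong (𝕊-swap M N f) (sym (𝕊-+ N (f (ℤ.+ M)) (f -[1+ M ]))) ⟩
    𝕊 N (λ n → 𝕊 M (λ m → f m n)) + 𝕊 N (λ n → f (ℤ.+ M) n + f -[1+ M ] n) ≈⟨ 𝕊-+ N _ _ ⟨
    𝕊 N (λ n → 𝕊 (suc M) (λ m → f m n))                               ∎

  𝕊-rev : ∀ N f → 𝕊 N (λ n → f (rev n)) ≈ 𝕊 N f
  𝕊-rev zero    f = refl
  𝕊-rev (suc N) f = +-cong (𝕊-rev N f) (+-comm _ _)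

  Supported : ℕ → (ℤ → Carrier) → Set
  Supported A f = ∀ n → A ℕ.≤ level n → f n ≈ 0#

  𝕊-enlarge : ∀ {A X f} → Supported A f → A ℕ.≤ X → 𝕊 X f ≈ 𝕊 A f
  𝕊-enlarge {A} {f = f} f-supp A≤X = go (ℕ.≤⇒≤′ A≤X)
    where
    go : ∀ {X} → A ℕ.≤′ X → 𝕊 X f ≈ 𝕊 A f
    go (ℕ.≤′-reflexive ≡.refl) = refl
    go (ℕ.≤′-step {X} A≤X) = begin
      𝕊 X f + (f (ℤ.+ X) + f -[1+ X ])   ≈⟨ +-cong (go A≤X) (+-cong (f-supp (ℤ.+ X) (ℕ.≤′⇒≤ A≤X)) (f-supp -[1+ X ] (ℕ.≤′⇒≤ A≤X))) ⟩
      𝕊 A f + (0# + 0#)                  ≈⟨ +-congˡ (+-identityʳ 0#) ⟩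
      𝕊 A f + 0#                         ≈⟨ +-identityʳ _ ⟩
      𝕊 A f                              ∎

  -- Both sides are the sum of `f` over all integers from -X to X.
  𝕊-suc : ∀ X f → 𝕊 X (λ n → f (ℤ.suc n)) + f (ℤ.- ℤ.+ X) ≈ 𝕊 X f + f (ℤ.+ X)
  𝕊-suc zero    f = refl
  𝕊-suc (suc X) f = begin
    𝕊 X f⁺ + (f (ℤ.+ suc X) + f (ℤ.suc -[1+ X ])) + f -[1+ X ]   ≈⟨ +-congʳ (+-congˡ (+-congˡ (reflexive (≡.cong f (suc-neg X))))) ⟩
    𝕊 X f⁺ + (f (ℤ.+ suc X) + f (ℤ.- ℤ.+ X)) + f -[1+ X ]        ≈⟨ rearrange (𝕊 X f⁺) (f (ℤ.+ suc X)) (f (ℤ.- ℤ.+ X)) (f -[1+ X ]) ⟩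
    (𝕊 X f⁺ + f (ℤ.- ℤ.+ X)) + (f -[1+ X ] + f (ℤ.+ suc X))      ≈⟨ +-congʳ (𝕊-suc X f) ⟩
    (𝕊 X f + f (ℤ.+ X)) + (f -[1+ X ] + f (ℤ.+ suc X))           ≈⟨ +-assoc _ _ _ ⟩
    𝕊 X f + (f (ℤ.+ X) + (f -[1+ X ] + f (ℤ.+ suc X)))           ≈⟨ +-congˡ (+-assoc _ _ _) ⟨
    𝕊 X f + ((f (ℤ.+ X) + f -[1+ X ]) + f (ℤ.+ suc X))           ≈⟨ +-assoc _ _ _ ⟨
    𝕊 (suc X) f + f (ℤ.+ suc X)                                  ∎
    where
    f⁺ : ℤ → Carrier
    f⁺ n = f (ℤ.suc n)
    suc-neg : ∀ X → ℤ.suc -[1+ X ] ≡ ℤ.- ℤ.+ X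
    suc-neg zero    = ≡.refl
    suc-neg (suc X) = ≡.refl
    rearrange : ∀ s a b c → s + (a + b) + c ≈ (s + b) + (c + a)
    rearrange s a b c = begin
      s + (a + b) + c      ≈⟨ +-congʳ (+-congˡ (+-comm a b)) ⟩
      s + (b + a) + c      ≈⟨ +-congʳ (+-assoc s b a) ⟨
      s + b + a + c        ≈⟨ +-assoc _ a c ⟩
      s + b + (a + c)      ≈⟨ +-congˡ (+-comm a c) ⟩
      s + b + (c + a)      ∎

  -- Each unit shift exchanges one boundary value for another by `𝕊-suc`. Both vanish: after a + 1
  -- shifts the left one sits at level X - (a + 1), which is still at least A.
  𝕊-shift⁺ : ∀ {A X f} → Supported A f → ∀ a → A ℕ.+ a ℕ.≤ X → 𝕊 X (λ n → f (ℤ.+ a ℤ.+ n)) ≈ 𝕊 X f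
  𝕊-shift⁺ {A} {X} {f} f-supp zero    le = 𝕊-cong X λ n → reflexive (≡.cong f (ℤ.+-identityˡ n))
  𝕊-shift⁺ {A} {X} {f} f-supp (suc a) le = begin
    𝕊 X (λ n → f (ℤ.+ suc a ℤ.+ n))                                  ≈⟨ 𝕊-cong X (λ n → reflexive (≡.cong f (e (ℤ.+ a) n))) ⟩
    𝕊 X (λ n → fₐ (ℤ.suc n))                                         ≈⟨ +-identityʳ _ ⟨
    𝕊 X (λ n → fₐ (ℤ.suc n)) + 0#                                    ≈⟨ +-congˡ (f-supp _ (≡.subst (A ℕ.≤_) (≡.sym (level-neg X le)) (lower X le))) ⟨
    𝕊 X (λ n → fₐ (ℤ.suc n)) + fₐ (ℤ.- ℤ.+ X)                        ≈⟨ 𝕊-suc X fₐ ⟩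
    𝕊 X fₐ + fₐ (ℤ.+ X)                                              ≈⟨ +-congˡ (f-supp (ℤ.+ (a ℕ.+ X)) (ℕ.≤-trans (ℕ.≤-trans (ℕ.m≤m+n A (suc a)) le) (ℕ.m≤n+m X a))) ⟩
    𝕊 X fₐ + 0#                                                      ≈⟨ +-identityʳ _ ⟩
    𝕊 X fₐ                                                           ≈⟨ 𝕊-shift⁺ f-supp a (ℕ.≤-trans (ℕ.+-monoʳ-≤ A (ℕ.n≤1+n a)) le) ⟩
    𝕊 X f                                                            ∎
    where
    fₐ : ℤ → Carrier
    fₐ n = f (ℤ.+ a ℤ.+ n)
    e : ∀ a n → ℤ.suc a ℤ.+ n ≡ a ℤ.+ ℤ.suc n
    e a n = e′ ℤ.1ℤ a n
      where
      e′ : ∀ c a n → c ℤ.+ a ℤ.+ n ≡ a ℤ.+ (c ℤ.+ n)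
      e′ = ℤ-Solver.solve-∀
    a<X : ∀ X → A ℕ.+ suc a ℕ.≤ X → a ℕ.< X
    a<X X le = ℕ.≤-trans (ℕ.m≤n+m (suc a) A) le
    level-neg : ∀ X → A ℕ.+ suc a ℕ.≤ X → level (ℤ.+ a ℤ.- ℤ.+ X) ≡ X ℕ.∸ suc a
    level-neg zero    le with () ← a<X zero le
    level-neg (suc X) le = ≡.trans (≡.cong level (ℤ.⊖-< (a<X (suc X) le)))
      (≡.cong (λ m → level (ℤ.- ℤ.+ m)) (ℕ.+-∸-assoc 1 (ℕ.≤-pred (a<X (suc X) le))))
    lower : ∀ X → A ℕ.+ suc a ℕ.≤ X → A ℕ.≤ X ℕ.∸ suc a
    lower X le = ≡.subst (ℕ._≤ X ℕ.∸ suc a) (ℕ.m+n∸n≡m A (suc a)) (ℕ.∸-monoˡ-≤ (suc a) le)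

  𝕊-shift : ∀ {A X f} → Supported A f → ∀ a → A ℕ.+ ℤ.∣ a ∣ ℕ.≤ X → 𝕊 X (λ n → f (a ℤ.+ n)) ≈ 𝕊 X f
  𝕊-shift f-supp (ℤ.+ a) le = 𝕊-shift⁺ f-supp a le
  -- A negative shift is a positive one conjugated by `rev`.
  𝕊-shift {A} {X} {f} f-supp -[1+ a ] le = begin
    𝕊 X (λ n → f (-[1+ a ] ℤ.+ n))             ≈⟨ 𝕊-rev X _ ⟨
    𝕊 X (λ n → f (-[1+ a ] ℤ.+ rev n))         ≈⟨ 𝕊-cong X (λ n → reflexive (≡.cong f (≡.sym (rev-+ (ℤ.+ suc a) n)))) ⟩
    𝕊 X (λ n → f (rev (ℤ.+ suc a ℤ.+ n)))      ≈⟨ 𝕊-shift⁺ (λ n le → f-supp (rev n) (≡.subst (A ℕ.≤_) (≡.sym (level-rev n)) le)) (suc a) le ⟩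
    𝕊 X (λ n → f (rev n))                      ≈⟨ 𝕊-rev X f ⟩
    𝕊 X f                                      ∎

  sum₅ : (ℕ → Carrier) → Carrier
  sum₅ f = f 0 + (f 1 + (f 2 + (f 3 + f 4)))

  sum₅-cong : ∀ {f g} → (∀ k → k ℕ.< 5 → f k ≈ g k) → sum₅ f ≈ sum₅ g
  sum₅-cong f≈g = +-cong (f≈g 0 (ℕ.s≤s ℕ.z≤n)) (+-cong (f≈g 1 (ℕ.s≤s (ℕ.s≤s ℕ.z≤n))) (+-cong (f≈g 2 (ℕ.s≤s (ℕ.s≤s (ℕ.s≤s ℕ.z≤n))))
    (+-cong (f≈g 3 (ℕ.s≤s (ℕ.s≤s (ℕ.s≤s (ℕ.s≤s ℕ.z≤n))))) (f≈g 4 ℕ.≤-refl))))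

  𝕊-sum₅ : ∀ N (f : ℕ → ℤ → Carrier) → 𝕊 N (λ n → sum₅ (λ k → f k n)) ≈ sum₅ (λ k → 𝕊 N (f k))
  𝕊-sum₅ N f = trans (𝕊-+ N _ _) (+-congˡ (trans (𝕊-+ N _ _) (+-congˡ (trans (𝕊-+ N _ _) (+-congˡ (𝕊-+ N _ _))))))

  -- Division by 5 with remainder splits a window of 5N levels into five windows of N levels. On
  -- negative integers the remainder k occurs at offset 4 - k within its block of levels, hence the
  -- crosswise pairing in `rearrange`.
  𝕊-blocks : ∀ N f → 𝕊 (N ℕ.* 5) f ≈ sum₅ (λ k → 𝕊 N (λ n → f (at k n)))
  𝕊-blocks N f = trans (go N) (𝕊-sum₅ N (λ k n → f (at k n)))
    where
    open Algebra.Solver.CommutativeMonoid +-commutativeMonoid using (solve; _⊕_; _⊜_)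
    rearrange : ∀ s a b c d e a′ b′ c′ d′ e′ →
      ((((s + (a + e′)) + (b + d′)) + (c + c′)) + (d + b′)) + (e + a′) ≈
      s + ((a + (b + (c + (d + e)))) + (a′ + (b′ + (c′ + (d′ + e′)))))
    rearrange = solve 11 (λ s a b c d e a′ b′ c′ d′ e′ →
      (((((s ⊕ (a ⊕ e′)) ⊕ (b ⊕ d′)) ⊕ (c ⊕ c′)) ⊕ (d ⊕ b′)) ⊕ (e ⊕ a′)) ⊜
      (s ⊕ ((a ⊕ (b ⊕ (c ⊕ (d ⊕ e)))) ⊕ (a′ ⊕ (b′ ⊕ (c′ ⊕ (d′ ⊕ e′))))))) refl
    go : ∀ N → 𝕊 (N ℕ.* 5) f ≈ 𝕊 N (λ n → sum₅ (λ k → f (at k n)))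
    go zero    = refl
    go (suc N) = trans (rearrange _ _ _ _ _ _ _ _ _ _ _) (+-cong (go N) (+-congʳ (sum₅-cong λ k _ → reflexive (≡.cong f (≡.sym (at-+ k N))))))

  𝕊ⁿ : ∀ m → ℕ → (Vec ℤ m → Carrier) → Carrier
  𝕊ⁿ zero    M F = F []
  𝕊ⁿ (suc m) M F = 𝕊 M (λ a → 𝕊ⁿ m M (λ v → F (a ∷ v)))

  𝕊ⁿ-cong : ∀ m M {F G} → (∀ v → F v ≈ G v) → 𝕊ⁿ m M F ≈ 𝕊ⁿ m M G
  𝕊ⁿ-cong zero    M F≈G = F≈G []
  𝕊ⁿ-cong (suc m) M F≈G = 𝕊-cong M λ a → 𝕊ⁿ-cong m M λ v → F≈G (a ∷ v)

  𝕊ⁿ-+ : ∀ m M F G → 𝕊ⁿ m M (λ v → F v + G v) ≈ 𝕊ⁿ m M F + 𝕊ⁿ m M G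
  𝕊ⁿ-+ zero    M F G = refl
  𝕊ⁿ-+ (suc m) M F G = trans (𝕊-cong M λ a → 𝕊ⁿ-+ m M (λ v → F (a ∷ v)) (λ v → G (a ∷ v))) (𝕊-+ M _ _)

  *-𝕊ⁿ : ∀ m M c F → c * 𝕊ⁿ m M F ≈ 𝕊ⁿ m M (λ v → c * F v)
  *-𝕊ⁿ zero    M c F = refl
  *-𝕊ⁿ (suc m) M c F = trans (*-𝕊 M c _) (𝕊-cong M λ a → *-𝕊ⁿ m M c (λ v → F (a ∷ v)))

  𝕊-𝕊ⁿ-swap : ∀ m M N (F : ℤ → Vec ℤ m → Carrier) → 𝕊 N (λ l → 𝕊ⁿ m M (F l)) ≈ 𝕊ⁿ m M (λ v → 𝕊 N (λ l → F l v))
  𝕊-𝕊ⁿ-swap zero    M N F = refl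
  𝕊-𝕊ⁿ-swap (suc m) M N F = trans (𝕊-swap N M (λ l a → 𝕊ⁿ m M (λ v → F l (a ∷ v)))) (𝕊-cong M λ a → 𝕊-𝕊ⁿ-swap m M N (λ l v → F l (a ∷ v)))

  -- The last factor `c` is the place for the coefficient of a fifth power, which thus travels
  -- inside each term of the expanded sum. The same holds for `pow`, which is x^m c.
  prod : ∀ {m} → (ℤ → Carrier) → Carrier → Vec ℤ m → Carrier
  prod f c []      = c
  prod f c (x ∷ v) = f x * prod f c v

  prod-map : ∀ {m} f (g : ℤ → ℤ) c (v : Vec ℤ m) → prod f c (Vec.map g v) ≡ prod (λ x → f (g x)) c v
  prod-map f g c []      = ≡.refl
  prod-map f g c (x ∷ v) = ≡.cong (f (g x) *_) (prod-map f g c v)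

  pow : ℕ → Carrier → Carrier → Carrier
  pow zero    x c = c
  pow (suc m) x c = x * pow m x c

  pow-cong : ∀ m {x y c d} → x ≈ y → c ≈ d → pow m x c ≈ pow m y d
  pow-cong zero    x≈y c≈d = c≈d
  pow-cong (suc m) x≈y c≈d = *-cong x≈y (pow-cong m x≈y c≈d)

  pow-𝕊 : ∀ m M f c → pow m (𝕊 M f) c ≈ 𝕊ⁿ m M (prod f c)
  pow-𝕊 zero    M f c = refl
  pow-𝕊 (suc m) M f c = begin
    𝕊 M f * pow m (𝕊 M f) c                        ≈⟨ *-congˡ (pow-𝕊 m M f c) ⟩
    𝕊 M f * 𝕊ⁿ m M (prod f c)                      ≈⟨ 𝕊-* M f _ ⟩
    𝕊 M (λ a → f a * 𝕊ⁿ m M (prod f c))            ≈⟨ 𝕊-cong M (λ a → *-𝕊ⁿ m M (f a) (prod f c)) ⟩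
    𝕊ⁿ (suc m) M (prod f c)                        ∎

  pow-*ʳ : ∀ m x c d → pow m x (c * d) ≈ c * pow m x d
  pow-*ʳ zero    x c d = refl
  pow-*ʳ (suc m) x c d = begin
    x * pow m x (c * d)      ≈⟨ *-congˡ (pow-*ʳ m x c d) ⟩
    x * (c * pow m x d)      ≈⟨ *-assoc x c _ ⟨
    (x * c) * pow m x d      ≈⟨ *-congʳ (*-comm x c) ⟩
    (c * x) * pow m x d      ≈⟨ *-assoc c x _ ⟩
    c * (x * pow m x d)      ∎

  pow-1 : ∀ m x c → pow m x c ≈ c * pow m x 1#
  pow-1 m x c = trans (pow-cong m refl (sym (*-identityʳ c))) (pow-*ʳ m x c 1#)

  pow-* : ∀ m x u c → pow m (x * u) c ≈ pow m x (pow m u c)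
  pow-* zero    x u c = refl
  pow-* (suc m) x u c = begin
    (x * u) * pow m (x * u) c            ≈⟨ *-congˡ (pow-* m x u c) ⟩
    (x * u) * pow m x (pow m u c)        ≈⟨ *-assoc x u _ ⟩
    x * (u * pow m x (pow m u c))        ≈⟨ *-congˡ (pow-*ʳ m x u (pow m u c)) ⟨
    x * pow m x (u * pow m u c)          ∎

open import Data.Rational.Base
open import Data.Rational.Properties
import Data.Rational.Unnormalised.Base as ℚᵘ
import Data.Rational.Unnormalised.Properties as ℚᵘ
open import Relation.Binary.Bundles using (Setoid)
open import Relation.Binary.PropositionalEquality using (refl; sym; trans; cong; cong₂; subst; subst₂; isEquivalence; module ≡-Reasoning)
open import Defs

open RawSemiringDefs (RawRing.rawSemiring +-*-rawRing) using (_^_)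
open RawRing (complexRawRing +-*-rawRing) using () renaming (_+_ to _+ⁱ_; _*_ to _*ⁱ_; -_ to ~ⁱ_; 0# to 0ⁱ; 1# to 1ⁱ)
open RawSemiringDefs (RawRing.rawSemiring (complexRawRing +-*-rawRing)) using () renaming (_^_ to _^ⁱ_)
open Summation +-0-rawMonoid using () renaming (∑< to ∑ℚ)
open Summation (RawRing.+-rawMonoid ℂ-rawRing) using () renaming (∑< to ∑ℂ)

-- The ring of complex numbers

ℚ[i]-commutativeRing : CommutativeRing 0ℓ 0ℓ
ℚ[i]-commutativeRing = record
  { Carrier = ℚ[i] ; _≈_ = _≡_ ; _+_ = _+ⁱ_ ; _*_ = _*ⁱ_ ; -_ = ~ⁱ_ ; 0# = 0ⁱ ; 1# = 1ⁱ
  ; isCommutativeRing = record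
    { isRing = record
      { +-isAbelianGroup = record
        { isGroup = record
          { isMonoid = record
            { isSemigroup = record
              { isMagma = record { isEquivalence = isEquivalence ; ∙-cong = cong₂ _+ⁱ_ }
              ; assoc = λ x y z → cong₂ _+i_ (+-assoc (re x) (re y) (re z)) (+-assoc (im x) (im y) (im z)) }
            ; identity = (λ x → cong₂ _+i_ (+-identityˡ (re x)) (+-identityˡ (im x)))
                       , (λ x → cong₂ _+i_ (+-identityʳ (re x)) (+-identityʳ (im x))) }
          ; inverse = (λ x → cong₂ _+i_ (+-inverseˡ (re x)) (+-inverseˡ (im x)))
                    , (λ x → cong₂ _+i_ (+-inverseʳ (re x)) (+-inverseʳ (im x)))
          ; ⁻¹-cong = cong ~ⁱ_ }
        ; comm = λ x y → cong₂ _+i_ (+-comm (re x) (re y)) (+-comm (im x) (im y)) }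
      ; *-cong = cong₂ _*ⁱ_
      ; *-assoc = *ⁱ-assoc
      ; *-identity = (λ x → trans (*ⁱ-comm 1ⁱ x) (*ⁱ-identityʳ x)) , *ⁱ-identityʳ
      ; distrib = distribˡ , λ x y z → trans (*ⁱ-comm (y +ⁱ z) x)
                    (trans (distribˡ x y z) (cong₂ _+ⁱ_ (*ⁱ-comm x y) (*ⁱ-comm x z)))
      }
    ; *-comm = *ⁱ-comm
    }
  }
  where
  *ⁱ-comm : ∀ z w → z *ⁱ w ≡ w *ⁱ z
  *ⁱ-comm (a +i b) (c +i d) = cong₂ _+i_ (e₁ a b c d) (e₂ a b c d)
    where
    e₁ : ∀ a b c d → a * c - b * d ≡ c * a - d * b
    e₁ = solve-∀ ℚ-ring
    e₂ : ∀ a b c d → a * d + b * c ≡ c * b + d * a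
    e₂ = solve-∀ ℚ-ring
  *ⁱ-identityʳ : ∀ z → z *ⁱ 1ⁱ ≡ z
  *ⁱ-identityʳ (a +i b) = cong₂ _+i_ (e₁ a b) (e₂ a b)
    where
    e₁ : ∀ a b → a * 1ℚ - b * 0ℚ ≡ a
    e₁ = solve-∀ ℚ-ring
    e₂ : ∀ a b → a * 0ℚ + b * 1ℚ ≡ b
    e₂ = solve-∀ ℚ-ring
  distribˡ : ∀ z u v → z *ⁱ (u +ⁱ v) ≡ z *ⁱ u +ⁱ z *ⁱ v
  distribˡ (a +i b) (c +i d) (c′ +i d′) = cong₂ _+i_ (e₁ a b c d c′ d′) (e₂ a b c d c′ d′)
    where
    e₁ : ∀ a b c d c′ d′ → a * (c + c′) - b * (d + d′) ≡ (a * c - b * d) + (a * c′ - b * d′)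
    e₁ = solve-∀ ℚ-ring
    e₂ : ∀ a b c d c′ d′ → a * (d + d′) + b * (c + c′) ≡ (a * d + b * c) + (a * d′ + b * c′)
    e₂ = solve-∀ ℚ-ring

module ℚ[i] = CommutativeRing ℚ[i]-commutativeRing

Eventually : (ℕ → Set) → Set
Eventually P = ∃ λ K → ∀ k → K ℕ.≤ k → P k

always : ∀ {P : ℕ → Set} → (∀ k → P k) → Eventually P
always p = 0 , λ k _ → p k

eventually-map : ∀ {P Q : ℕ → Set} → (∀ k → P k → Q k) → Eventually P → Eventually Q
eventually-map f (K , p) = K , λ k K≤k → f k (p k K≤k)

eventually-map₂ : ∀ {P Q R : ℕ → Set} → (∀ k → P k → Q k → R k) → Eventually P → Eventually Q → Eventually R
eventually-map₂ f (K , p) (L , q) = K ℕ.⊔ L , λ k le →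
  f k (p k (ℕ.≤-trans (ℕ.m≤m⊔n K L) le)) (q k (ℕ.≤-trans (ℕ.m≤n⊔m K L) le))

approx : ℂ → ℕ → ℚ[i]
approx z k = seq (re z) k +i seq (im z) k

infixl 6 _+ᶜ_ _-ᶜ_
infixl 7 _*ᶜ_
infix 8 -ᶜ_

-- The operations of Defs unfold to Cauchy sequences together with their moduli, which the
-- conversion checker would compare; the opaque copies prevent this.
opaque
  _+ᶜ_ _*ᶜ_ : ℂ → ℂ → ℂ
  z +ᶜ w = z +ℂ w
  z *ᶜ w = z *ℂ w
  -ᶜ_ : ℂ → ℂ
  -ᶜ z = -ℂ z

_-ᶜ_ : ℂ → ℂ → ℂ
z -ᶜ w = z +ᶜ (-ᶜ w)

infix 4 _≼_ _≈_

-- z ≼ B says that |Re z| + |Im z| ≤ B.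
record _≼_ (z : ℂ) (B : ℚ) : Set where
  constructor mk≼
  field
    bound≼ : ∀ ε → 0ℚ < ε → Eventually λ k → N1 (approx z k) ≤ B + ε
open _≼_

-- A record, unlike _≃ℂ_, so that z and w can be inferred from z ≈ w.
record _≈_ (z w : ℂ) : Set where
  constructor mk≈
  field
    close : ∀ ε → 0ℚ < ε → Eventually λ k → dist (approx z k) (approx w k) ≤ ε

p≤p+ε : ∀ p {ε} → 0ℚ ≤ ε → p ≤ p + ε
p≤p+ε p {ε} 0≤ε = subst (_≤ p + ε) (+-identityʳ p) (+-monoʳ-≤ p 0≤ε)

eventually-≼ : ∀ {z B} → Eventually (λ k → N1 (approx z k) ≤ B) → z ≼ B
eventually-≼ {z} {B} ev = mk≼ λ ε 0<ε → eventually-map (λ k le → ≤-trans le (p≤p+ε B (<⇒≤ 0<ε))) ev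

opaque
  unfolding _+ᶜ_ _*ᶜ_ -ᶜ_

  -- Equality is the bound 0 for the difference, so the congruence laws below reduce to estimates
  -- for sums, negatives and products in `_≼_`.
  ≈-intro : ∀ {z w} → (z -ᶜ w) ≼ 0ℚ → z ≈ w
  ≈-intro {z} {w} (mk≼ p) = mk≈ λ ε 0<ε →
    eventually-map (λ k → subst (dist (approx z k) (approx w k) ≤_) (+-identityˡ ε)) (p ε 0<ε)

opaque
  unfolding _+ᶜ_ _*ᶜ_ -ᶜ_

  ≈-elim : ∀ {z w} → z ≈ w → (z -ᶜ w) ≼ 0ℚ
  ≈-elim {z} {w} (mk≈ p) = mk≼ λ ε 0<ε →
    eventually-map (λ k → subst (dist (approx z k) (approx w k) ≤_) (sym (+-identityˡ ε))) (p ε 0<ε)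

≼-pointwise : ∀ {z w B} → (∀ k → N1 (approx z k) ≤ N1 (approx w k)) → w ≼ B → z ≼ B
≼-pointwise z≤w (mk≼ w≼B) = mk≼ λ ε 0<ε → eventually-map (λ k → ≤-trans (z≤w k)) (w≼B ε 0<ε)

≼-mono : ∀ {z A B} → A ≤ B → z ≼ A → z ≼ B
≼-mono A≤B (mk≼ z≼A) = mk≼ λ ε 0<ε → eventually-map (λ k le → ≤-trans le (+-monoˡ-≤ ε A≤B)) (z≼A ε 0<ε)

half : ∀ {ε} → 0ℚ < ε → 0ℚ < ½ * ε
half = *-pos (positive⁻¹ ½)

two-halves : ∀ A B ε → (A + ½ * ε) + (B + ½ * ε) ≡ (A + B) + ε
two-halves = solve-∀ ℚ-ring

opaque
  unfolding _+ᶜ_ _*ᶜ_ -ᶜ_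

  ≼-+ : ∀ {z w A B} → z ≼ A → w ≼ B → (z +ᶜ w) ≼ (A + B)
  ≼-+ {z} {w} {A} {B} (mk≼ z≼A) (mk≼ w≼B) = mk≼ λ ε 0<ε → eventually-map₂
    (λ k p q → ≤-trans (N1-+ (approx z k) (approx w k)) (≤-trans (+-mono-≤ p q) (≤-reflexive (two-halves A B ε))))
    (z≼A (½ * ε) (half 0<ε)) (w≼B (½ * ε) (half 0<ε))

opaque
  unfolding _+ᶜ_ _*ᶜ_ -ᶜ_

  ≼-neg : ∀ {z B} → z ≼ B → (-ᶜ z) ≼ B
  ≼-neg {z} = ≼-pointwise λ k → ≤-reflexive (N1-neg (approx z k))

-- The cap δ ≤ 1 absorbs the quadratic term δ² in the estimate of a product.
shrink₁ : ∀ {K ε} → 0ℚ ≤ K → 0ℚ < ε → ∃ λ δ → 0ℚ < δ × δ ≤ 1ℚ × K * δ ≤ ε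
shrink₁ {K} {ε} 0≤K 0<ε =
  let δ , 0<δ , Kδ≤ε = shrink 0≤K 0<ε
  in δ ⊓ 1ℚ , 0<δ⊓1 δ 0<δ , p⊓q≤q δ 1ℚ , ≤-trans (*-monoˡ 0≤K (p⊓q≤p δ 1ℚ)) Kδ≤ε
  where
  0<δ⊓1 : ∀ δ → 0ℚ < δ → 0ℚ < δ ⊓ 1ℚ
  0<δ⊓1 δ 0<δ with ⊓-sel δ 1ℚ
  ... | inj₁ eq = subst (0ℚ <_) (sym eq) 0<δ
  ... | inj₂ eq = subst (0ℚ <_) (sym eq) 0<1

opaque
  unfolding _+ᶜ_ _*ᶜ_ -ᶜ_

  ≼-* : ∀ {z w A B} → 0ℚ ≤ A → 0ℚ ≤ B → z ≼ A → w ≼ B → (z *ᶜ w) ≼ (A * B)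
  ≼-* {z} {w} {A} {B} 0≤A 0≤B (mk≼ z≼A) (mk≼ w≼B) = mk≼ λ ε 0<ε →
    let δ , 0<δ , δ≤1 , le = shrink₁ {A + B + 1ℚ} (+-nn (+-nn 0≤A 0≤B) 0≤1) 0<ε
    in eventually-map₂ (λ k p q → begin
         N1 (approx z k *ⁱ approx w k)               ≤⟨ N1-* (approx z k) (approx w k) ⟩
         N1 (approx z k) * N1 (approx w k)           ≤⟨ *-mono (0≤N1 (approx w k)) (0≤N1 (approx z k)) p q ⟩
         (A + δ) * (B + δ)                           ≡⟨ e₁ A B δ ⟩
         A * B + (A + B + δ) * δ                     ≤⟨ +-monoʳ-≤ (A * B) (*-monoʳ (<⇒≤ 0<δ) (+-monoʳ-≤ (A + B) δ≤1)) ⟩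
         A * B + (A + B + 1ℚ) * δ                    ≤⟨ +-monoʳ-≤ (A * B) le ⟩
         A * B + ε                                   ∎)
       (z≼A δ 0<δ) (w≼B δ 0<δ)
    where
    open ≤-Reasoning
    e₁ : ∀ A B δ → (A + δ) * (B + δ) ≡ A * B + (A + B + δ) * δ
    e₁ = solve-∀ ℚ-ring

opaque
  unfolding _+ᶜ_

  -- This carries a bound for `l +ᶜ l`, which is what the pairing of terms provides, over to `l`
  -- itself.
  ≼-double : ∀ {z B} → (z +ᶜ z) ≼ B → z ≼ B
  ≼-double {z} = ≼-pointwise λ k → +-mono-≤ (∣p∣≤∣p+p∣ (re (approx z k))) (∣p∣≤∣p+p∣ (im (approx z k)))
    where
    double : ∀ p → p + p ≡ (1ℚ + 1ℚ) * p
    double = solve-∀ ℚ-ring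
    ∣p∣≤∣p+p∣ : ∀ p → ∣ p ∣ ≤ ∣ p + p ∣
    ∣p∣≤∣p+p∣ p = begin
      ∣ p ∣           ≡⟨ *-identityˡ ∣ p ∣ ⟨
      1ℚ * ∣ p ∣      ≤⟨ *-monoʳ (0≤∣p∣ p) (p≤p+ε 1ℚ 0≤1) ⟩
      2ℚ * ∣ p ∣      ≡⟨ ∣p*q∣≡∣p∣*∣q∣ 2ℚ p ⟨
      ∣ 2ℚ * p ∣      ≡⟨ cong ∣_∣ (double p) ⟨
      ∣ p + p ∣       ∎
      where open ≤-Reasoning

≼-limit : ∀ {z B} → (∀ ε → 0ℚ < ε → z ≼ (B + ε)) → z ≼ B
≼-limit {z} {B} f = mk≼ λ ε 0<ε → eventually-map
  (λ k le → ≤-trans le (≤-reflexive (e B ε))) (bound≼ (f (½ * ε) (half 0<ε)) (½ * ε) (half 0<ε))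
  where
  e : ∀ B ε → B + ½ * ε + ½ * ε ≡ B + ε
  e = solve-∀ ℚ-ring

eventually-bounded : ∀ z → ∃ λ B → 0ℚ ≤ B × Eventually λ k → N1 (approx z k) ≤ B
eventually-bounded z =
  let A , 0≤A , evA = bounded (seq (re z)) (cauchy (re z))
      B , 0≤B , evB = bounded (seq (im z)) (cauchy (im z))
  in A + B , +-nn 0≤A 0≤B , eventually-map₂ (λ k → +-mono-≤) evA evB

≼-finite : ∀ z → ∃ λ B → 0ℚ ≤ B × z ≼ B
≼-finite z = let B , 0≤B , ev = eventually-bounded z in B , 0≤B , eventually-≼ ev

≼0-*ˡ : ∀ {z w} → z ≼ 0ℚ → (z *ᶜ w) ≼ 0ℚ
≼0-*ˡ {z} {w} z≼0 = let B , 0≤B , w≼B = ≼-finite w in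
  subst ((z *ᶜ w) ≼_) (*-zeroˡ B) (≼-* {z} {w} ≤-refl 0≤B z≼0 w≼B)

approx-≡ : ∀ {z w} → (∀ k → approx z k ≡ approx w k) → z ≈ w
approx-≡ {z} {w} eq = mk≈ λ ε 0<ε → always λ k →
  subst (λ x → dist x (approx w k) ≤ ε) (sym (eq k)) (≤-trans (dist-refl (approx w k)) (<⇒≤ 0<ε))

≼-≡ : ∀ {z w B} → (∀ k → approx z k ≡ approx w k) → w ≼ B → z ≼ B
≼-≡ eq = ≼-pointwise λ k → ≤-reflexive (cong N1 (eq k))

0≼0 : 0ℂ ≼ 0ℚ
0≼0 = eventually-≼ (always λ k → ≤-refl)

≈-refl : ∀ {z} → z ≈ z
≈-refl = approx-≡ λ _ → refl

opaque
  unfolding _+ᶜ_ _*ᶜ_ -ᶜ_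

  ≈-sym : ∀ {z w} → z ≈ w → w ≈ z
  ≈-sym {z} {w} p = ≈-intro {w} {z} (≼-≡ {w -ᶜ z} { -ᶜ (z -ᶜ w)} (λ k → e (approx z k) (approx w k)) (≼-neg {z -ᶜ w} (≈-elim {z} {w} p)))
    where
    e : ∀ z w → w ℚ[i].- z ≡ ℚ[i].- (z ℚ[i].- w)
    e z w = cong₂ _+i_ (e′ (re z) (re w)) (e′ (im z) (im w))
      where
      e′ : ∀ z w → w - z ≡ - (z - w)
      e′ = solve-∀ ℚ-ring

opaque
  unfolding _+ᶜ_ _*ᶜ_ -ᶜ_

  ≈-trans : ∀ {u v w} → u ≈ v → v ≈ w → u ≈ w
  ≈-trans {u} {v} {w} p q = ≈-intro {u} {w} (≼-≡ {u -ᶜ w} {(u -ᶜ v) +ᶜ (v -ᶜ w)} (λ k → e (approx u k) (approx v k) (approx w k)) (≼-+ {u -ᶜ v} {v -ᶜ w} (≈-elim {u} {v} p) (≈-elim {v} {w} q)))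
    where
    e : ∀ u v w → u ℚ[i].- w ≡ (u ℚ[i].- v) ℚ[i].+ (v ℚ[i].- w)
    e u v w = cong₂ _+i_ (e′ (re u) (re v) (re w)) (e′ (im u) (im v) (im w))
      where
      e′ : ∀ u v w → u - w ≡ (u - v) + (v - w)
      e′ = solve-∀ ℚ-ring

opaque
  unfolding _+ᶜ_ _*ᶜ_ -ᶜ_

  ℂ-+-cong : ∀ {u v x y} → u ≈ v → x ≈ y → (u +ᶜ x) ≈ (v +ᶜ y)
  ℂ-+-cong {u} {v} {x} {y} p q = ≈-intro {u +ᶜ x} {v +ᶜ y}
    (≼-≡ {(u +ᶜ x) -ᶜ (v +ᶜ y)} {(u -ᶜ v) +ᶜ (x -ᶜ y)} (λ k → e (approx u k) (approx v k) (approx x k) (approx y k))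
       (≼-+ {u -ᶜ v} {x -ᶜ y} (≈-elim {u} {v} p) (≈-elim {x} {y} q)))
    where
    e : ∀ u v x y → (u ℚ[i].+ x) ℚ[i].- (v ℚ[i].+ y) ≡ (u ℚ[i].- v) ℚ[i].+ (x ℚ[i].- y)
    e u v x y = cong₂ _+i_ (e′ (re u) (re v) (re x) (re y)) (e′ (im u) (im v) (im x) (im y))
      where
      e′ : ∀ u v x y → (u + x) - (v + y) ≡ (u - v) + (x - y)
      e′ = solve-∀ ℚ-ring
  ℂ-neg-cong : ∀ {u v} → u ≈ v → (-ᶜ u) ≈ (-ᶜ v)
  ℂ-neg-cong {u} {v} p = ≈-intro { -ᶜ u} { -ᶜ v} (≼-≡ {(-ᶜ u) -ᶜ (-ᶜ v)} { -ᶜ (u -ᶜ v)} (λ k → e (approx u k) (approx v k)) (≼-neg {u -ᶜ v} (≈-elim {u} {v} p)))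
    where
    e : ∀ u v → (ℚ[i].- u) ℚ[i].- (ℚ[i].- v) ≡ ℚ[i].- (u ℚ[i].- v)
    e u v = cong₂ _+i_ (e′ (re u) (re v)) (e′ (im u) (im v))
      where
      e′ : ∀ u v → (- u) - (- v) ≡ - (u - v)
      e′ = solve-∀ ℚ-ring
  ℂ-*-cong : ∀ {u v x y} → u ≈ v → x ≈ y → (u *ᶜ x) ≈ (v *ᶜ y)
  ℂ-*-cong {u} {v} {x} {y} p q = ≈-intro {u *ᶜ x} {v *ᶜ y}
    (≼-≡ {(u *ᶜ x) -ᶜ (v *ᶜ y)} {((u -ᶜ v) *ᶜ x) +ᶜ ((x -ᶜ y) *ᶜ v)} (λ k → e (approx u k) (approx v k) (approx x k) (approx y k))
       (≼-+ {(u -ᶜ v) *ᶜ x} {(x -ᶜ y) *ᶜ v} (≼0-*ˡ {u -ᶜ v} {x} (≈-elim {u} {v} p)) (≼0-*ˡ {x -ᶜ y} {v} (≈-elim {x} {y} q))))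
    where
    e : ∀ u v x y → (u ℚ[i].* x) ℚ[i].- (v ℚ[i].* y) ≡ (u ℚ[i].- v) ℚ[i].* x ℚ[i].+ (x ℚ[i].- y) ℚ[i].* v
    e (u +i u′) (v +i v′) (x +i x′) (y +i y′) = cong₂ _+i_ (e₁ u u′ v v′ x x′ y y′) (e₂ u u′ v v′ x x′ y y′)
      where
      e₁ : ∀ u u′ v v′ x x′ y y′ → (u * x - u′ * x′) - (v * y - v′ * y′) ≡
        ((u - v) * x - (u′ - v′) * x′) + ((x - y) * v - (x′ - y′) * v′)
      e₁ = solve-∀ ℚ-ring
      e₂ : ∀ u u′ v v′ x x′ y y′ → (u * x′ + u′ * x) - (v * y′ + v′ * y) ≡
        ((u - v) * x′ + (u′ - v′) * x) + ((x - y) * v′ + (x′ - y′) * v)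
      e₂ = solve-∀ ℚ-ring

opaque
  unfolding _+ᶜ_ _*ᶜ_ -ᶜ_

  ℂ-+-assoc : ∀ x y z → (x +ᶜ y) +ᶜ z ≈ x +ᶜ (y +ᶜ z)
  ℂ-+-assoc x y z = approx-≡ λ k → ℚ[i].+-assoc (approx x k) (approx y k) (approx z k)

  ℂ-+-identityˡ : ∀ x → 0ℂ +ᶜ x ≈ x
  ℂ-+-identityˡ x = approx-≡ λ k → ℚ[i].+-identityˡ (approx x k)

  ℂ-+-comm : ∀ x y → x +ᶜ y ≈ y +ᶜ x
  ℂ-+-comm x y = approx-≡ λ k → ℚ[i].+-comm (approx x k) (approx y k)

  ℂ-inverseˡ : ∀ x → (-ᶜ x) +ᶜ x ≈ 0ℂ
  ℂ-inverseˡ x = approx-≡ λ k → ℚ[i].-‿inverseˡ (approx x k)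

  ℂ-*-assoc : ∀ x y z → (x *ᶜ y) *ᶜ z ≈ x *ᶜ (y *ᶜ z)
  ℂ-*-assoc x y z = approx-≡ λ k → ℚ[i].*-assoc (approx x k) (approx y k) (approx z k)

  ℂ-*-identityˡ : ∀ x → 1ℂ *ᶜ x ≈ x
  ℂ-*-identityˡ x = approx-≡ λ k → ℚ[i].*-identityˡ (approx x k)

  ℂ-*-comm : ∀ x y → x *ᶜ y ≈ y *ᶜ x
  ℂ-*-comm x y = approx-≡ λ k → ℚ[i].*-comm (approx x k) (approx y k)

  ℂ-distribˡ : ∀ x y z → x *ᶜ (y +ᶜ z) ≈ x *ᶜ y +ᶜ x *ᶜ z
  ℂ-distribˡ x y z = approx-≡ λ k → ℚ[i].distribˡ (approx x k) (approx y k) (approx z k)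

≈-isEquivalence : IsEquivalence _≈_
≈-isEquivalence = record { refl = ≈-refl ; sym = ≈-sym ; trans = ≈-trans }

≈-setoid : Setoid 0ℓ 0ℓ
≈-setoid = record { isEquivalence = ≈-isEquivalence }

open import Algebra.Consequences.Setoid ≈-setoid
  using (comm∧idˡ⇒id; comm∧invˡ⇒inv; comm∧distrˡ⇒distr)

ℂ-commutativeRing : CommutativeRing 0ℓ 0ℓ
ℂ-commutativeRing = record
  { isCommutativeRing = record
    { isRing = record
      { +-isAbelianGroup = record
        { isGroup = record
          { isMonoid = record
            { isSemigroup = record
              { isMagma = record
                { isEquivalence = ≈-isEquivalence ; ∙-cong = ℂ-+-cong }
              ; assoc = ℂ-+-assoc }
            ; identity = comm∧idˡ⇒id ℂ-+-comm ℂ-+-identityˡ }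
          ; inverse = comm∧invˡ⇒inv ℂ-+-comm ℂ-inverseˡ
          ; ⁻¹-cong = ℂ-neg-cong }
        ; comm = ℂ-+-comm }
      ; *-cong = ℂ-*-cong
      ; *-assoc = ℂ-*-assoc
      ; *-identity = comm∧idˡ⇒id ℂ-*-comm ℂ-*-identityˡ
      ; distrib = comm∧distrˡ⇒distr ℂ-+-cong ℂ-*-comm ℂ-distribˡ
      }
    ; *-comm = ℂ-*-comm
    }
  }

opaque
  unfolding _+ᶜ_ _*ᶜ_ -ᶜ_

  ≼-resp-≈ : ∀ {z w B} → z ≈ w → w ≼ B → z ≼ B
  ≼-resp-≈ {z} {w} {B} p w≼B = ≼-≡ {z} {w +ᶜ (z -ᶜ w)} (λ k → e (approx z k) (approx w k))
    (subst ((w +ᶜ (z -ᶜ w)) ≼_) (+-identityʳ B) (≼-+ {w} {z -ᶜ w} w≼B (≈-elim {z} {w} p)))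
    where
    e : ∀ z w → z ≡ w ℚ[i].+ (z ℚ[i].- w)
    e z w = cong₂ _+i_ (e′ (re z) (re w)) (e′ (im z) (im w))
      where
      e′ : ∀ z w → z ≡ w + (z - w)
      e′ = solve-∀ ℚ-ring

opaque
  unfolding _+ᶜ_ _*ᶜ_ -ᶜ_

  ≈0⇒≃0 : ∀ {z} → z ≈ 0ℂ → z ≃ℂ 0ℂ
  ≈0⇒≃0 {z} (mk≈ q) = (λ ε 0<ε → eventually-map (λ k → ≤-trans (∣re∣≤N1 (w k))) (q ε 0<ε))
                          , (λ ε 0<ε → eventually-map (λ k → ≤-trans (∣im∣≤N1 (w k))) (q ε 0<ε))
    where
    w : ℕ → ℚ[i]
    w k = approx (z -ᶜ 0ℂ) k

-- The exponential

^ⁱ-distrib-* : ∀ z w n → (z *ⁱ w) ^ⁱ n ≡ z ^ⁱ n *ⁱ w ^ⁱ n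
^ⁱ-distrib-* z w zero = sym (ℚ[i].*-identityˡ 1ⁱ)
^ⁱ-distrib-* z w (suc n) = begin
  (z *ⁱ w) *ⁱ (z *ⁱ w) ^ⁱ n            ≡⟨ cong ((z *ⁱ w) *ⁱ_) (^ⁱ-distrib-* z w n) ⟩
  (z *ⁱ w) *ⁱ (z ^ⁱ n *ⁱ w ^ⁱ n)       ≡⟨ ℚ[i].*-assoc z w _ ⟩
  z *ⁱ (w *ⁱ (z ^ⁱ n *ⁱ w ^ⁱ n))       ≡⟨ cong (z *ⁱ_) (ℚ[i].*-assoc w (z ^ⁱ n) (w ^ⁱ n)) ⟨
  z *ⁱ ((w *ⁱ z ^ⁱ n) *ⁱ w ^ⁱ n)       ≡⟨ cong (λ x → z *ⁱ (x *ⁱ w ^ⁱ n)) (ℚ[i].*-comm w (z ^ⁱ n)) ⟩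
  z *ⁱ ((z ^ⁱ n *ⁱ w) *ⁱ w ^ⁱ n)       ≡⟨ cong (z *ⁱ_) (ℚ[i].*-assoc (z ^ⁱ n) w (w ^ⁱ n)) ⟩
  z *ⁱ (z ^ⁱ n *ⁱ (w *ⁱ w ^ⁱ n))       ≡⟨ ℚ[i].*-assoc z (z ^ⁱ n) _ ⟨
  (z *ⁱ z ^ⁱ n) *ⁱ (w *ⁱ w ^ⁱ n)       ∎
  where open ≡-Reasoning

-- 1 + h(z + w) and (1 + hz)(1 + hw) differ by h²zw only.
E-+ : ∀ k z w B C → 0ℚ ≤ B → N1 z ≤ B → N1 w ≤ B → 0ℚ ≤ C → (1ℚ + B * h k) ^ (2^ k) ≤ C →
  dist (E k (z +ⁱ w)) (E k z *ⁱ E k w) ≤ C * C * (N1 z * N1 w) * h k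
E-+ k z w B C 0≤B z≤B w≤B 0≤C m^≤C = begin
  dist (a ^ⁱ n) (E k z *ⁱ E k w)       ≡⟨ cong (dist (a ^ⁱ n)) (^ⁱ-distrib-* (lin k z) (lin k w) n) ⟨
  dist (a ^ⁱ n) (b ^ⁱ n)               ≤⟨ pow-diff a b M 1≤M a≤M b≤M n ⟩
  ι n * M ^ n * dist a b               ≤⟨ *-mono (0≤N1 (a -ⁱ b)) (*-nn (0≤ι n) (^-nn n (≤-trans 0≤1 1≤M)))
                                            (*-monoˡ (0≤ι n) M^≤) ab ⟩
  ι n * (C * C) * (h k * h k * D)      ≡⟨ e (ι n) C (h k) D ⟩
  (ι n * h k) * (C * C * D * h k)      ≡⟨ cong (_* (C * C * D * h k)) (2^*h k) ⟩
  1ℚ * (C * C * D * h k)               ≡⟨ *-identityˡ _ ⟩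
  C * C * D * h k                      ∎
  where
  open ≤-Reasoning
  n = 2^ k
  m = 1ℚ + B * h k
  M = m * m
  a = lin k (z +ⁱ w)
  b = lin k z *ⁱ lin k w
  D = N1 z * N1 w
  0≤Bh : 0ℚ ≤ B * h k
  0≤Bh = *-nn 0≤B (0≤h k)
  1≤m : 1ℚ ≤ m
  1≤m = p≤p+ε 1ℚ 0≤Bh
  1≤M : 1ℚ ≤ M
  1≤M = *-mono 0≤1 0≤1 1≤m 1≤m
  a≤M : N1 a ≤ M
  a≤M = ≤-trans (N1-lin k (z +ⁱ w) (B + B) (≤-trans (N1-+ z w) (+-mono-≤ z≤B w≤B)))
          (by-diff {1ℚ + (B + B) * h k} {M} _ (sq-nn (B * h k)) (e₀ B (h k)))
    where
    e₀ : ∀ B h → 1ℚ + (B + B) * h + B * h * (B * h) ≡ (1ℚ + B * h) * (1ℚ + B * h)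
    e₀ = solve-∀ ℚ-ring
  b≤M : N1 b ≤ M
  b≤M = ≤-trans (N1-* (lin k z) (lin k w))
    (*-mono (0≤N1 (lin k w)) (0≤N1 (lin k z)) (N1-lin k z B z≤B) (N1-lin k w B w≤B))
  M^≤ : M ^ n ≤ C * C
  M^≤ = ≤-trans (≤-reflexive (*-^ m m n)) (*-mono (^-nn n 0≤m) (^-nn n 0≤m) m^≤C m^≤C)
    where
    0≤m : 0ℚ ≤ m
    0≤m = ≤-trans 0≤1 1≤m
  ab : dist a b ≤ h k * h k * D
  ab = begin
    dist a b                                               ≡⟨ cong₂ (λ x y → ∣ x ∣ + ∣ y ∣)
                                                               (r₁ (h k) (re z) (im z) (re w) (im w)) (r₂ (h k) (re z) (im z) (re w) (im w)) ⟩
    ∣ - (h k * h k * re (z *ⁱ w)) ∣ + ∣ - (h k * h k * im (z *ⁱ w)) ∣ ≡⟨ cong₂ _+_ (habs (re (z *ⁱ w))) (habs (im (z *ⁱ w))) ⟩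
    h k * h k * ∣ re (z *ⁱ w) ∣ + h k * h k * ∣ im (z *ⁱ w) ∣ ≡⟨ *-distribˡ-+ (h k * h k) _ _ ⟨
    h k * h k * N1 (z *ⁱ w)                                ≤⟨ *-monoˡ (*-nn (0≤h k) (0≤h k)) (N1-* z w) ⟩
    h k * h k * D                                          ∎
    where
    habs : ∀ p → ∣ - (h k * h k * p) ∣ ≡ h k * h k * ∣ p ∣
    habs p = trans (∣-p∣≡∣p∣ (h k * h k * p)) (trans (∣p*q∣≡∣p∣*∣q∣ (h k * h k) p) (cong (_* ∣ p ∣) (0≤p⇒∣p∣≡p (*-nn (0≤h k) (0≤h k)))))
    r₁ : ∀ h a b c d → 1ℚ + h * (a + c) - ((1ℚ + h * a) * (1ℚ + h * c) - (h * b) * (h * d)) ≡ - (h * h * (a * c - b * d))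
    r₁ = solve-∀ ℚ-ring
    r₂ : ∀ h a b c d → h * (b + d) - ((1ℚ + h * a) * (h * d) + (h * b) * (1ℚ + h * c)) ≡ - (h * h * (a * d + b * c))
    r₂ = solve-∀ ℚ-ring
  e : ∀ n C h D → n * (C * C) * (h * h * D) ≡ (n * h) * (C * C * D * h)
  e = solve-∀ ℚ-ring

exp-bound′ : ∀ B → 0ℚ ≤ B → ∃ λ C → 0ℚ ≤ C × Eventually λ k → (1ℚ + B * h k) ^ (2^ k) ≤ C
exp-bound′ B 0≤B =
  let j , C , 0≤C , bd = exp-bound B 0≤B
  in C , 0≤C , j , λ k j≤k → subst (λ k → (1ℚ + B * h k) ^ (2^ k) ≤ C) (ℕ.m+[n∸m]≡n j≤k) (bd (k ℕ.∸ j))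

eventually-Kh≤ε : ∀ K ε → 0ℚ ≤ K → 0ℚ < ε → Eventually λ k → K * h k ≤ ε
eventually-Kh≤ε K ε 0≤K 0<ε =
  let δ , 0<δ , Kδ≤ε = shrink 0≤K 0<ε
  in eventually-map (λ k hk≤δ → ≤-trans (*-monoˡ 0≤K hk≤δ) Kδ≤ε) (h-small δ 0<δ)

opaque
  expᶜ : ℂ → ℂ
  expᶜ z = exp z

opaque
  unfolding _+ᶜ_ _*ᶜ_ expᶜ

  -- The k-th approximants of all three exponentials use the same `E k`, so `E-+` bounds the
  -- difference by K h k with K depending only on bounds for `z` and `w`.
  exp-+ : ∀ z w → expᶜ (z +ᶜ w) ≈ expᶜ z *ᶜ expᶜ w
  exp-+ z w =
    let A , 0≤A , evA = eventually-bounded z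
        B , 0≤B , evB = eventually-bounded w
        C , 0≤C , evC = exp-bound′ (A + B) (+-nn 0≤A 0≤B)
        0≤CC = *-nn 0≤C 0≤C
        0≤K = *-nn 0≤CC (*-nn 0≤A 0≤B)
    in mk≈ λ ε 0<ε → eventually-map₂ (λ k (z≤A , w≤B) (m^≤C , Kh≤ε) → ≤-trans
        (E-+ k (approx z k) (approx w k) (A + B) C (+-nn 0≤A 0≤B)
          (≤-trans z≤A (p≤p+ε A 0≤B)) (≤-trans w≤B (subst (B ≤_) (+-comm B A) (p≤p+ε B 0≤A))) 0≤C m^≤C)
        (≤-trans (*-monoʳ (0≤h k) (*-monoˡ 0≤CC (*-mono (0≤N1 (approx w k)) (0≤N1 (approx z k)) z≤A w≤B))) Kh≤ε))
      (eventually-map₂ (λ k → _,_) evA evB)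
      (eventually-map₂ (λ k → _,_) evC (eventually-Kh≤ε _ ε 0≤K 0<ε))

  exp-≡ : ∀ {z w} → (∀ k → approx z k ≡ approx w k) → expᶜ z ≈ expᶜ w
  exp-≡ eq = approx-≡ λ k → cong (E k) (eq k)

opaque
  unfolding expᶜ

  approx-expᶜ : ∀ z k → approx (expᶜ z) k ≡ E k (approx z k)
  approx-expᶜ z k = refl

-- The terms exp (2πi (pτ + r)) with rational p and r

shift : ℚ → ℤ → ℚ
shift ε n = n / 1 + ½ * ε

module _ (τ : ℂ) where

  -- Terms of the theta series, their products and the roots of unity (p = 0) all have such
  -- exponents, so multiplying them is addition of pairs of rationals.
  Φ-exponent : ℚ → ℚ → ℂ
  Φ-exponent p r = 2πi *ℂ (ofℝ (fromℚ p) *ℂ τ +ℂ ofℝ (fromℚ r))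

  opaque
    Φ : ℚ → ℚ → ℂ
    Φ p r = expᶜ (Φ-exponent p r)

  private
    x y : ℕ → ℚ
    x k = seq (re τ) k
    y k = seq (im τ) k

  Φ-exponent-re : ∀ p r k → re (approx (Φ-exponent p r) k) ≡ - (2ℚ * πSeq k * (p * y k))
  Φ-exponent-re p r k = e (πSeq k) p r (x k) (y k)
    where
    e : ∀ π p r x y → 0ℚ * (p * x - 0ℚ * y + r) - (1ℚ + 1ℚ) * π * (p * y + 0ℚ * x + 0ℚ) ≡ - ((1ℚ + 1ℚ) * π * (p * y))
    e = solve-∀ ℚ-ring

  Φ-exponent-im : ∀ p r k → im (approx (Φ-exponent p r) k) ≡ 2ℚ * πSeq k * (p * x k + r)
  Φ-exponent-im p r k = e (πSeq k) p r (x k) (y k)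
    where
    e : ∀ π p r x y → 0ℚ * (p * y + 0ℚ * x + 0ℚ) + (1ℚ + 1ℚ) * π * (p * x - 0ℚ * y + r) ≡ (1ℚ + 1ℚ) * π * (p * x + r)
    e = solve-∀ ℚ-ring

  Φ-exponent-+ : ∀ p r p′ r′ k → approx (Φ-exponent (p + p′) (r + r′)) k ≡ approx (Φ-exponent p r) k +ⁱ approx (Φ-exponent p′ r′) k
  Φ-exponent-+ p r p′ r′ k = cong₂ _+i_
    (trans (Φ-exponent-re (p + p′) (r + r′) k)
      (trans (e₁ (πSeq k) p p′ (y k)) (sym (cong₂ _+_ (Φ-exponent-re p r k) (Φ-exponent-re p′ r′ k)))))
    (trans (Φ-exponent-im (p + p′) (r + r′) k)
      (trans (e₂ (πSeq k) p p′ (x k) r r′) (sym (cong₂ _+_ (Φ-exponent-im p r k) (Φ-exponent-im p′ r′ k)))))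
    where
    e₁ : ∀ π p p′ y → - ((1ℚ + 1ℚ) * π * ((p + p′) * y)) ≡ - ((1ℚ + 1ℚ) * π * (p * y)) + - ((1ℚ + 1ℚ) * π * (p′ * y))
    e₁ = solve-∀ ℚ-ring
    e₂ : ∀ π p p′ x r r′ → (1ℚ + 1ℚ) * π * ((p + p′) * x + (r + r′)) ≡ (1ℚ + 1ℚ) * π * (p * x + r) + (1ℚ + 1ℚ) * π * (p′ * x + r′)
    e₂ = solve-∀ ℚ-ring

  θ-exponent≡Φ-exponent : ∀ ε ε′ n k → approx (θ-exponent (fromℚ ε) (fromℚ ε′) 0ℂ τ n) k ≡
    approx (Φ-exponent (½ * (shift ε n * shift ε n)) (shift ε n * (½ * ε′))) k
  θ-exponent≡Φ-exponent ε ε′ n k = cong₂ _+i_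
    (trans (e₁ (πSeq k) s (½ * ε′) (x k) (y k)) (sym (Φ-exponent-re (½ * (s * s)) (s * (½ * ε′)) k)))
    (trans (e₂ (πSeq k) s (½ * ε′) (x k) (y k)) (sym (Φ-exponent-im (½ * (s * s)) (s * (½ * ε′)) k)))
    where
    s = shift ε n
    e₁ : ∀ π s ε x y → 0ℚ * ((½ * (s * s) * x - 0ℚ * y) + (s * (0ℚ + ε) - 0ℚ * (0ℚ + 0ℚ)))
      - (1ℚ + 1ℚ) * π * ((½ * (s * s) * y + 0ℚ * x) + (s * (0ℚ + 0ℚ) + 0ℚ * (0ℚ + ε))) ≡ - ((1ℚ + 1ℚ) * π * (½ * (s * s) * y))
    e₁ = solve-∀ ℚ-ring
    e₂ : ∀ π s ε x y → 0ℚ * ((½ * (s * s) * y + 0ℚ * x) + (s * (0ℚ + 0ℚ) + 0ℚ * (0ℚ + ε)))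
      + (1ℚ + 1ℚ) * π * ((½ * (s * s) * x - 0ℚ * y) + (s * (0ℚ + ε) - 0ℚ * (0ℚ + 0ℚ))) ≡ (1ℚ + 1ℚ) * π * (½ * (s * s) * x + s * ε)
    e₂ = solve-∀ ℚ-ring

  real-exponent≡Φ-exponent : ∀ q k → approx (2πi *ℂ ofℝ (fromℚ q)) k ≡ approx (Φ-exponent 0ℚ q) k
  real-exponent≡Φ-exponent q k = cong₂ _+i_
    (trans (e₁ (πSeq k) q (x k) (y k)) (sym (Φ-exponent-re 0ℚ q k)))
    (trans (e₂ (πSeq k) q (x k) (y k)) (sym (Φ-exponent-im 0ℚ q k)))
    where
    e₁ : ∀ π r x y → 0ℚ * r - (1ℚ + 1ℚ) * π * 0ℚ ≡ - ((1ℚ + 1ℚ) * π * (0ℚ * y))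
    e₁ = solve-∀ ℚ-ring
    e₂ : ∀ π r x y → 0ℚ * 0ℚ + (1ℚ + 1ℚ) * π * r ≡ (1ℚ + 1ℚ) * π * (0ℚ * x + r)
    e₂ = solve-∀ ℚ-ring

  opaque
    unfolding _+ᶜ_

    exp-Φ-exponent-+ : ∀ p r p′ r′ → expᶜ (Φ-exponent (p + p′) (r + r′)) ≈ expᶜ (Φ-exponent p r +ᶜ Φ-exponent p′ r′)
    exp-Φ-exponent-+ p r p′ r′ =
      exp-≡ {Φ-exponent (p + p′) (r + r′)} {Φ-exponent p r +ᶜ Φ-exponent p′ r′} (Φ-exponent-+ p r p′ r′)

  opaque
    unfolding Φ

    Φ-+ : ∀ p r p′ r′ → Φ (p + p′) (r + r′) ≈ Φ p r *ᶜ Φ p′ r′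
    Φ-+ p r p′ r′ = ≈-trans (exp-Φ-exponent-+ p r p′ r′) (exp-+ (Φ-exponent p r) (Φ-exponent p′ r′))

    approx-Φ : ∀ p r k → approx (Φ p r) k ≡ E k (approx (Φ-exponent p r) k)
    approx-Φ p r k = approx-expᶜ (Φ-exponent p r) k

  ζ₅≈Φ : ζ₅ ≈ Φ 0ℚ (ℤ.+ 1 / 5)
  ζ₅≈Φ = approx-≡ eq
    where
    eq : ∀ k → approx ζ₅ k ≡ approx (Φ 0ℚ (ℤ.+ 1 / 5)) k
    eq k = trans (cong (E k) (real-exponent≡Φ-exponent (ℤ.+ 1 / 5) k)) (sym (approx-Φ 0ℚ (ℤ.+ 1 / 5) k))

-- The bound |p| y² ≤ 1 of Defs, solved for |p| when y ≥ q / 4 and s = 1 / q.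
part≤ : ∀ p x q s → 0ℚ ≤ q → 0ℚ ≤ s → q * s ≡ 1ℚ → q ≤ x →
  ∣ p ∣ * ((1ℚ + ¼ * x) * (1ℚ + ¼ * x)) ≤ 1ℚ → ∣ p ∣ ≤ 16ℚ * (s * s)
part≤ p x q s 0≤q 0≤s qs≡1 q≤x bd = begin
  ∣ p ∣                                ≡⟨ *-identityʳ ∣ p ∣ ⟨
  ∣ p ∣ * (1ℚ * 1ℚ)                    ≤⟨ *-monoˡ (0≤∣p∣ p) (*-mono 0≤1 0≤1 1≤4ys 1≤4ys) ⟩
  ∣ p ∣ * ((4ℚ * y * s) * (4ℚ * y * s)) ≡⟨ e ∣ p ∣ 4ℚ y s ⟩
  ∣ p ∣ * (y * y) * (16ℚ * (s * s))    ≤⟨ *-monoʳ (*-nn 0≤16 (*-nn 0≤s 0≤s)) bd ⟩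
  1ℚ * (16ℚ * (s * s))                 ≡⟨ *-identityˡ _ ⟩
  16ℚ * (s * s)                        ∎
  where
  open ≤-Reasoning
  y = 1ℚ + ¼ * x
  e : ∀ p f y s → p * ((f * y * s) * (f * y * s)) ≡ p * (y * y) * (f * f * (s * s))
  e = solve-∀ ℚ-ring
  x≤4y : x ≤ 4ℚ * y
  x≤4y = subst (x ≤_) (e₁ x) (p≤p+ε x {4ℚ} (nonNegative⁻¹ 4ℚ))
    where
    e₁ : ∀ x → x + (1ℚ + 1ℚ) * (1ℚ + 1ℚ) ≡ (1ℚ + 1ℚ) * (1ℚ + 1ℚ) * (1ℚ + ½ * ½ * x)
    e₁ = solve-∀ ℚ-ring
  1≤4ys : 1ℚ ≤ 4ℚ * y * s
  1≤4ys = subst (_≤ 4ℚ * y * s) qs≡1 (*-monoʳ 0≤s (≤-trans q≤x x≤4y))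

-- Decay of the terms

32ℚ : ℚ
32ℚ = 16ℚ + 16ℚ

module _ (τ : ℍ) where

  private
    y : ℕ → ℚ
    y k = seq (im (point τ)) k

    c = proj₁ (0<im τ)

    0<c : 0ℚ < c
    0<c = proj₁ (proj₂ (0<im τ))

    c≤y : Eventually λ k → c ≤ y k
    c≤y = eventually-map (λ k → subst (_≤ y k) (+-identityˡ c)) (proj₂ (proj₂ (0<im τ)))

  -- The real part of the exponent is -2π (½p) Im τ, of size at least c p ≥ q because π ≥ 1 and Im τ
  -- ≥ c. The constant 32 is 16 for the real part and 16 for the imaginary part.
  Φ-bound : ∀ p r q s → 0ℚ ≤ p → 1ℚ ≤ q → q ≤ c * p → 0ℚ ≤ s → q * s ≡ 1ℚ →
    Φ (point τ) (½ * p) r ≼ (32ℚ * (s * s))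
  Φ-bound p r q s 0≤p 1≤q q≤cp 0≤s qs≡1 = subst (Φ (point τ) (½ * p) r ≼_) (sym (*-distribʳ-+ (s * s) 16ℚ 16ℚ)) (eventually-≼ (eventually-map₂ (λ k → pointwise k)
    (eventually-map₂ (λ k → _,_) c≤y (nm-small (seq (re w)) (seq (im w)) (cauchy (re w)) (cauchy (im w)))) (2 , λ k 2≤k → 2≤k)))
    where
    w = Φ-exponent (point τ) (½ * p) r
    X : ℕ → ℚ
    X k = 2ℚ * πSeq k * (½ * p * y k)
    0≤q : 0ℚ ≤ q
    0≤q = ≤-trans 0≤1 1≤q
    q≤X : ∀ k → c ≤ y k → q ≤ X k
    q≤X k c≤yk = begin
      q                  ≤⟨ q≤cp ⟩
      c * p              ≤⟨ *-monoʳ 0≤p c≤yk ⟩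
      y k * p            ≡⟨ *-identityˡ _ ⟨
      1ℚ * (y k * p)     ≤⟨ *-monoʳ (*-nn (≤-trans (<⇒≤ 0<c) c≤yk) 0≤p) (1≤π k) ⟩
      πSeq k * (y k * p) ≡⟨ e (πSeq k) (y k) p ⟩
      X k                ∎
      where
      open ≤-Reasoning
      e : ∀ π y p → π * (y * p) ≡ (1ℚ + 1ℚ) * π * (½ * p * y)
      e = solve-∀ ℚ-ring
    pointwise : ∀ k → c ≤ y k × nm (approx w k) * h k ≤ 1ℚ → 2 ℕ.≤ k →
      N1 (approx (Φ (point τ) (½ * p) r) k) ≤ 16ℚ * (s * s) + 16ℚ * (s * s)
    pointwise (suc (suc k)) (c≤yk , small) _ =
      subst (λ z → N1 z ≤ 16ℚ * (s * s) + 16ℚ * (s * s)) (sym (approx-Φ (point τ) (½ * p) r (2 ℕ.+ k)))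
        (+-mono-≤ (bd (re z) (p≤p+ε (re z * re z) (sq-nn (im z))))
                  (bd (im z) (subst (im z * im z ≤_) (+-comm (im z * im z) (re z * re z)) (p≤p+ε (im z * im z) (sq-nn (re z))))))
      where
      z = E (2 ℕ.+ k) (approx w (2 ℕ.+ k))
      x = X (2 ℕ.+ k)
      q≤x : q ≤ x
      q≤x = q≤X (2 ℕ.+ k) c≤yk
      bd : ∀ t → t * t ≤ nm z → ∣ t ∣ ≤ 16ℚ * (s * s)
      bd t tt≤ = part≤ t x q s 0≤q 0≤s qs≡1 q≤x
        (Decay.part-bound (approx w (2 ℕ.+ k)) k x (Φ-exponent-re (point τ) (½ * p) r (2 ℕ.+ k)) (≤-trans 0≤q q≤x)
          (≤-trans small (≤-trans 1≤q q≤x)) t tt≤)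
    pointwise (suc zero) _ (ℕ.s≤s ())

  -- Squaring the bound for half the exponent doubles the order of decay.
  Φ-decay : ∃ λ c → 0ℚ < c × ∀ p r q s → 0ℚ ≤ p → 1ℚ ≤ q → q ≤ c * p → 0ℚ ≤ s → q * s ≡ 1ℚ →
    Φ (point τ) p r ≼ (32ℚ * (s * s) * (32ℚ * (s * s)))
  Φ-decay = c , 0<c , λ p r q s 0≤p 1≤q q≤cp 0≤s qs≡1 →
    let 0≤K = *-nn {32ℚ} {s * s} (nonNegative⁻¹ 32ℚ) (*-nn 0≤s 0≤s)
        bd = Φ-bound p (½ * r) q s 0≤p 1≤q q≤cp 0≤s qs≡1
    in ≼-resp-≈ (halves p r) (≼-* 0≤K 0≤K bd bd)
    where
    halves : ∀ p r → Φ (point τ) p r ≈ Φ (point τ) (½ * p) (½ * r) *ᶜ Φ (point τ) (½ * p) (½ * r)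
    halves p r = subst₂ (λ p′ r′ → Φ (point τ) p′ r′ ≈ Φ (point τ) (½ * p) (½ * r) *ᶜ Φ (point τ) (½ * p) (½ * r)) (e p) (e r)
      (Φ-+ (point τ) (½ * p) (½ * r) (½ * p) (½ * r))
      where
      e : ∀ p → ½ * p + ½ * p ≡ p
      e = solve-∀ ℚ-ring

-- The value exp (πi/2) = i

-- By Bernoulli (1 - u)^n ≥ 1 - nu = 1 - B ≥ ½, while (1 + u)(1 - u) ≤ 1. The explicit constant 2,
-- valid from k = 0 on, is what `E-linear` uses.
≤2-^ : ∀ B → 0ℚ ≤ B → B ≤ ½ → ∀ k → (1ℚ + B * h k) ^ (2^ k) ≤ 2ℚ
≤2-^ B 0≤B B≤½ k = begin
  a                    ≡⟨ *-identityʳ a ⟨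
  a * (½ * 2ℚ)         ≡⟨ *-assoc a ½ 2ℚ ⟨
  a * ½ * 2ℚ           ≤⟨ *-monoʳ 0≤2 (*-monoˡ (^-nn n (+-nn 0≤1 0≤u)) ½≤b) ⟩
  a * b * 2ℚ           ≡⟨ cong (_* 2ℚ) (*-^ (1ℚ + u) (1ℚ + - u) n) ⟨
  ((1ℚ + u) * (1ℚ + - u)) ^ n * 2ℚ ≤⟨ *-monoʳ 0≤2 (≤1-^ n (*-nn (+-nn 0≤1 0≤u) 0≤1-u) (by-diff {(1ℚ + u) * (1ℚ + - u)} {1ℚ} (u * u) (sq-nn u) (sq u))) ⟩
  1ℚ * 2ℚ              ≡⟨ *-identityˡ 2ℚ ⟩
  2ℚ                   ∎
  where
  open ≤-Reasoning
  n = 2^ k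
  u = B * h k
  a = (1ℚ + u) ^ n
  b = (1ℚ + - u) ^ n
  0≤u : 0ℚ ≤ u
  0≤u = *-nn 0≤B (0≤h k)
  u≤1 : u ≤ 1ℚ
  u≤1 = *-mono {B} {1ℚ} {h k} {1ℚ} (0≤h k) 0≤B (≤-trans B≤½ (p≤p+ε ½ 0≤½)) (h≤1 k)
  0≤1-u : 0ℚ ≤ 1ℚ + - u
  0≤1-u = diff u≤1
  sq : ∀ u → (1ℚ + u) * (1ℚ + - u) + u * u ≡ 1ℚ
  sq = solve-∀ ℚ-ring
  nu≡B : ι n * u ≡ B
  nu≡B = trans (e (ι n) B (h k)) (trans (cong (B *_) (2^*h k)) (*-identityʳ B))
    where
    e : ∀ n B h → n * (B * h) ≡ B * (n * h)
    e = solve-∀ ℚ-ring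
  ½≤b : ½ ≤ b
  ½≤b = begin
    ½                    ≤⟨ by-diff {½} {1ℚ + - B} (½ - B) (diff B≤½) (e B) ⟩
    1ℚ + - B             ≡⟨ cong (λ x → 1ℚ + - x) nu≡B ⟨
    1ℚ + - (ι n * u)     ≡⟨ cong (1ℚ +_) (neg-distribʳ-* (ι n) u) ⟩
    1ℚ + ι n * - u       ≤⟨ bernoulli (- u) n 0≤1-u ⟩
    b                    ∎
    where
    e : ∀ x → ½ + (½ - x) ≡ 1ℚ + - x
    e = solve-∀ ℚ-ring

-- The approximations start with `E 0 z = 1 + z`, so summing all steps of their convergence from 0
-- on measures the distance to the linear part.
E-linear : ∀ k z B → 0ℚ ≤ B → B ≤ ½ → N1 z ≤ B → dist (E k z) (1ⁱ +ⁱ z) ≤ 4ℚ * (B * B)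
E-linear k z B 0≤B B≤½ z≤B = begin
  dist (E k z) (1ⁱ +ⁱ z)       ≡⟨ cong (dist (E k z)) E0 ⟨
  dist (E k z) (E 0 z)         ≤⟨ telescope′ (λ m n → dist (E m z) (E n z)) (λ a b c → dist-tri (E a z) (E b z) (E c z)) (λ m → dist-refl (E m z))
                                    (2ℚ * (B * B)) 0 (*-nn 0≤2 (*-nn 0≤B 0≤B))
                                    (ExpCauchy.step (λ _ → z) B 0≤B 0 2ℚ 0≤2 (≤2-^ B 0≤B B≤½) z z≤B) k 0 ℕ.z≤n ℕ.z≤n ⟩
  2ℚ * (2ℚ * (B * B)) * 1ℚ     ≡⟨ e B ⟩
  4ℚ * (B * B)                 ∎
  where
  open ≤-Reasoning
  e : ∀ B → (1ℚ + 1ℚ) * ((1ℚ + 1ℚ) * (B * B)) * 1ℚ ≡ (1ℚ + 1ℚ) * (1ℚ + 1ℚ) * (B * B)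
  e = solve-∀ ℚ-ring
  E0 : E 0 z ≡ 1ⁱ +ⁱ z
  E0 = trans (ℚ[i].*-identityʳ (lin 0 z)) (cong₂ _+i_ (cong (1ℚ +_) (*-identityˡ (re z))) (trans (*-identityˡ (im z)) (sym (+-identityˡ (im z)))))

-- U t = (1 + it)² / (1 + t²) solves U′ = 2i/(1 + t²) U, with U 0 = 1 and U 1 = i.
U : ℚ → ℚ[i]
U t = (2ℚ * 1/1+sq t - 1ℚ) +i (2ℚ * (t * 1/1+sq t))

24ℚ : ℚ
24ℚ = 4ℚ * (4ℚ + 2ℚ)

∣*∣≤ : ∀ {u v U V} → 0ℚ ≤ u → u ≤ U → ∣ v ∣ ≤ V → ∣ u * v ∣ ≤ U * V
∣*∣≤ {u} {v} {U} {V} 0≤u u≤U v≤V = begin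
  ∣ u * v ∣       ≡⟨ ∣p*q∣≡∣p∣*∣q∣ u v ⟩
  ∣ u ∣ * ∣ v ∣   ≡⟨ cong (_* ∣ v ∣) (0≤p⇒∣p∣≡p 0≤u) ⟩
  u * ∣ v ∣       ≤⟨ *-mono (0≤∣p∣ v) 0≤u u≤U v≤V ⟩
  U * V           ∎
  where open ≤-Reasoning

module _ (t d : ℚ) (0≤t : 0ℚ ≤ t) (0≤d : 0ℚ ≤ d) where

  private
    f = 1/1+sq t
    g = 1/1+sq (t + d)

    f-g : f - g ≡ d * (t + t + d) * (f * g)
    f-g = begin
      f - g                                                              ≡⟨ cong₂ _-_ (sym (*-identityʳ f)) (sym (*-identityʳ g)) ⟩
      f * 1ℚ - g * 1ℚ                                                    ≡⟨ cong₂ (λ x y → f * x - g * y) (sym (f-inv (t + d))) (sym (f-inv t)) ⟩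
      f * ((1ℚ + (t + d) * (t + d)) * g) - g * ((1ℚ + t * t) * f)        ≡⟨ e f g t d ⟩
      d * (t + t + d) * (f * g)                                          ∎
      where
      open ≡-Reasoning
      e : ∀ f g t d → f * ((1ℚ + (t + d) * (t + d)) * g) - g * ((1ℚ + t * t) * f) ≡ d * (t + t + d) * (f * g)
      e = solve-∀ ℚ-ring

    t²f : t * t * f ≡ 1ℚ - f
    t²f = trans (e f t) (cong (_- f) (f-inv t))
      where
      e : ∀ f t → t * t * f ≡ (1ℚ + t * t) * f - f
      e = solve-∀ ℚ-ring

    ∣g-f∣≤ : ∣ g - f ∣ ≤ 2ℚ * d
    ∣g-f∣≤ = begin
      ∣ g - f ∣               ≤⟨ f-lip (t + d) t (+-nn 0≤t 0≤d) 0≤t ⟩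
      2ℚ * ∣ t + d - t ∣      ≡⟨ cong (λ x → 2ℚ * x) (trans (cong ∣_∣ (e t d)) (0≤p⇒∣p∣≡p 0≤d)) ⟩
      2ℚ * d                  ∎
      where
      open ≤-Reasoning
      e : ∀ t d → t + d - t ≡ d
      e = solve-∀ ℚ-ring

    ∣f-g∣≤ : ∣ f - g ∣ ≤ 2ℚ * d
    ∣f-g∣≤ = subst (_≤ 2ℚ * d) (∣-∣-sym g f) ∣g-f∣≤

    x = 2ℚ * d * f

    -- The terms of first order in d cancel; what is left has two small factors, each of them d or
    -- the difference of f and g.
    re-error : re (U t *ⁱ (1ℚ +i x)) - re (U (t + d)) ≡ 4ℚ * d * (t * f) * (g - f) + 2ℚ * d * d * (f * g)
    re-error = begin
      re (U t *ⁱ (1ℚ +i x)) - re (U (t + d))                              ≡⟨ e₁ f g t d ⟩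
      2ℚ * (f - g) - 4ℚ * d * t * f * f                                   ≡⟨ cong (λ y → 2ℚ * y - 4ℚ * d * t * f * f) f-g ⟩
      2ℚ * (d * (t + t + d) * (f * g)) - 4ℚ * d * t * f * f               ≡⟨ e₂ f g t d ⟩
      4ℚ * d * (t * f) * (g - f) + 2ℚ * d * d * (f * g)                   ∎
      where
      open ≡-Reasoning
      e₁ : ∀ f g t d → ((1ℚ + 1ℚ) * f - 1ℚ) * 1ℚ - (1ℚ + 1ℚ) * (t * f) * ((1ℚ + 1ℚ) * d * f) - ((1ℚ + 1ℚ) * g - 1ℚ) ≡
        (1ℚ + 1ℚ) * (f - g) - (1ℚ + 1ℚ) * (1ℚ + 1ℚ) * d * t * f * f
      e₁ = solve-∀ ℚ-ring
      e₂ : ∀ f g t d → (1ℚ + 1ℚ) * (d * (t + t + d) * (f * g)) - (1ℚ + 1ℚ) * (1ℚ + 1ℚ) * d * t * f * f ≡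
        (1ℚ + 1ℚ) * (1ℚ + 1ℚ) * d * (t * f) * (g - f) + (1ℚ + 1ℚ) * d * d * (f * g)
      e₂ = solve-∀ ℚ-ring

    im-error : im (U t *ⁱ (1ℚ +i x)) - im (U (t + d)) ≡ 2ℚ * d * d * (t * f * g) + 2ℚ * d * (g - f) + 4ℚ * d * f * (f - g)
    im-error = begin
      im (U t *ⁱ (1ℚ +i x)) - im (U (t + d))                              ≡⟨ e₁ f g t d ⟩
      2ℚ * t * (f - g) + 4ℚ * d * f * f - 2ℚ * d * f - 2ℚ * d * g         ≡⟨ cong (λ y → 2ℚ * t * y + 4ℚ * d * f * f - 2ℚ * d * f - 2ℚ * d * g) f-g ⟩
      2ℚ * t * (d * (t + t + d) * (f * g)) + 4ℚ * d * f * f - 2ℚ * d * f - 2ℚ * d * g ≡⟨ e₂ f g t d ⟩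
      4ℚ * d * (t * t * f) * g + 2ℚ * d * d * (t * f * g) + 4ℚ * d * f * f - 2ℚ * d * f - 2ℚ * d * g
                                                                          -- Eliminating t² by t²f =
                                                                          -- 1 - f exposes the
                                                                          -- cancellation of the
                                                                          -- terms linear in d.
                                                                          ≡⟨ cong (λ y → 4ℚ * d * y * g + 2ℚ * d * d * (t * f * g) + 4ℚ * d * f * f - 2ℚ * d * f - 2ℚ * d * g) t²f ⟩
      4ℚ * d * (1ℚ - f) * g + 2ℚ * d * d * (t * f * g) + 4ℚ * d * f * f - 2ℚ * d * f - 2ℚ * d * g
                                                                          ≡⟨ e₃ f g t d ⟩
      2ℚ * d * d * (t * f * g) + 2ℚ * d * (g - f) + 4ℚ * d * f * (f - g)  ∎
      where
      open ≡-Reasoning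
      e₁ : ∀ f g t d → ((1ℚ + 1ℚ) * f - 1ℚ) * ((1ℚ + 1ℚ) * d * f) + (1ℚ + 1ℚ) * (t * f) * 1ℚ - (1ℚ + 1ℚ) * ((t + d) * g) ≡
        (1ℚ + 1ℚ) * t * (f - g) + (1ℚ + 1ℚ) * (1ℚ + 1ℚ) * d * f * f - (1ℚ + 1ℚ) * d * f - (1ℚ + 1ℚ) * d * g
      e₁ = solve-∀ ℚ-ring
      e₂ : ∀ f g t d → (1ℚ + 1ℚ) * t * (d * (t + t + d) * (f * g)) + (1ℚ + 1ℚ) * (1ℚ + 1ℚ) * d * f * f - (1ℚ + 1ℚ) * d * f - (1ℚ + 1ℚ) * d * g ≡
        (1ℚ + 1ℚ) * (1ℚ + 1ℚ) * d * (t * t * f) * g + (1ℚ + 1ℚ) * d * d * (t * f * g) + (1ℚ + 1ℚ) * (1ℚ + 1ℚ) * d * f * f - (1ℚ + 1ℚ) * d * f - (1ℚ + 1ℚ) * d * g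
      e₂ = solve-∀ ℚ-ring
      e₃ : ∀ f g t d → (1ℚ + 1ℚ) * (1ℚ + 1ℚ) * d * (1ℚ - f) * g + (1ℚ + 1ℚ) * d * d * (t * f * g) + (1ℚ + 1ℚ) * (1ℚ + 1ℚ) * d * f * f - (1ℚ + 1ℚ) * d * f - (1ℚ + 1ℚ) * d * g ≡
        (1ℚ + 1ℚ) * d * d * (t * f * g) + (1ℚ + 1ℚ) * d * (g - f) + (1ℚ + 1ℚ) * (1ℚ + 1ℚ) * d * f * (f - g)
      e₃ = solve-∀ ℚ-ring

  -- The local error of one Euler step for U′ = 2i/(1 + t²) U. The constant is 8 + 2 for the two
  -- real error terms and 2 + 4 + 8 for the three imaginary ones.
  U-step : dist (U t *ⁱ (1ℚ +i x)) (U (t + d)) ≤ 24ℚ * (d * d)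
  U-step = begin
    dist (U t *ⁱ (1ℚ +i x)) (U (t + d))
      ≡⟨ cong₂ (λ p q → ∣ p ∣ + ∣ q ∣) re-error im-error ⟩
    ∣ a₁ + a₂ ∣ + ∣ b₁ + b₂ + b₃ ∣
      ≤⟨ +-mono-≤ (∣p+q∣≤∣p∣+∣q∣ a₁ a₂) (≤-trans (∣p+q∣≤∣p∣+∣q∣ (b₁ + b₂) b₃) (+-monoˡ-≤ ∣ b₃ ∣ (∣p+q∣≤∣p∣+∣q∣ b₁ b₂))) ⟩
    ∣ a₁ ∣ + ∣ a₂ ∣ + (∣ b₁ ∣ + ∣ b₂ ∣ + ∣ b₃ ∣)
      ≤⟨ +-mono-≤ (+-mono-≤ a₁≤ a₂≤) (+-mono-≤ (+-mono-≤ b₁≤ b₂≤) b₃≤) ⟩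
    4ℚ * d * 1ℚ * (2ℚ * d) + 2ℚ * d * d * 1ℚ + (2ℚ * d * d * 1ℚ + 2ℚ * d * (2ℚ * d) + 4ℚ * d * 1ℚ * (2ℚ * d))
      ≡⟨ e d ⟩
    24ℚ * (d * d)                                                      ∎
    where
    open ≤-Reasoning
    a₁ = 4ℚ * d * (t * f) * (g - f)
    a₂ = 2ℚ * d * d * (f * g)
    b₁ = 2ℚ * d * d * (t * f * g)
    b₂ = 2ℚ * d * (g - f)
    b₃ = 4ℚ * d * f * (f - g)
    0≤4d : 0ℚ ≤ 4ℚ * d
    0≤4d = *-nn {4ℚ} (nonNegative⁻¹ 4ℚ) 0≤d
    0≤2d : 0ℚ ≤ 2ℚ * d
    0≤2d = *-nn 0≤2 0≤d
    ∣nn∣ : ∀ {p q} → 0ℚ ≤ p → p ≤ q → ∣ p ∣ ≤ q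
    ∣nn∣ 0≤p p≤q = ≤-trans (≤-reflexive (0≤p⇒∣p∣≡p 0≤p)) p≤q
    a₁≤ : ∣ a₁ ∣ ≤ 4ℚ * d * 1ℚ * (2ℚ * d)
    a₁≤ = ∣*∣≤ (*-nn 0≤4d (*-nn 0≤t (0≤f t))) (*-monoˡ 0≤4d (tf≤1 t)) ∣g-f∣≤
    a₂≤ : ∣ a₂ ∣ ≤ 2ℚ * d * d * 1ℚ
    a₂≤ = ∣*∣≤ (*-nn 0≤2d 0≤d) ≤-refl (∣nn∣ (*-nn (0≤f t) (0≤f (t + d))) (*-mono (0≤f (t + d)) (0≤f t) (f≤1 t) (f≤1 (t + d))))
    b₁≤ : ∣ b₁ ∣ ≤ 2ℚ * d * d * 1ℚ
    b₁≤ = ∣*∣≤ (*-nn 0≤2d 0≤d) ≤-refl (∣nn∣ (*-nn (*-nn 0≤t (0≤f t)) (0≤f (t + d))) (*-mono (0≤f (t + d)) (*-nn 0≤t (0≤f t)) (tf≤1 t) (f≤1 (t + d))))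
    b₂≤ : ∣ b₂ ∣ ≤ 2ℚ * d * (2ℚ * d)
    b₂≤ = ∣*∣≤ 0≤2d ≤-refl ∣g-f∣≤
    b₃≤ : ∣ b₃ ∣ ≤ 4ℚ * d * 1ℚ * (2ℚ * d)
    b₃≤ = ∣*∣≤ (*-nn 0≤4d (0≤f t)) (*-monoˡ 0≤4d (f≤1 t)) ∣f-g∣≤
    e : ∀ d → (1ℚ + 1ℚ) * (1ℚ + 1ℚ) * d * 1ℚ * ((1ℚ + 1ℚ) * d) + (1ℚ + 1ℚ) * d * d * 1ℚ +
      ((1ℚ + 1ℚ) * d * d * 1ℚ + (1ℚ + 1ℚ) * d * ((1ℚ + 1ℚ) * d) + (1ℚ + 1ℚ) * (1ℚ + 1ℚ) * d * 1ℚ * ((1ℚ + 1ℚ) * d)) ≡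
      (1ℚ + 1ℚ) * (1ℚ + 1ℚ) * ((1ℚ + 1ℚ) * (1ℚ + 1ℚ) + (1ℚ + 1ℚ)) * (d * d)
    e = solve-∀ ℚ-ring

dist-*ˡ : ∀ z u v → dist (z *ⁱ u) (z *ⁱ v) ≤ N1 z * dist u v
dist-*ˡ z u v = ≤-trans (≤-reflexive (cong N1 eq)) (N1-* z (u -ⁱ v))
  where
  e₁ : ∀ a b c d p q → (a * c - b * d) - (a * p - b * q) ≡ a * (c - p) - b * (d - q)
  e₁ = solve-∀ ℚ-ring
  e₂ : ∀ a b c d p q → (a * d + b * c) - (a * q + b * p) ≡ a * (d - q) + b * (c - p)
  e₂ = solve-∀ ℚ-ring
  eq : z *ⁱ u -ⁱ z *ⁱ v ≡ z *ⁱ (u -ⁱ v)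
  eq = cong₂ _+i_ (e₁ (re z) (im z) (re u) (im u) (re v) (im v)) (e₂ (re z) (im z) (re u) (im u) (re v) (im v))

dist-*ʳ : ∀ u v z → dist (u *ⁱ z) (v *ⁱ z) ≤ dist u v * N1 z
dist-*ʳ u v z = subst₂ _≤_ (cong₂ dist (ℚ[i].*-comm z u) (ℚ[i].*-comm z v)) (*-comm (N1 z) (dist u v)) (dist-*ˡ z u v)

-- The summands of `πSeq k`, halved, are the angles `x j` of the Euler steps for `U` on the grid of
-- width h k. So `A j`, the approximate exponential of i times their partial sum `Y j`, stays close
-- to `U (t j)`.
module QuarterTurn (k : ℕ) (2≤k : 2 ℕ.≤ k) (C : ℚ) (0≤C : 0ℚ ≤ C) (bd : (1ℚ + 2ℚ * h k) ^ (2^ k) ≤ C) where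
  open ≤-Reasoning

  private
    d = h k
    0≤d = 0≤h k
    n = 2^ k

    t g x Y : ℕ → ℚ
    t j = ι j * d
    g j = d * (4ℚ * 1/1+sq (t j))
    x j = 2ℚ * d * 1/1+sq (t j)
    Y j = ½ * ∑ℚ j g

    0≤t : ∀ j → 0ℚ ≤ t j
    0≤t j = *-nn (0≤ι j) 0≤d

    0≤2d : 0ℚ ≤ 2ℚ * d
    0≤2d = *-nn 0≤2 0≤d

    2d≤½ : 2ℚ * d ≤ ½
    2d≤½ = *-monoˡ {2ℚ} 0≤2 (h-anti 2≤k)

    0≤x : ∀ j → 0ℚ ≤ x j
    0≤x j = *-nn 0≤2d (0≤f (t j))

    x≤2d : ∀ j → x j ≤ 2ℚ * d
    x≤2d j = subst (x j ≤_) (*-identityʳ (2ℚ * d)) (*-monoˡ 0≤2d (f≤1 (t j)))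

    Y-suc : ∀ j → Y (suc j) ≡ Y j + x j
    Y-suc j = e (∑ℚ j g) d (1/1+sq (t j))
      where
      e : ∀ s d f → ½ * (s + d * ((1ℚ + 1ℚ) * (1ℚ + 1ℚ) * f)) ≡ ½ * s + (1ℚ + 1ℚ) * d * f
      e = solve-∀ ℚ-ring

    0≤Y : ∀ j → 0ℚ ≤ Y j
    0≤Y zero = ≤-refl
    0≤Y (suc j) = subst (0ℚ ≤_) (sym (Y-suc j)) (+-nn (0≤Y j) (0≤x j))

    Y≤ : ∀ j → Y j ≤ ι j * (2ℚ * d)
    Y≤ zero = ≤-reflexive (sym (*-zeroˡ (2ℚ * d)))
    Y≤ (suc j) = begin
      Y (suc j)                      ≡⟨ Y-suc j ⟩
      Y j + x j                      ≤⟨ +-mono-≤ (Y≤ j) (x≤2d j) ⟩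
      ι j * (2ℚ * d) + 2ℚ * d        ≡⟨ e (ι j) (2ℚ * d) ⟩
      ι (suc j) * (2ℚ * d)           ∎
      where
      e : ∀ i d → i * d + d ≡ (1ℚ + i) * d
      e = solve-∀ ℚ-ring

    Y≤2 : ∀ j → j ℕ.≤ n → Y j ≤ 2ℚ
    Y≤2 j j≤n = begin
      Y j               ≤⟨ Y≤ j ⟩
      ι j * (2ℚ * d)    ≡⟨ e (ι j) 2ℚ d ⟩
      2ℚ * (ι j * d)    ≤⟨ *-monoˡ {2ℚ} 0≤2 (ι*h≤1 k j≤n) ⟩
      2ℚ                ∎
      where
      e : ∀ i a d → i * (a * d) ≡ a * (i * d)
      e = solve-∀ ℚ-ring

    i*_ : ℚ → ℚ[i]
    i* y = 0ℚ +i y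

    N1-i* : ∀ {y} → 0ℚ ≤ y → N1 (i* y) ≡ y
    N1-i* {y} 0≤y = trans (+-identityˡ ∣ y ∣) (0≤p⇒∣p∣≡p 0≤y)

    A : ℕ → ℚ[i]
    A j = E k (i* Y j)

    A≤C : ∀ j → j ℕ.≤ n → N1 (A j) ≤ C
    A≤C j j≤n = ≤-trans (N1-^ (lin k (i* Y j)) (1ℚ + 2ℚ * d) n
      (N1-lin k (i* Y j) 2ℚ (≤-trans (≤-reflexive (N1-i* (0≤Y j))) (Y≤2 j j≤n)))) bd

    -- The local errors in units of d²: 4C² from the functional equation `E-+`, 16C from linearising
    -- exp (i x), and 24 from `U-step`.
    κ = 4ℚ * (C * C) + 16ℚ * C + 24ℚ

    0≤κ : 0ℚ ≤ κ
    0≤κ = +-nn (+-nn (*-nn {4ℚ} (nonNegative⁻¹ 4ℚ) (*-nn 0≤C 0≤C)) (*-nn {16ℚ} 0≤16 0≤C)) (nonNegative⁻¹ 24ℚ)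

    step : ∀ j → suc j ℕ.≤ n → dist (A (suc j)) (U (t (suc j))) ≤ κ * (d * d) + dist (A j) (U (t j)) * (1ℚ + 2ℚ * d)
    step j j<n = begin
      dist (A (suc j)) (U (t (suc j)))
        ≡⟨ cong₂ dist (cong (E k) iY-suc) (cong U t-suc) ⟩
      dist (E k (i* Y j +ⁱ i* x j)) (U (t j + d))
        ≤⟨ dist-tri (E k (i* Y j +ⁱ i* x j)) (A j *ⁱ E k (i* x j)) (U (t j + d)) ⟩
      dist (E k (i* Y j +ⁱ i* x j)) (A j *ⁱ E k (i* x j)) + dist (A j *ⁱ E k (i* x j)) (U (t j + d))
        ≤⟨ +-mono-≤ first (≤-trans (dist-tri (A j *ⁱ E k (i* x j)) (A j *ⁱ 1+ix) (U (t j + d)))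
             (+-mono-≤ second (≤-trans (dist-tri (A j *ⁱ 1+ix) (U (t j) *ⁱ 1+ix) (U (t j + d))) (+-mono-≤ third (U-step (t j) d (0≤t j) 0≤d))))) ⟩
      C * C * (2ℚ * (2ℚ * d)) * d + (C * (4ℚ * (2ℚ * d * (2ℚ * d))) + (dist (A j) (U (t j)) * (1ℚ + 2ℚ * d) + 24ℚ * (d * d)))
        ≡⟨ e C d (dist (A j) (U (t j)) * (1ℚ + 2ℚ * d)) 24ℚ ⟩
      κ * (d * d) + dist (A j) (U (t j)) * (1ℚ + 2ℚ * d) ∎
      where
      j≤n = ℕ.<⇒≤ j<n
      1+ix = 1ℚ +i x j
      iY-suc : i* Y (suc j) ≡ i* Y j +ⁱ i* x j
      iY-suc = cong₂ _+i_ refl (Y-suc j)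
      t-suc : t (suc j) ≡ t j + d
      t-suc = e′ (ι j) d
        where
        e′ : ∀ i d → (1ℚ + i) * d ≡ i * d + d
        e′ = solve-∀ ℚ-ring
      x≤2 : x j ≤ 2ℚ
      x≤2 = ≤-trans (x≤2d j) (≤-trans 2d≤½ (≤-trans (p≤p+ε ½ 0≤½) (p≤p+ε 1ℚ 0≤1)))
      first : dist (E k (i* Y j +ⁱ i* x j)) (A j *ⁱ E k (i* x j)) ≤ C * C * (2ℚ * (2ℚ * d)) * d
      first = ≤-trans
        (E-+ k (i* Y j) (i* x j) 2ℚ C 0≤2 (≤-trans (≤-reflexive (N1-i* (0≤Y j))) (Y≤2 j j≤n)) (≤-trans (≤-reflexive (N1-i* (0≤x j))) x≤2) 0≤C bd)
        (*-monoʳ 0≤d (*-monoˡ (*-nn 0≤C 0≤C) (*-mono (0≤N1 (i* x j)) (0≤N1 (i* Y j))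
          (≤-trans (≤-reflexive (N1-i* (0≤Y j))) (Y≤2 j j≤n)) (≤-trans (≤-reflexive (N1-i* (0≤x j))) (x≤2d j)))))
      1+ix≡ : 1ⁱ +ⁱ i* x j ≡ 1+ix
      1+ix≡ = cong₂ _+i_ (+-identityʳ 1ℚ) (+-identityˡ (x j))
      second : dist (A j *ⁱ E k (i* x j)) (A j *ⁱ 1+ix) ≤ C * (4ℚ * (2ℚ * d * (2ℚ * d)))
      second = ≤-trans (dist-*ˡ (A j) (E k (i* x j)) 1+ix) (*-mono (0≤N1 (E k (i* x j) -ⁱ 1+ix)) (0≤N1 (A j)) (A≤C j j≤n)
        (subst (λ z → dist (E k (i* x j)) z ≤ 4ℚ * (2ℚ * d * (2ℚ * d))) 1+ix≡
          (E-linear k (i* x j) (2ℚ * d) 0≤2d 2d≤½ (≤-trans (≤-reflexive (N1-i* (0≤x j))) (x≤2d j)))))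
      third : dist (A j *ⁱ 1+ix) (U (t j) *ⁱ 1+ix) ≤ dist (A j) (U (t j)) * (1ℚ + 2ℚ * d)
      third = ≤-trans (dist-*ʳ (A j) (U (t j)) 1+ix) (*-monoˡ (0≤N1 (A j -ⁱ U (t j)))
        (+-monoʳ-≤ 1ℚ (≤-trans (≤-reflexive (0≤p⇒∣p∣≡p (0≤x j))) (x≤2d j))))
      e : ∀ C d D T → C * C * ((1ℚ + 1ℚ) * ((1ℚ + 1ℚ) * d)) * d + (C * ((1ℚ + 1ℚ) * (1ℚ + 1ℚ) * ((1ℚ + 1ℚ) * d * ((1ℚ + 1ℚ) * d))) + (D + T * (d * d))) ≡
        ((1ℚ + 1ℚ) * (1ℚ + 1ℚ) * (C * C) + (1ℚ + 1ℚ) * (1ℚ + 1ℚ) * ((1ℚ + 1ℚ) * (1ℚ + 1ℚ)) * C + T) * (d * d) + D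
      e = solve-∀ ℚ-ring

    -- A discrete Grönwall estimate: every step adds at most κ d² and enlarges the earlier error by
    -- the factor 1 + 2d.
    gronwall : ∀ j → j ℕ.≤ n → dist (A j) (U (t j)) ≤ ι j * (κ * (d * d)) * (1ℚ + 2ℚ * d) ^ j
    gronwall zero _ = ≤-trans (≤-reflexive (cong₂ dist A0 U0)) (≤-trans (dist-refl 1ⁱ) (≤-reflexive (sym zero-bound)))
      where
      A0 : A 0 ≡ 1ⁱ
      A0 = trans (cong (_^ⁱ n) lin0) (one n)
        where
        lin0 : lin k (i* Y 0) ≡ 1ⁱ
        lin0 = cong₂ _+i_ (trans (cong (1ℚ +_) (*-zeroʳ d)) (+-identityʳ 1ℚ)) (*-zeroʳ d)
        one : ∀ m → 1ⁱ ^ⁱ m ≡ 1ⁱ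
        one zero = refl
        one (suc m) = trans (ℚ[i].*-identityˡ (1ⁱ ^ⁱ m)) (one m)
      U0 : U (t 0) ≡ 1ⁱ
      U0 = cong U (*-zeroˡ d)
      zero-bound : 0ℚ * (κ * (d * d)) * 1ℚ ≡ 0ℚ
      zero-bound = trans (*-identityʳ _) (*-zeroˡ (κ * (d * d)))
    gronwall (suc j) j<n = begin
      dist (A (suc j)) (U (t (suc j)))                              ≤⟨ step j j<n ⟩
      S + dist (A j) (U (t j)) * q                                  ≤⟨ +-monoʳ-≤ S (*-monoʳ 0≤q (gronwall j (ℕ.<⇒≤ j<n))) ⟩
      S + ι j * S * q ^ j * q                                       ≤⟨ +-monoˡ-≤ (ι j * S * q ^ j * q) S≤ ⟩
      S * q ^ suc j + ι j * S * q ^ j * q                           ≡⟨ e S (ι j) q (q ^ j) ⟩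
      ι (suc j) * S * q ^ suc j                                     ∎
      where
      S = κ * (d * d)
      q = 1ℚ + 2ℚ * d
      1≤q : 1ℚ ≤ q
      1≤q = p≤p+ε 1ℚ 0≤2d
      0≤q : 0ℚ ≤ q
      0≤q = ≤-trans 0≤1 1≤q
      S≤ : S ≤ S * q ^ suc j
      S≤ = subst (_≤ S * q ^ suc j) (*-identityʳ S) (*-monoˡ (*-nn 0≤κ (*-nn 0≤d 0≤d)) (1≤^ (suc j) 1≤q))
      e : ∀ S i q p → S * (q * p) + i * S * p * q ≡ (1ℚ + i) * S * (q * p)
      e = solve-∀ ℚ-ring

  quarter-turn : dist (E k (0ℚ +i (½ * πSeq k))) (0ℚ +i 1ℚ) ≤ κ * C * h k
  quarter-turn = begin
    -- The last node is t = 1, where `U` equals i, and `Y n` is half of `πSeq k`.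
    dist (A n) (0ℚ +i 1ℚ)                        ≡⟨ cong (λ t → dist (A n) (U t)) (2^*h k) ⟨
    dist (A n) (U (t n))                         ≤⟨ gronwall n ℕ.≤-refl ⟩
    ι n * (κ * (d * d)) * (1ℚ + 2ℚ * d) ^ n      ≤⟨ *-monoˡ (*-nn (0≤ι n) (*-nn 0≤κ (*-nn 0≤d 0≤d))) bd ⟩
    ι n * (κ * (d * d)) * C                      ≡⟨ e (ι n) κ d C ⟩
    (ι n * d) * (κ * C * d)                      ≡⟨ cong (_* (κ * C * d)) (2^*h k) ⟩
    1ℚ * (κ * C * d)                             ≡⟨ *-identityˡ _ ⟩
    κ * C * d                                    ∎
    where
    e : ∀ n κ d C → n * (κ * (d * d)) * C ≡ (n * d) * (κ * C * d)
    e = solve-∀ ℚ-ring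

iᶜ : ℂ
iᶜ = 0ᴿ +i 1ᴿ

module _ (τ : ℂ) where

  Φ-¼ : Φ τ 0ℚ (½ * ½) ≈ iᶜ
  Φ-¼ =
    let C , 0≤C , ev = exp-bound′ 2ℚ 0≤2
        0≤K = *-nn (+-nn (+-nn (*-nn {4ℚ} (nonNegative⁻¹ 4ℚ) (*-nn 0≤C 0≤C)) (*-nn {16ℚ} 0≤16 0≤C)) (nonNegative⁻¹ 24ℚ)) 0≤C
    in mk≈ λ ε 0<ε → eventually-map₂
      (λ k (2≤k , bd) Kh≤ε → subst (λ z → dist z (0ℚ +i 1ℚ) ≤ ε) (sym (eq k)) (≤-trans (QuarterTurn.quarter-turn k 2≤k C 0≤C bd) Kh≤ε))
      (eventually-map₂ (λ k → _,_) (2 , λ k 2≤k → 2≤k) ev)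
      (eventually-Kh≤ε _ ε 0≤K 0<ε)
    where
    eq : ∀ k → approx (Φ τ 0ℚ (½ * ½)) k ≡ E k (0ℚ +i (½ * πSeq k))
    eq k = trans (approx-Φ τ 0ℚ (½ * ½) k) (cong (E k) (cong₂ _+i_
      (trans (Φ-exponent-re τ 0ℚ (½ * ½) k) (e₁ (πSeq k) (seq (im τ) k)))
      (trans (Φ-exponent-im τ 0ℚ (½ * ½) k) (e₂ (πSeq k) (seq (re τ) k)))))
      where
      e₁ : ∀ π y → - ((1ℚ + 1ℚ) * π * (0ℚ * y)) ≡ 0ℚ
      e₁ = solve-∀ ℚ-ring
      e₂ : ∀ π x → (1ℚ + 1ℚ) * π * (0ℚ * x + ½ * ½) ≡ ½ * π
      e₂ = solve-∀ ℚ-ring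

opaque
  unfolding _*ᶜ_ -ᶜ_

  i*i≈-1 : iᶜ *ᶜ iᶜ ≈ -ᶜ 1ℂ
  i*i≈-1 = approx-≡ λ k → refl

module ℂ = CommutativeRing ℂ-commutativeRing
module ℂ-Properties = Algebra.Properties.Ring ℂ.ring
module ≈-Reasoning = Relation.Binary.Reasoning.Setoid ℂ.setoid

-- Integers in ℚ and the points (2l + 1)/10

/1-homo-+ : ∀ m n → (m ℤ.+ n) / 1 ≡ m / 1 + n / 1
/1-homo-+ m n = toℚᵘ-injective (begin
  toℚᵘ ((m ℤ.+ n) / 1)               ≈⟨ toℚᵘ-fromℚᵘ (ℚᵘ.mkℚᵘ (m ℤ.+ n) 0) ⟩
  ℚᵘ.mkℚᵘ (m ℤ.+ n) 0                ≈⟨ ℚᵘ.*≡* (cong (ℤ._* ℤ.1ℤ) (sym (cong₂ ℤ._+_ (ℤ.*-identityʳ m) (ℤ.*-identityʳ n)))) ⟩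
  ℚᵘ.mkℚᵘ m 0 ℚᵘ.+ ℚᵘ.mkℚᵘ n 0       ≈⟨ ℚᵘ.+-cong (toℚᵘ-fromℚᵘ (ℚᵘ.mkℚᵘ m 0)) (toℚᵘ-fromℚᵘ (ℚᵘ.mkℚᵘ n 0)) ⟨
  toℚᵘ (m / 1) ℚᵘ.+ toℚᵘ (n / 1)     ≈⟨ toℚᵘ-homo-+ (m / 1) (n / 1) ⟨
  toℚᵘ (m / 1 + n / 1)               ∎)
  where open Relation.Binary.Reasoning.Setoid ℚᵘ.≃-setoid

/1-homo-* : ∀ m n → (m ℤ.* n) / 1 ≡ m / 1 * (n / 1)
/1-homo-* m n = toℚᵘ-injective (begin
  toℚᵘ ((m ℤ.* n) / 1)               ≈⟨ toℚᵘ-fromℚᵘ (ℚᵘ.mkℚᵘ (m ℤ.* n) 0) ⟩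
  ℚᵘ.mkℚᵘ m 0 ℚᵘ.* ℚᵘ.mkℚᵘ n 0       ≈⟨ ℚᵘ.*-cong (toℚᵘ-fromℚᵘ (ℚᵘ.mkℚᵘ m 0)) (toℚᵘ-fromℚᵘ (ℚᵘ.mkℚᵘ n 0)) ⟨
  toℚᵘ (m / 1) ℚᵘ.* toℚᵘ (n / 1)     ≈⟨ toℚᵘ-homo-* (m / 1) (n / 1) ⟨
  toℚᵘ (m / 1 * (n / 1))             ∎)
  where open Relation.Binary.Reasoning.Setoid ℚᵘ.≃-setoid

/1-homo-neg : ∀ n → (ℤ.- n) / 1 ≡ - (n / 1)
/1-homo-neg (ℤ.+ zero)  = refl
/1-homo-neg (ℤ.+ suc n) = refl
/1-homo-neg -[1+ n ]    = sym (⁻¹-involutive (ℤ.+ suc n / 1))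
  where open import Algebra.Properties.AbelianGroup +-0-abelianGroup using (⁻¹-involutive)

ι-* : ∀ m n → ι (m ℕ.* n) ≡ ι m * ι n
ι-* zero    n = sym (*-zeroˡ (ι n))
ι-* (suc m) n = trans (ι-+ n (m ℕ.* n)) (trans (cong (ι n +_) (ι-* m n)) (e (ι m) (ι n)))
  where
  e : ∀ m n → n + m * n ≡ (1ℚ + m) * n
  e = solve-∀ ℚ-ring

⅕ : ℚ
⅕ = ℤ.+ 1 / 5

5ℚ : ℚ
5ℚ = ℤ.+ 5 / 1

-- An enumeration of 1/10 + ℤ/5 under which `rev` becomes negation; hence the absolute value of
-- `σ l` depends on the level of `l` only.
σ : ℤ → ℚ
σ l = (l / 1 + ½) * ⅕

σ-+ : ∀ l d → σ (l ℤ.+ d ℤ.* ℤ.+ 5) ≡ σ l + d / 1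
σ-+ l d = begin
  ((l ℤ.+ d ℤ.* ℤ.+ 5) / 1 + ½) * ⅕      ≡⟨ cong (λ x → (x + ½) * ⅕) (trans (/1-homo-+ l (d ℤ.* ℤ.+ 5)) (cong (l / 1 +_) (/1-homo-* d (ℤ.+ 5)))) ⟩
  (l / 1 + d / 1 * 5ℚ + ½) * ⅕           ≡⟨ e (l / 1) (d / 1) ⟩
  σ l + d / 1                            ∎
  where
  open ≡-Reasoning
  e : ∀ l d → (l + d * 5ℚ + ½) * ⅕ ≡ (l + ½) * ⅕ + d
  e = solve-∀ ℚ-ring

σ-at : ∀ k n → σ (at k n) ≡ n / 1 + σ (ℤ.+ k)
σ-at k n = trans (cong σ (ℤ.+-comm (n ℤ.* ℤ.+ 5) (ℤ.+ k))) (trans (σ-+ (ℤ.+ k) n) (+-comm (σ (ℤ.+ k)) (n / 1)))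

σ-level : ∀ l → σ l * σ l ≡ ((ι (level l) + ½) * ⅕) * ((ι (level l) + ½) * ⅕)
σ-level (ℤ.+ n)  = cong (λ x → ((x + ½) * ⅕) * ((x + ½) * ⅕)) (n/1≡ι n)
σ-level -[1+ n ] = trans (cong (λ x → ((- x + ½) * ⅕) * ((- x + ½) * ⅕)) (n/1≡ι (suc n))) (e (ι n))
  where
  e : ∀ x → ((- (1ℚ + x) + ½) * ⅕) * ((- (1ℚ + x) + ½) * ⅕) ≡ ((x + ½) * ⅕) * ((x + ½) * ⅕)
  e = solve-∀ ℚ-ring

σ-large : ∀ N l → N ℕ.* 5 ℕ.≤ level l → ι N * ι N ≤ σ l * σ l
σ-large N l le = subst (ι N * ι N ≤_) (sym (σ-level l)) (*-mono (0≤ι N) (0≤ι N) ιN≤ ιN≤)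
  where
  open ≤-Reasoning
  ιN≤ : ι N ≤ (ι (level l) + ½) * ⅕
  ιN≤ = begin
    ι N                       ≡⟨ e (ι N) ⟩
    ι N * 5ℚ * ⅕              ≡⟨ cong (_* ⅕) (ι-* N 5) ⟨
    ι (N ℕ.* 5) * ⅕           ≤⟨ *-monoʳ {⅕} (nonNegative⁻¹ ⅕) (≤-trans (ι-mono le) (p≤p+ε (ι (level l)) 0≤½)) ⟩
    (ι (level l) + ½) * ⅕     ∎
    where
    e : ∀ n → n ≡ n * 5ℚ * ⅕
    e = solve-∀ ℚ-ring

σ-rev : ∀ a l → σ (a ℤ.+ rev l) ≡ a / 1 * ⅕ - σ l
σ-rev a l = begin
  σ (a ℤ.+ rev l)                          ≡⟨ cong (λ x → (x + ½) * ⅕) (trans (/1-homo-+ a (rev l))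
                                                (cong (a / 1 +_) (trans (cong (_/ 1) (rev≡ l)) (trans (/1-homo-+ -[1+ 0 ] (ℤ.- l)) (cong (- 1ℚ +_) (/1-homo-neg l)))))) ⟩
  (a / 1 + (- 1ℚ + - (l / 1)) + ½) * ⅕     ≡⟨ e (a / 1) (l / 1) ⟩
  a / 1 * ⅕ - σ l                          ∎
  where
  open ≡-Reasoning
  e : ∀ a l → (a + (- 1ℚ + - l) + ½) * ⅕ ≡ a * ⅕ - (l + ½) * ⅕
  e = solve-∀ ℚ-ring

-- Roots of unity

-- Periods and antiperiods in the second argument of `Φ` stand for the roots of unity 1 and -1. All
-- of them are generated by ½, which comes from i * i = -1.
module Periods (τ : ℂ) where

  Period Antiperiod : ℚ → Set
  Period x = ∀ p r → Φ τ p (r + x) ≈ Φ τ p r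
  Antiperiod x = ∀ p r → Φ τ p (r + x) ≈ -ᶜ Φ τ p r

  Φ-½ : Φ τ 0ℚ ½ ≈ -ᶜ 1ℂ
  Φ-½ = ℂ.trans (Φ-+ τ 0ℚ (½ * ½) 0ℚ (½ * ½)) (ℂ.trans (ℂ.*-cong (Φ-¼ τ) (Φ-¼ τ)) i*i≈-1)

  antiperiod-½ : Antiperiod ½
  antiperiod-½ p r = begin
    Φ τ p (r + ½)              ≡⟨ cong (λ p → Φ τ p (r + ½)) (+-identityʳ p) ⟨
    Φ τ (p + 0ℚ) (r + ½)       ≈⟨ Φ-+ τ p r 0ℚ ½ ⟩
    Φ τ p r *ᶜ Φ τ 0ℚ ½        ≈⟨ ℂ.*-congˡ Φ-½ ⟩
    Φ τ p r *ᶜ (-ᶜ 1ℂ)         ≈⟨ ℂ-Properties.-‿distribʳ-* (Φ τ p r) 1ℂ ⟨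
    -ᶜ (Φ τ p r *ᶜ 1ℂ)         ≈⟨ ℂ.-‿cong (ℂ.*-identityʳ (Φ τ p r)) ⟩
    -ᶜ Φ τ p r                 ∎
    where open ≈-Reasoning

  period-+ : ∀ {x y} → Period x → Period y → Period (x + y)
  period-+ {x} {y} per-x per-y p r = ℂ.trans (ℂ.reflexive (cong (Φ τ p) (sym (+-assoc r x y)))) (ℂ.trans (per-y p (r + x)) (per-x p r))

  antiperiod+period : ∀ {x y} → Antiperiod x → Period y → Antiperiod (x + y)
  antiperiod+period {x} {y} anti-x per-y p r = ℂ.trans (ℂ.reflexive (cong (Φ τ p) (sym (+-assoc r x y)))) (ℂ.trans (per-y p (r + x)) (anti-x p r))

  antiperiod+antiperiod : ∀ {x y} → Antiperiod x → Antiperiod y → Period (x + y)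
  antiperiod+antiperiod {x} {y} anti-x anti-y p r = begin
    Φ τ p (r + (x + y))     ≡⟨ cong (Φ τ p) (+-assoc r x y) ⟨
    Φ τ p (r + x + y)       ≈⟨ anti-y p (r + x) ⟩
    -ᶜ Φ τ p (r + x)        ≈⟨ ℂ.-‿cong (anti-x p r) ⟩
    -ᶜ (-ᶜ Φ τ p r)         ≈⟨ ℂ-Properties.-‿involutive (Φ τ p r) ⟩
    Φ τ p r                 ∎
    where open ≈-Reasoning

  cancel : ∀ r x → r - x + x ≡ r
  cancel = solve-∀ ℚ-ring

  period-neg : ∀ {x} → Period x → Period (- x)
  period-neg {x} per-x p r = ℂ.trans (ℂ.sym (per-x p (r - x))) (ℂ.reflexive (cong (Φ τ p) (cancel r x)))

  antiperiod-neg : ∀ {x} → Antiperiod x → Antiperiod (- x)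
  antiperiod-neg {x} anti-x p r = begin
    Φ τ p (r - x)              ≈⟨ ℂ-Properties.-‿involutive _ ⟨
    -ᶜ (-ᶜ Φ τ p (r - x))      ≈⟨ ℂ.-‿cong (anti-x p (r - x)) ⟨
    -ᶜ Φ τ p (r - x + x)       ≡⟨ cong (λ r → -ᶜ Φ τ p r) (cancel r x) ⟩
    -ᶜ Φ τ p r                 ∎
    where open ≈-Reasoning

  period-ι : ∀ n → Period (ι n)
  period-ι zero    p r = ℂ.reflexive (cong (Φ τ p) (+-identityʳ r))
  period-ι (suc n) = period-+ (antiperiod+antiperiod antiperiod-½ antiperiod-½) (period-ι n)

  period-ℤ : ∀ n → Period (n / 1)
  period-ℤ (ℤ.+ n)  = subst Period (sym (n/1≡ι n)) (period-ι n)
  period-ℤ -[1+ n ] = period-neg (period-ℤ (ℤ.+ suc n))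

open IntegerSums ℂ-commutativeRing

-- Bounds for window sums, and windows in residue classes modulo 5

𝕊-≼ : ∀ N {f β} → (∀ n → level n ℕ.< N → f n ≼ β) → 𝕊 N f ≼ (ι N * (β + β))
𝕊-≼ zero    {f} {β} f≼β = subst (0ℂ ≼_) (sym (*-zeroˡ (β + β))) 0≼0
𝕊-≼ (suc N) {f} {β} f≼β = subst (𝕊 (suc N) f ≼_) (e (ι N) (β + β))
  (≼-+ (𝕊-≼ N λ n n<N → f≼β n (ℕ.m<n⇒m<1+n n<N)) (≼-+ (f≼β (ℤ.+ N) ℕ.≤-refl) (f≼β -[1+ N ] ℕ.≤-refl)))
  where
  e : ∀ n β → n * β + β ≡ (1ℚ + n) * β
  e = solve-∀ ℚ-ring

-- This is (2M)^m β, a window of M levels containing 2M integers.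
count : ℕ → ℕ → ℚ → ℚ
count zero    M β = β
count (suc m) M β = ι M * (count m M β + count m M β)

𝕊ⁿ-≼ : ∀ m M {F β} → (∀ v → All (λ a → level a ℕ.< M) v → F v ≼ β) → 𝕊ⁿ m M F ≼ count m M β
𝕊ⁿ-≼ zero    M F≼β = F≼β [] []
𝕊ⁿ-≼ (suc m) M F≼β = 𝕊-≼ M λ a a<M → 𝕊ⁿ-≼ m M λ v v<M → F≼β (a ∷ v) (a<M ∷ v<M)

-- For negative n the remainder is counted from the other end, j = 4 - k. In both cases N levels of
-- n correspond exactly to 5N levels of 5n + k.
level-at : ∀ k n → k ℕ.< 5 → ∃ λ j → j ℕ.< 5 × level (at k n) ≡ j ℕ.+ level n ℕ.* 5
level-at k (ℤ.+ n) k<5 = k , k<5 , cong level (at-+ k n)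
level-at 0 -[1+ n ] _ = 4 , ℕ.≤-refl , refl
level-at 1 -[1+ n ] _ = 3 , ℕ.m≤m+n 4 1 , refl
level-at 2 -[1+ n ] _ = 2 , ℕ.m≤m+n 3 2 , refl
level-at 3 -[1+ n ] _ = 1 , ℕ.m≤m+n 2 3 , refl
level-at 4 -[1+ n ] _ = 0 , ℕ.m≤m+n 1 4 , refl
level-at (suc (suc (suc (suc (suc _))))) -[1+ n ] (ℕ.s≤s (ℕ.s≤s (ℕ.s≤s (ℕ.s≤s (ℕ.s≤s ())))))

level-at-< : ∀ k n {N} → k ℕ.< 5 → level n ℕ.< N → level (at k n) ℕ.< N ℕ.* 5
level-at-< k n k<5 n<N with level-at k n k<5
... | j , j<5 , eq rewrite eq = ℕ.<-≤-trans (ℕ.+-monoˡ-< (level n ℕ.* 5) j<5) (ℕ.*-monoˡ-≤ 5 n<N)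

level-at-≥ : ∀ k n {N} → k ℕ.< 5 → N ℕ.≤ level n → N ℕ.* 5 ℕ.≤ level (at k n)
level-at-≥ k n k<5 N≤n with level-at k n k<5
... | j , j<5 , eq rewrite eq = ℕ.≤-trans (ℕ.*-monoˡ-≤ 5 N≤n) (ℕ.m≤n+m (level n ℕ.* 5) j)

at-shift : ∀ k n d → at k (n ℤ.+ d) ≡ at k n ℤ.+ d ℤ.* ℤ.+ 5
at-shift k n d = e (ℤ.+ k) n d (ℤ.+ 5)
  where
  e : ∀ k n d f → (n ℤ.+ d) ℤ.* f ℤ.+ k ≡ n ℤ.* f ℤ.+ k ℤ.+ d ℤ.* f
  e = ℤ-Solver.solve-∀

-- Cancellation in the truncated fivefold sum

-- `J-odd` expresses oddness of J through its effect: an odd multiple of an antiperiod is an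
-- antiperiod.
module Cancellation (T : ℂ) (J : ℚ) (J-odd : ∀ y → Periods.Antiperiod T y → Periods.Antiperiod T (J * y)) where

  open Periods T

  κ : ℚ
  κ = ½ * (J * ⅕)

  weight : ℤ → ℚ
  weight l = (1ℚ + 1ℚ) * J * σ l

  -- With l = 5n + k and σ l = n + (2k + 1)/10, G l is the n-th term of θ[(2k+1)/5; J/5],
  -- and w l is the coefficient ζ₅^((2k+1)J) of its fifth power.
  G w : ℤ → ℂ
  G l = Φ T (½ * (σ l * σ l)) (σ l * κ)
  w l = Φ T 0ℚ (weight l)

  Q : ∀ {m} → Vec ℤ m → ℚ
  Q []      = 0ℚ
  Q (x ∷ v) = ½ * (σ x * σ x) + Q v

  R : ∀ {m} → ℚ → Vec ℤ m → ℚ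
  R r₀ []      = r₀
  R r₀ (x ∷ v) = σ x * κ + R r₀ v

  prod-Φ : ∀ {m} r₀ (v : Vec ℤ m) → prod G (Φ T 0ℚ r₀) v ≈ Φ T (Q v) (R r₀ v)
  prod-Φ r₀ []      = ℂ.refl
  prod-Φ r₀ (x ∷ v) = ℂ.trans (ℂ.*-congˡ (prod-Φ r₀ v)) (ℂ.sym (Φ-+ T _ _ _ _))

  0≤Q : ∀ {m} (v : Vec ℤ m) → 0ℚ ≤ Q v
  0≤Q []      = ≤-refl
  0≤Q (x ∷ v) = +-nn (*-nn 0≤½ (sq-nn (σ x))) (0≤Q v)

  -- The entries of `v` are the differences of the coordinates `σ` from the first one. They are
  -- unchanged when all coordinates are moved by the same amount, as the reflection does.
  coords : ℤ → Vec ℤ 4 → Vec ℤ 5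
  coords l v = l ∷ Vec.map (λ d → l ℤ.+ d ℤ.* ℤ.+ 5) v

  offset : Vec ℤ 4 → ℤ
  offset (a ∷ b ∷ c ∷ e ∷ []) = a ℤ.+ (b ℤ.+ (c ℤ.+ e))

  -- With D = `offset v` the coordinates sum to 5 s₀ + D, so the reflection sends s₀ to s₀ - ⅖ (5 s₀
  -- + D) = -s₀ - ⅖ D. In terms of l this is l ↦ -2D + `rev l`.
  δ : Vec ℤ 4 → ℤ
  δ v = ℤ.- (offset v ℤ.+ offset v)

  private
    Qf : ℚ → ℚ → ℚ → ℚ → ℚ → ℚ
    Qf s a b c e = ½ * (s * s) + (½ * ((s + a) * (s + a)) + (½ * ((s + b) * (s + b)) + (½ * ((s + c) * (s + c)) + (½ * ((s + e) * (s + e)) + 0ℚ))))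

    Rf : ℚ → ℚ → ℚ → ℚ → ℚ → ℚ
    Rf s a b c e = s * κ + ((s + a) * κ + ((s + b) * κ + ((s + c) * κ + ((s + e) * κ + (1ℚ + 1ℚ) * J * s))))

    Q-coords : ∀ l a b c e → Q (coords l (a ∷ b ∷ c ∷ e ∷ [])) ≡ Qf (σ l) (a / 1) (b / 1) (c / 1) (e / 1)
    Q-coords l a b c e = cong (½ * (σ l * σ l) +_) (cong₂ _+_ (½sq a) (cong₂ _+_ (½sq b) (cong₂ _+_ (½sq c) (cong (_+ 0ℚ) (½sq e)))))
      where
      ½sq : ∀ d → ½ * (σ (l ℤ.+ d ℤ.* ℤ.+ 5) * σ (l ℤ.+ d ℤ.* ℤ.+ 5)) ≡ ½ * ((σ l + d / 1) * (σ l + d / 1))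
      ½sq d = cong (λ x → ½ * (x * x)) (σ-+ l d)

    R-coords : ∀ l a b c e → R (weight l) (coords l (a ∷ b ∷ c ∷ e ∷ [])) ≡ Rf (σ l) (a / 1) (b / 1) (c / 1) (e / 1)
    R-coords l a b c e = cong (σ l * κ +_) (cong₂ _+_ (lin-κ a) (cong₂ _+_ (lin-κ b) (cong₂ _+_ (lin-κ c) (cong (_+ weight l) (lin-κ e)))))
      where
      lin-κ : ∀ d → σ (l ℤ.+ d ℤ.* ℤ.+ 5) * κ ≡ (σ l + d / 1) * κ
      lin-κ d = cong (_* κ) (σ-+ l d)

    offset/1 : ∀ a b c e → offset (a ∷ b ∷ c ∷ e ∷ []) / 1 ≡ a / 1 + (b / 1 + (c / 1 + e / 1))
    offset/1 a b c e = trans (/1-homo-+ a _) (cong (a / 1 +_) (trans (/1-homo-+ b _) (cong (b / 1 +_) (/1-homo-+ c e))))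

    σ-mirror : ∀ l a b c e → σ (δ (a ∷ b ∷ c ∷ e ∷ []) ℤ.+ rev l) ≡
      - ((a / 1 + (b / 1 + (c / 1 + e / 1))) + (a / 1 + (b / 1 + (c / 1 + e / 1)))) * ⅕ - σ l
    σ-mirror l a b c e = trans (σ-rev (δ v) l) (cong (λ x → x * ⅕ - σ l)
      (trans (/1-homo-neg (offset v ℤ.+ offset v)) (cong -_ (trans (/1-homo-+ (offset v) (offset v)) (cong₂ _+_ (offset/1 a b c e) (offset/1 a b c e))))))
      where
      v : Vec ℤ 4
      v = a ∷ b ∷ c ∷ e ∷ []

  -- The reflection in the hyperplane where the coordinates σ sum to 0 preserves the quadratic form ...
  Q-mirror : ∀ l v → Q (coords (δ v ℤ.+ rev l) v) ≡ Q (coords l v)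
  Q-mirror l v@(a ∷ b ∷ c ∷ e ∷ []) = trans (Q-coords (δ v ℤ.+ rev l) a b c e)
    (trans (cong (λ s → Qf s (a / 1) (b / 1) (c / 1) (e / 1)) (σ-mirror l a b c e))
      (trans (eq (σ l) (a / 1) (b / 1) (c / 1) (e / 1)) (sym (Q-coords l a b c e))))
    where
    eq : ∀ s a b c e → let s′ = - ((a + (b + (c + e))) + (a + (b + (c + e)))) * ⅕ - s in
      ½ * (s′ * s′) + (½ * ((s′ + a) * (s′ + a)) + (½ * ((s′ + b) * (s′ + b)) + (½ * ((s′ + c) * (s′ + c)) + (½ * ((s′ + e) * (s′ + e)) + 0ℚ)))) ≡
      ½ * (s * s) + (½ * ((s + a) * (s + a)) + (½ * ((s + b) * (s + b)) + (½ * ((s + c) * (s + c)) + (½ * ((s + e) * (s + e)) + 0ℚ))))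
    eq = solve-∀ ℚ-ring

  -- ... and shifts the linear one by J times a half-integer, J odd.
  R-mirror : ∀ l v → R (weight (δ v ℤ.+ rev l)) (coords (δ v ℤ.+ rev l) v) ≡
    R (weight l) (coords l v) - J * (½ + (l ℤ.+ offset v) / 1)
  R-mirror l v@(a ∷ b ∷ c ∷ e ∷ []) = trans (R-coords (δ v ℤ.+ rev l) a b c e)
    (trans (cong (λ s → Rf s (a / 1) (b / 1) (c / 1) (e / 1)) (σ-mirror l a b c e))
      (trans (eq (l / 1) J (a / 1) (b / 1) (c / 1) (e / 1))
        (sym (cong₂ (λ x y → x - J * (½ + y)) (R-coords l a b c e) (trans (/1-homo-+ l (offset v)) (cong (l / 1 +_) (offset/1 a b c e)))))))
    where
    eq : ∀ l J a b c e → let s = (l + ½) * ⅕ ; D = a + (b + (c + e)) ; s′ = - (D + D) * ⅕ - s ; k = ½ * (J * ⅕) in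
      s′ * k + ((s′ + a) * k + ((s′ + b) * k + ((s′ + c) * k + ((s′ + e) * k + (1ℚ + 1ℚ) * J * s′)))) ≡
      s * k + ((s + a) * k + ((s + b) * k + ((s + c) * k + ((s + e) * k + (1ℚ + 1ℚ) * J * s)))) - J * (½ + (l + D))
    eq = solve-∀ ℚ-ring

  F : ℤ → Vec ℤ 4 → ℂ
  F l v = Φ T (Q (coords l v)) (R (weight l) (coords l v))

  F-mirror : ∀ l v → F (δ v ℤ.+ rev l) v ≈ -ᶜ F l v
  F-mirror l v = ℂ.trans (ℂ.reflexive (cong₂ (Φ T) (Q-mirror l v) (R-mirror l v)))
    (antiperiod-neg (J-odd _ (antiperiod+period antiperiod-½ (period-ℤ (l ℤ.+ offset v)))) _ _)

  -- J n is the difference of the antiperiods J (½ + n) and J ½, so the integrality of J is also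
  -- contained in `J-odd`.
  period-J : ∀ n → Period (J * (n / 1))
  period-J n = subst Period (e J (n / 1)) (antiperiod+antiperiod
    (J-odd _ (antiperiod+period antiperiod-½ (period-ℤ n))) (antiperiod-neg (J-odd ½ antiperiod-½)))
    where
    e : ∀ J n → J * (½ + n) - J * ½ ≡ J * n
    e = solve-∀ ℚ-ring

  -- The exponent changes by the period 2Jn. The coefficient of a residue class can therefore be
  -- written as a function of l, and it is reflected together with the vector.
  w-at : ∀ k n → w (at k n) ≈ w (ℤ.+ k)
  w-at k n = ℂ.trans (ℂ.reflexive (cong (Φ T 0ℚ) (trans (cong ((1ℚ + 1ℚ) * J *_) (σ-at k n)) (e J (n / 1) (σ (ℤ.+ k))))))
    (period-+ (period-J n) (period-J n) 0ℚ (weight (ℤ.+ k)))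
    where
    e : ∀ J n s → (1ℚ + 1ℚ) * J * (n + s) ≡ (1ℚ + 1ℚ) * J * s + (J * n + J * n)
    e = solve-∀ ℚ-ring

  module Truncation (N : ℕ) where

    private
      L = N ℕ.* 5

    Inside Outside : ℤ → Set
    Inside l  = level l ℕ.< L
    Outside l = L ℕ.≤ level l

    -- Cutting off the factors rather than the ranges of summation allows windows to be enlarged and
    -- shifted freely, and it treats the five coordinates alike.
    g : ℤ → ℂ
    g l with level l ℕ.<? L
    ... | yes _ = G l
    ... | no  _ = 0ℂ

    g-inside : ∀ {l} → Inside l → g l ≈ G l
    g-inside {l} l<L with level l ℕ.<? L
    ... | yes _  = ℂ.refl
    ... | no l≮L = contradiction l<L l≮L

    g-outside : Supported L g
    g-outside l L≤l with level l ℕ.<? L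
    ... | yes l<L = contradiction l<L (ℕ.≤⇒≯ L≤l)
    ... | no  _   = ℂ.refl

    inside? : ∀ {m} (v : Vec ℤ m) → All Inside v ⊎ Any Outside v
    inside? []      = inj₁ []
    inside? (x ∷ v) with ℕ.<-≤-connex (level x) L | inside? v
    ... | inj₂ out | _        = inj₂ (here out)
    ... | inj₁ _   | inj₂ out = inj₂ (there out)
    ... | inj₁ i   | inj₁ is  = inj₁ (i ∷ is)

    prod-inside : ∀ {m} c {v : Vec ℤ m} → All Inside v → prod g c v ≈ prod G c v
    prod-inside c []       = ℂ.refl
    prod-inside c (i ∷ is) = ℂ.*-cong (g-inside i) (prod-inside c is)

    prod-outside : ∀ {m} c {v : Vec ℤ m} → Any Outside v → prod g c v ≈ 0ℂ
    prod-outside c (here out)  = ℂ.trans (ℂ.*-congʳ (g-outside _ out)) (ℂ.zeroˡ _)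
    prod-outside c (there out) = ℂ.trans (ℂ.*-congˡ (prod-outside c out)) (ℂ.zeroʳ _)

    Q-outside : ∀ {m} {v : Vec ℤ m} → Any Outside v → ½ * (ι N * ι N) ≤ Q v
    Q-outside {v = x ∷ v} (here out)  = ≤-trans (*-monoˡ {½} 0≤½ (σ-large N x out)) (p≤p+ε _ (0≤Q v))
    Q-outside {v = x ∷ v} (there out) = ≤-trans (Q-outside out)
      (subst (Q v ≤_) (+-comm (Q v) (½ * (σ x * σ x))) (p≤p+ε (Q v) (*-nn 0≤½ (sq-nn (σ x)))))

    H : ℤ → Vec ℤ 4 → ℂ
    H l v = prod g (w l) (coords l v)

    H-inside : ∀ l v → All Inside (coords l v) → H l v ≈ F l v
    H-inside l v is = ℂ.trans (prod-inside (w l) is) (prod-Φ (weight l) (coords l v))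

    module _ (β : ℚ) (0≤β : 0ℚ ≤ β) (Φ≼β : ∀ p r → ½ * (ι N * ι N) ≤ p → Φ T p r ≼ β) where

      -- Two uncut terms cancel and two cut ones are both 0. If just one is cut, some coordinate of
      -- its vector lies outside the window, which forces Q ≥ ½ N²; the surviving term has the same
      -- Q by `Q-mirror` and is bounded by β.
      H-mirror : ∀ l v → (H l v +ᶜ H (δ v ℤ.+ rev l) v) ≼ β
      H-mirror l v with inside? (coords l v) | inside? (coords (δ v ℤ.+ rev l) v)
      ... | inj₁ is  | inj₁ is′  = ≼-mono 0≤β (≼-resp-≈
        (ℂ.trans (ℂ.+-cong (H-inside l v is) (ℂ.trans (H-inside (δ v ℤ.+ rev l) v is′) (F-mirror l v))) (ℂ.-‿inverseʳ (F l v))) 0≼0)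
      ... | inj₁ is  | inj₂ out′ = ≼-resp-≈
        (ℂ.trans (ℂ.+-cong (H-inside l v is) (prod-outside (w (δ v ℤ.+ rev l)) out′)) (ℂ.+-identityʳ (F l v)))
        (Φ≼β _ _ (subst (½ * (ι N * ι N) ≤_) (Q-mirror l v) (Q-outside out′)))
      ... | inj₂ out | inj₁ is′  = ≼-resp-≈
        (ℂ.trans (ℂ.+-cong (prod-outside (w l) out) (H-inside (δ v ℤ.+ rev l) v is′)) (ℂ.+-identityˡ _))
        (Φ≼β _ _ (subst (½ * (ι N * ι N) ≤_) (sym (Q-mirror l v)) (Q-outside out)))
      ... | inj₂ out | inj₂ out′ = ≼-mono 0≤β (≼-resp-≈
        (ℂ.trans (ℂ.+-cong (prod-outside (w l) out) (prod-outside (w (δ v ℤ.+ rev l)) out′)) (ℂ.+-identityʳ 0ℂ)) 0≼0)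

      H-supported : ∀ v → Supported L (λ l → H l v)
      H-supported v l L≤l = ℂ.trans (ℂ.*-congʳ (g-outside l L≤l)) (ℂ.zeroˡ _)

      -- 5N for the support of `H` in l and 16N for the shift: `offset v` consists of four summands
      -- of size at most 2N, and `δ v` is twice as large.
      X = N ℕ.* 21

      δ-bound : ∀ v → All (λ a → level a ℕ.< N ℕ.* 2) v → L ℕ.+ ℤ.∣ δ v ∣ ℕ.≤ X
      δ-bound v@(a ∷ b ∷ c ∷ e ∷ []) (a< ∷ b< ∷ c< ∷ e< ∷ []) = begin
        L ℕ.+ ℤ.∣ δ v ∣                                 ≡⟨ cong (L ℕ.+_) (ℤ.∣-i∣≡∣i∣ (offset v ℤ.+ offset v)) ⟩
        L ℕ.+ ℤ.∣ offset v ℤ.+ offset v ∣               ≤⟨ ℕ.+-monoʳ-≤ L (ℕ.≤-trans (ℤ.∣i+j∣≤∣i∣+∣j∣ (offset v) (offset v)) (ℕ.+-mono-≤ offset≤ offset≤)) ⟩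
        N ℕ.* 5 ℕ.+ (8N ℕ.+ 8N)                         ≡⟨ eq N ⟩
        X                                               ∎
        where
        open ℕ.≤-Reasoning
        2N = N ℕ.* 2
        8N = 2N ℕ.+ (2N ℕ.+ (2N ℕ.+ 2N))
        abs≤ : ∀ a → level a ℕ.< 2N → ℤ.∣ a ∣ ℕ.≤ 2N
        abs≤ (ℤ.+ n)  n<  = ℕ.<⇒≤ n<
        abs≤ -[1+ n ] n<  = n<
        offset≤ : ℤ.∣ offset v ∣ ℕ.≤ 8N
        offset≤ = ℕ.≤-trans (ℤ.∣i+j∣≤∣i∣+∣j∣ a _) (ℕ.+-mono-≤ (abs≤ a a<)
          (ℕ.≤-trans (ℤ.∣i+j∣≤∣i∣+∣j∣ b _) (ℕ.+-mono-≤ (abs≤ b b<)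
            (ℕ.≤-trans (ℤ.∣i+j∣≤∣i∣+∣j∣ c e) (ℕ.+-mono-≤ (abs≤ c c<) (abs≤ e e<))))))
        eq : ∀ N → N ℕ.* 5 ℕ.+ ((N ℕ.* 2 ℕ.+ (N ℕ.* 2 ℕ.+ (N ℕ.* 2 ℕ.+ N ℕ.* 2))) ℕ.+ (N ℕ.* 2 ℕ.+ (N ℕ.* 2 ℕ.+ (N ℕ.* 2 ℕ.+ N ℕ.* 2)))) ≡ N ℕ.* 21
        eq = ℕ-Solver.solve-∀

      -- In a window large enough for both, the second copy is re-indexed by the reflection; the sum
      -- of the two then runs over the nearly cancelling pairs of `H-mirror`.
      𝕊H-doubled : ∀ v → All (λ a → level a ℕ.< N ℕ.* 2) v →
        (𝕊 L (λ l → H l v) +ᶜ 𝕊 L (λ l → H l v)) ≼ (ι X * (β + β))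
      𝕊H-doubled v v< = ≼-resp-≈ (begin
        𝕊 L (λ l → H l v) +ᶜ 𝕊 L (λ l → H l v)                        ≈⟨ ℂ.+-cong enlarge (ℂ.trans enlarge mirror) ⟩
        𝕊 X (λ l → H l v) +ᶜ 𝕊 X (λ l → H (δ v ℤ.+ rev l) v)          ≈⟨ 𝕊-+ X (λ l → H l v) (λ l → H (δ v ℤ.+ rev l) v) ⟨
        𝕊 X (λ l → H l v +ᶜ H (δ v ℤ.+ rev l) v)                      ∎)
        (𝕊-≼ X λ l _ → H-mirror l v)
        where
        open ≈-Reasoning
        L+δ≤X = δ-bound v v<
        enlarge : 𝕊 L (λ l → H l v) ≈ 𝕊 X (λ l → H l v)
        enlarge = ℂ.sym (𝕊-enlarge (H-supported v) (ℕ.≤-trans (ℕ.m≤m+n L ℤ.∣ δ v ∣) L+δ≤X))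
        mirror : 𝕊 X (λ l → H l v) ≈ 𝕊 X (λ l → H (δ v ℤ.+ rev l) v)
        mirror = ℂ.sym (ℂ.trans (𝕊-rev X (λ l → H (δ v ℤ.+ l) v)) (𝕊-shift (H-supported v) (δ v) L+δ≤X))

    f : ℕ → ℂ
    f k = 𝕊 N (λ n → G (at k n))

    -- The left-hand side of the relation in its symmetric form over k modulo 5, with every theta
    -- series cut at N.
    P : ℂ
    P = sum₅ (λ k → pow 5 (f k) (w (ℤ.+ k)))

    M = N ℕ.* 2

    -- The series is re-indexed by the difference d to a given n. Differences within a window of N
    -- levels lie in one of 2N levels, and `g` discards the surplus.
    f-centred : ∀ k n → k ℕ.< 5 → level n ℕ.< N → f k ≈ 𝕊 M (λ d → g (at k n ℤ.+ d ℤ.* ℤ.+ 5))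
    f-centred k n k<5 n<N = begin
      𝕊 N (λ n → G (at k n))                        ≈⟨ 𝕊-cong-< N (λ n n<N → ℂ.sym (g-inside (level-at-< k n k<5 n<N))) ⟩
      𝕊 N γ                                         ≈⟨ 𝕊-enlarge γ-supp (ℕ.≤-trans (ℕ.m≤m+n N ℤ.∣ n ∣) N+n≤M) ⟨
      𝕊 M γ                                         ≈⟨ 𝕊-shift γ-supp n N+n≤M ⟨
      𝕊 M (λ d → γ (n ℤ.+ d))                       ≈⟨ 𝕊-cong M (λ d → ℂ.reflexive (cong g (at-shift k n d))) ⟩
      𝕊 M (λ d → g (at k n ℤ.+ d ℤ.* ℤ.+ 5))        ∎
      where
      open ≈-Reasoning
      γ : ℤ → ℂ
      γ n = g (at k n)
      γ-supp : Supported N γ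
      γ-supp n N≤n = g-outside (at k n) (level-at-≥ k n k<5 N≤n)
      abs≤ : ∀ n → level n ℕ.< N → ℤ.∣ n ∣ ℕ.≤ N
      abs≤ (ℤ.+ n)  n<N = ℕ.<⇒≤ n<N
      abs≤ -[1+ n ] n<N = n<N
      N+n≤M : N ℕ.+ ℤ.∣ n ∣ ℕ.≤ M
      N+n≤M = ℕ.≤-trans (ℕ.+-monoʳ-≤ N (abs≤ n n<N)) (ℕ.≤-reflexive (eq N))
        where
        eq : ∀ N → N ℕ.+ N ≡ N ℕ.* 2
        eq = ℕ-Solver.solve-∀

    -- One factor keeps its own index l and the other four are centred at it; thus five independent
    -- indices become the pair of l and v.
    pow-f : ∀ k → k ℕ.< 5 → pow 5 (f k) (w (ℤ.+ k)) ≈ 𝕊 N (λ n → 𝕊ⁿ 4 M (H (at k n)))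
    pow-f k k<5 = ℂ.trans (𝕊-* N (λ n → G (at k n)) (pow 4 (f k) (w (ℤ.+ k)))) (𝕊-cong-< N term)
      where
      open ≈-Reasoning
      term : ∀ n → level n ℕ.< N → G (at k n) *ᶜ pow 4 (f k) (w (ℤ.+ k)) ≈ 𝕊ⁿ 4 M (H (at k n))
      term n n<N = begin
        G l *ᶜ pow 4 (f k) (w (ℤ.+ k))       ≈⟨ ℂ.*-cong (ℂ.sym (g-inside (level-at-< k n k<5 n<N))) (pow-cong 4 (f-centred k n k<5 n<N) (ℂ.sym (w-at k n))) ⟩
        g l *ᶜ pow 4 (𝕊 M gₗ) (w l)          ≈⟨ ℂ.*-congˡ (pow-𝕊 4 M gₗ (w l)) ⟩
        g l *ᶜ 𝕊ⁿ 4 M (prod gₗ (w l))        ≈⟨ *-𝕊ⁿ 4 M (g l) (prod gₗ (w l)) ⟩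
        𝕊ⁿ 4 M (λ v → g l *ᶜ prod gₗ (w l) v) ≈⟨ 𝕊ⁿ-cong 4 M (λ v → ℂ.*-congˡ {g l} (ℂ.reflexive (sym (prod-map g (λ d → l ℤ.+ d ℤ.* ℤ.+ 5) (w l) v)))) ⟩
        𝕊ⁿ 4 M (H l)                         ∎
        where
        l = at k n
        gₗ : ℤ → ℂ
        gₗ d = g (l ℤ.+ d ℤ.* ℤ.+ 5)

    P≈ : P ≈ 𝕊ⁿ 4 M (λ v → 𝕊 L (λ l → H l v))
    P≈ = ℂ.trans (sum₅-cong pow-f) (ℂ.trans (ℂ.sym (𝕊-blocks N (λ l → 𝕊ⁿ 4 M (H l)))) (𝕊-𝕊ⁿ-swap 4 M L H))

    P-doubled : ∀ β → 0ℚ ≤ β → (∀ p r → ½ * (ι N * ι N) ≤ p → Φ T p r ≼ β) →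
      (P +ᶜ P) ≼ count 4 M (ι (N ℕ.* 21) * (β + β))
    P-doubled β 0≤β Φ≼β = ≼-resp-≈
      (ℂ.trans (ℂ.+-cong P≈ P≈) (ℂ.sym (𝕊ⁿ-+ 4 M (λ v → 𝕊 L (λ l → H l v)) (λ v → 𝕊 L (λ l → H l v)))))
      (𝕊ⁿ-≼ 4 M (𝕊H-doubled β 0≤β Φ≼β))

-- The truncation error tends to 0

r-anti : ∀ {i m} → i ℕ.≤ m → r m ≤ r i
r-anti {i} {m} i≤m = begin
  r m                          ≡⟨ *-identityʳ (r m) ⟨
  r m * 1ℚ                     ≡⟨ cong (r m *_) (ι*r i) ⟨
  r m * (ι (suc i) * r i)      ≤⟨ *-monoˡ (0≤r m) (*-monoʳ (0≤r i) (ι-mono (ℕ.s≤s i≤m))) ⟩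
  r m * (ι (suc m) * r i)      ≡⟨ e (r m) (ι (suc m)) (r i) ⟩
  ι (suc m) * r m * r i        ≡⟨ cong (_* r i) (ι*r m) ⟩
  1ℚ * r i                     ≡⟨ *-identityˡ (r i) ⟩
  r i                          ∎
  where
  open ≤-Reasoning
  e : ∀ a b c → a * (b * c) ≡ b * a * c
  e = solve-∀ ℚ-ring

r≤1 : ∀ m → r m ≤ 1ℚ
r≤1 m = ≤-trans (r-anti {0} {m} ℕ.z≤n) (≤-reflexive (trans (sym (*-identityˡ (r 0))) (ι*r 0)))

count-suc : ∀ m M β → count (suc m) M β ≡ (ι M + ι M) * count m M β
count-suc m M β = e (ι M) (count m M β)
  where
  e : ∀ x c → x * (c + c) ≡ (x + x) * c
  e = solve-∀ ℚ-ring

-- With u = N, ρ = 1 / N and s = a ρ², the number of terms times the decay s⁴ is of order ρ³.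
count-≡ : ∀ N a ρ t → ι N * ρ ≡ 1ℚ →
  let b = t * (a * (ρ * ρ) * (a * (ρ * ρ))) in
  count 4 (N ℕ.* 2) (ι (N ℕ.* 21) * (b * b + b * b)) ≡ 4ℚ * 4ℚ * (4ℚ * 4ℚ) * ι 21 * (t * t + t * t) * (a * a * (a * a)) * (ρ * ρ * ρ)
count-≡ N a ρ t Nρ≡1 = begin
  count 4 M X
    ≡⟨ trans (count-suc 3 M X) (cong (x *_) (trans (count-suc 2 M X) (cong (x *_) (trans (count-suc 1 M X) (cong (x *_) (count-suc 0 M X)))))) ⟩
  x * (x * (x * (x * X)))
    ≡⟨ cong₂ (λ x y → x * (x * (x * (x * (y * (b * b + b * b)))))) x≡4u (ι-* N 21) ⟩
  4ℚ * ι N * (4ℚ * ι N * (4ℚ * ι N * (4ℚ * ι N * (ι N * ι 21 * (b * b + b * b)))))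
    ≡⟨ e 4ℚ (ι 21) t (ι N) a ρ ⟩
  K * (ι N * ρ * (ι N * ρ) * (ι N * ρ) * (ι N * ρ) * (ι N * ρ))
    ≡⟨ cong (λ x → K * (x * x * x * x * x)) Nρ≡1 ⟩
  K * 1ℚ
    ≡⟨ *-identityʳ K ⟩
  K ∎
  where
  open ≡-Reasoning
  M = N ℕ.* 2
  b = t * (a * (ρ * ρ) * (a * (ρ * ρ)))
  K = 4ℚ * 4ℚ * (4ℚ * 4ℚ) * ι 21 * (t * t + t * t) * (a * a * (a * a)) * (ρ * ρ * ρ)
  x = ι M + ι M
  X = ι (N ℕ.* 21) * (b * b + b * b)
  x≡4u : x ≡ 4ℚ * ι N
  x≡4u = trans (cong (λ y → y + y) (ι-* N 2)) (e′ (ι N))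
    where
    e′ : ∀ u → u * (1ℚ + (1ℚ + 0ℚ)) + u * (1ℚ + (1ℚ + 0ℚ)) ≡ (1ℚ + 1ℚ) * (1ℚ + 1ℚ) * u
    e′ = solve-∀ ℚ-ring
  e : ∀ f g t u a ρ → f * u * (f * u * (f * u * (f * u * (u * g * (t * (a * (ρ * ρ) * (a * (ρ * ρ))) * (t * (a * (ρ * ρ) * (a * (ρ * ρ)))) + t * (a * (ρ * ρ) * (a * (ρ * ρ))) * (t * (a * (ρ * ρ) * (a * (ρ * ρ))))))))) ≡
    f * f * (f * f) * g * (t * t + t * t) * (a * a * (a * a)) * (ρ * ρ * ρ) * (u * ρ * (u * ρ) * (u * ρ) * (u * ρ) * (u * ρ))
  e = solve-∀ ℚ-ring

K₀ : ℚ
K₀ = 4ℚ * 4ℚ * (4ℚ * 4ℚ) * ι 21 * (32ℚ * 32ℚ + 32ℚ * 32ℚ)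

0≤K₀ : 0ℚ ≤ K₀
0≤K₀ = nonNegative⁻¹ K₀

module _ (τ : ℍ) (J : ℚ) (J-odd : ∀ y → Periods.Antiperiod (point τ) y → Periods.Antiperiod (point τ) (J * y)) where

  open Cancellation (point τ) J J-odd using (module Truncation)

  P-doubled-small : ∀ ε → 0ℚ < ε → ∃ λ N₀ → ∀ N → N₀ ℕ.≤ N → (Truncation.P N +ᶜ Truncation.P N) ≼ ε
  P-doubled-small ε 0<ε =
    let c , 0<c , decay = Φ-decay τ
        -- With a = 2/c the number s = a/N² is the inverse of q = ½ c N², the least value of c p
        -- over the terms whose partner is cut off. Taking N ≥ a ensures q ≥ 1, as the decay bound
        -- demands.
        a , 0<a , ca≡1 = inverse (half 0<c)
        0≤a = <⇒≤ 0<a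
        n₀ , a≤n₀ = arch a
        0≤K = *-nn {K₀} 0≤K₀ (*-nn (*-nn 0≤a 0≤a) (*-nn 0≤a 0≤a))
        η , 0<η , Kη≤ε = shrink 0≤K 0<ε
        i , ri≤η = r-small η 0<η
    in suc (n₀ ℕ.⊔ i) , λ where
      (suc m) (ℕ.s≤s le) → bound c a m 0<c 0<a ca≡1 decay (≤-trans a≤n₀ (ι-mono (ℕ.m≤n⇒m≤1+n (ℕ.≤-trans (ℕ.m≤m⊔n n₀ i) le))))
        (≤-trans (*-monoˡ 0≤K (≤-trans (r-anti (ℕ.≤-trans (ℕ.m≤n⊔m n₀ i) le)) ri≤η)) Kη≤ε)
    where
    bound : ∀ c a m → 0ℚ < c → 0ℚ < a → ½ * c * a ≡ 1ℚ →
      (∀ p r q s → 0ℚ ≤ p → 1ℚ ≤ q → q ≤ c * p → 0ℚ ≤ s → q * s ≡ 1ℚ →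
        Φ (point τ) p r ≼ (32ℚ * (s * s) * (32ℚ * (s * s)))) →
      a ≤ ι (suc m) → K₀ * (a * a * (a * a)) * r m ≤ ε → (Truncation.P (suc m) +ᶜ Truncation.P (suc m)) ≼ ε
    bound c a m 0<c 0<a ca≡1 decay a≤u K≤ε = ≼-mono
      (≤-trans (≤-reflexive (count-≡ (suc m) a ρ 32ℚ (ι*r m))) (≤-trans (*-monoˡ 0≤K ρ³≤ρ) K≤ε))
      (Truncation.P-doubled (suc m) β (*-nn 0≤b 0≤b) λ p r′ p≥ →
        decay p r′ q s (≤-trans (*-nn 0≤½ (*-nn 0≤u 0≤u)) p≥) 1≤q (*-monoˡ (<⇒≤ 0<c) p≥) 0≤s qs≡1)
      where
      ρ = r m
      u = ι (suc m)
      s = a * (ρ * ρ)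
      b = 32ℚ * (s * s)
      β = b * b
      q = c * (½ * (u * u))
      0≤u : 0ℚ ≤ u
      0≤u = 0≤ι (suc m)
      0≤a : 0ℚ ≤ a
      0≤a = <⇒≤ 0<a
      0≤K : 0ℚ ≤ K₀ * (a * a * (a * a))
      0≤K = *-nn {K₀} 0≤K₀ (*-nn (*-nn 0≤a 0≤a) (*-nn 0≤a 0≤a))
      0≤s : 0ℚ ≤ s
      0≤s = *-nn 0≤a (*-nn (0≤r m) (0≤r m))
      0≤b : 0ℚ ≤ b
      0≤b = *-nn {32ℚ} (nonNegative⁻¹ 32ℚ) (*-nn 0≤s 0≤s)
      ρ³≤ρ : ρ * ρ * ρ ≤ ρ
      ρ³≤ρ = subst (ρ * ρ * ρ ≤_) (*-identityˡ ρ) (*-monoʳ (0≤r m) (*-mono (0≤r m) (0≤r m) (r≤1 m) (r≤1 m)))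
      qs≡1 : q * s ≡ 1ℚ
      qs≡1 = trans (e c u a ρ) (cong₂ _*_ ca≡1 (cong₂ _*_ (ι*r m) (ι*r m)))
        where
        e : ∀ c u a ρ → c * (½ * (u * u)) * (a * (ρ * ρ)) ≡ ½ * c * a * ((u * ρ) * (u * ρ))
        e = solve-∀ ℚ-ring
      1≤q : 1ℚ ≤ q
      1≤q = begin
        1ℚ                     ≡⟨ ca≡1 ⟨
        ½ * c * a              ≤⟨ *-monoˡ 0≤½c a≤u ⟩
        ½ * c * u              ≡⟨ *-identityʳ _ ⟨
        ½ * c * u * 1ℚ         ≤⟨ *-monoˡ (*-nn 0≤½c 0≤u) (p≤p+ε 1ℚ (0≤ι m)) ⟩
        ½ * c * u * u          ≡⟨ e c u ⟩
        q                      ∎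
        where
        open ≤-Reasoning
        0≤½c : 0ℚ ≤ ½ * c
        0≤½c = <⇒≤ (half 0<c)
        e : ∀ c u → ½ * c * u * u ≡ c * (½ * (u * u))
        e = solve-∀ ℚ-ring

-- Limits

infix 4 _⟶ᶜ_
_⟶ᶜ_ : (ℕ → ℂ) → ℂ → Set
s ⟶ᶜ l = ∀ ε → 0ℚ < ε → ∃ λ N₀ → ∀ N → N₀ ℕ.≤ N → (s N -ᶜ l) ≼ ε

⟶-const : ∀ z → (λ _ → z) ⟶ᶜ z
⟶-const z ε 0<ε = 0 , λ N _ → ≼-mono (<⇒≤ 0<ε) (≼-resp-≈ (ℂ.-‿inverseʳ z) 0≼0)

⟶-resp-≈ : ∀ {s t l} → (∀ N → s N ≈ t N) → s ⟶ᶜ l → t ⟶ᶜ l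
⟶-resp-≈ s≈t s→l ε 0<ε = let N₀ , f = s→l ε 0<ε in N₀ , λ N le → ≼-resp-≈ (ℂ.+-congʳ (ℂ.sym (s≈t N))) (f N le)

⟶-+ : ∀ {s t l m} → s ⟶ᶜ l → t ⟶ᶜ m → (λ N → s N +ᶜ t N) ⟶ᶜ l +ᶜ m
⟶-+ {s} {t} {l} {m} s→l t→m ε 0<ε =
  let N₁ , f = s→l (½ * ε) (half 0<ε)
      N₂ , g = t→m (½ * ε) (half 0<ε)
  in N₁ ℕ.⊔ N₂ , λ N le → subst (_ ≼_) (e ε)
    (≼-resp-≈ (eq (s N) (t N)) (≼-+ (f N (ℕ.≤-trans (ℕ.m≤m⊔n N₁ N₂) le)) (g N (ℕ.≤-trans (ℕ.m≤n⊔m N₁ N₂) le))))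
  where
  open import Algebra.Properties.CommutativeSemigroup ℂ.+-commutativeSemigroup using (interchange)
  eq : ∀ x y → (x +ᶜ y) -ᶜ (l +ᶜ m) ≈ (x -ᶜ l) +ᶜ (y -ᶜ m)
  eq x y = ℂ.trans (ℂ.+-congˡ (ℂ.sym (ℂ-Properties.-‿+-comm l m))) (interchange x y (-ᶜ l) (-ᶜ m))
  e : ∀ ε → ½ * ε + ½ * ε ≡ ε
  e = solve-∀ ℚ-ring

⟶-neg : ∀ {s l} → s ⟶ᶜ l → (λ N → -ᶜ s N) ⟶ᶜ -ᶜ l
⟶-neg {s} {l} s→l ε 0<ε = let N₀ , f = s→l ε 0<ε in N₀ , λ N le →
  ≼-resp-≈ (ℂ-Properties.-‿+-comm (s N) (-ᶜ l)) (≼-neg (f N le))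

⟶-* : ∀ {s t l m} → s ⟶ᶜ l → t ⟶ᶜ m → (λ N → s N *ᶜ t N) ⟶ᶜ l *ᶜ m
⟶-* {s} {t} {l} {m} s→l t→m ε 0<ε =
  let A , 0≤A , l≼A = ≼-finite l
      B , 0≤B , m≼B = ≼-finite m
      δ , 0<δ , Kδ≤ε = shrink {1ℚ + B + A} {ε} (+-nn (+-nn 0≤1 0≤B) 0≤A) 0<ε
      0≤δ = <⇒≤ 0<δ
      N₁ , f = s→l δ 0<δ
      N₂ , g = t→m δ 0<δ
      -- Bounds `t N` by 1 + B, independently of δ.
      N₃ , g′ = t→m 1ℚ 0<1
  in (N₁ ℕ.⊔ N₂) ℕ.⊔ N₃ , λ N le →
    let le₁₂ = ℕ.≤-trans (ℕ.m≤m⊔n (N₁ ℕ.⊔ N₂) N₃) le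
        s-l = f N (ℕ.≤-trans (ℕ.m≤m⊔n N₁ N₂) le₁₂)
        t-m = g N (ℕ.≤-trans (ℕ.m≤n⊔m N₁ N₂) le₁₂)
        tN≼ = ≼-resp-≈ (split (t N)) (≼-+ (g′ N (ℕ.≤-trans (ℕ.m≤n⊔m (N₁ ℕ.⊔ N₂) N₃) le)) m≼B)
    in ≼-mono (≤-trans (≤-reflexive (e δ A B)) Kδ≤ε)
         (≼-resp-≈ (eq (s N) (t N)) (≼-+ (≼-* 0≤δ (+-nn 0≤1 0≤B) s-l tN≼) (≼-* 0≤A 0≤δ l≼A t-m)))
  where
  open ≈-Reasoning
  e : ∀ δ A B → δ * (1ℚ + B) + A * δ ≡ (1ℚ + B + A) * δ
  e = solve-∀ ℚ-ring
  telescope₃ : ∀ x y z → (x -ᶜ y) +ᶜ (y +ᶜ z) ≈ x +ᶜ z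
  telescope₃ x y z = begin
    (x -ᶜ y) +ᶜ (y +ᶜ z)         ≈⟨ ℂ.+-assoc x (-ᶜ y) _ ⟩
    x +ᶜ (-ᶜ y +ᶜ (y +ᶜ z))      ≈⟨ ℂ.+-congˡ (ℂ.+-assoc (-ᶜ y) y z) ⟨
    x +ᶜ ((-ᶜ y +ᶜ y) +ᶜ z)      ≈⟨ ℂ.+-congˡ (ℂ.+-congʳ (ℂ.-‿inverseˡ y)) ⟩
    x +ᶜ (0ℂ +ᶜ z)               ≈⟨ ℂ.+-congˡ (ℂ.+-identityˡ z) ⟩
    x +ᶜ z                       ∎
  split : ∀ x → x ≈ (x -ᶜ m) +ᶜ m
  split x = begin
    x                            ≈⟨ ℂ.+-identityʳ x ⟨
    x +ᶜ 0ℂ                      ≈⟨ telescope₃ x m 0ℂ ⟨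
    (x -ᶜ m) +ᶜ (m +ᶜ 0ℂ)        ≈⟨ ℂ.+-congˡ (ℂ.+-identityʳ m) ⟩
    (x -ᶜ m) +ᶜ m                ∎
  eq : ∀ x y → (x *ᶜ y) -ᶜ (l *ᶜ m) ≈ ((x -ᶜ l) *ᶜ y) +ᶜ (l *ᶜ (y -ᶜ m))
  eq x y = ℂ.sym (begin
    ((x -ᶜ l) *ᶜ y) +ᶜ (l *ᶜ (y -ᶜ m))                            ≈⟨ ℂ.+-cong (ℂ.distribʳ y x (-ᶜ l)) (ℂ.distribˡ l y (-ᶜ m)) ⟩
    ((x *ᶜ y) +ᶜ ((-ᶜ l) *ᶜ y)) +ᶜ ((l *ᶜ y) +ᶜ (l *ᶜ (-ᶜ m)))     ≈⟨ ℂ.+-cong (ℂ.+-congˡ (ℂ.sym (ℂ-Properties.-‿distribˡ-* l y))) (ℂ.+-congˡ (ℂ.sym (ℂ-Properties.-‿distribʳ-* l m))) ⟩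
    ((x *ᶜ y) -ᶜ (l *ᶜ y)) +ᶜ ((l *ᶜ y) -ᶜ (l *ᶜ m))               ≈⟨ telescope₃ (x *ᶜ y) (l *ᶜ y) (-ᶜ (l *ᶜ m)) ⟩
    (x *ᶜ y) -ᶜ (l *ᶜ m)                                          ∎)

⟶-pow : ∀ k {s l} c → s ⟶ᶜ l → (λ N → pow k (s N) c) ⟶ᶜ pow k l c
⟶-pow zero    c s→l = ⟶-const c
⟶-pow (suc k) {s} {l} c s→l = ⟶-* {s} {λ N → pow k (s N) c} {l} {pow k l c} s→l (⟶-pow k {s} {l} c s→l)

opaque
  unfolding _+ᶜ_ -ᶜ_

  approx-+ᶜ : ∀ z w k → approx (z +ᶜ w) k ≡ (seq (re z) k + seq (re w) k) +i (seq (im z) k + seq (im w) k)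
  approx-+ᶜ z w k = refl

  ⟶-limℂ : ∀ s c → s ⟶ᶜ limℂ s c
  ⟶-limℂ s c ε 0<ε =
    let N₁ , f = lim-correct (λ n → re (s n)) (proj₁ c) (½ * ε) (half 0<ε)
        N₂ , g = lim-correct (λ n → im (s n)) (proj₂ c) (½ * ε) (half 0<ε)
    in N₁ ℕ.⊔ N₂ , λ N le → eventually-≼ (eventually-map₂
      (λ k p q → ≤-trans (+-mono-≤ p q) (≤-reflexive (e ε)))
      (f N (ℕ.≤-trans (ℕ.m≤m⊔n N₁ N₂) le)) (g N (ℕ.≤-trans (ℕ.m≤n⊔m N₁ N₂) le)))
    where
    e : ∀ ε → ½ * ε + ½ * ε ≡ ε
    e = solve-∀ ℚ-ring

⟶-resp-≈ʳ : ∀ {s l m} → l ≈ m → s ⟶ᶜ l → s ⟶ᶜ m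
⟶-resp-≈ʳ l≈m s→l ε 0<ε = let N₀ , f = s→l ε 0<ε in N₀ , λ N le → ≼-resp-≈ (ℂ.+-congˡ (ℂ.-‿cong (ℂ.sym l≈m))) (f N le)

-- Theta constants as limits of window sums

∑ℂ-suc : ∀ N a → ∑ℂ (suc N) a ≈ ∑ℂ N a +ᶜ a N
∑ℂ-suc N a = approx-≡ (λ k → trans (cong₂ _+i_ (re-eq k) (im-eq k)) (sym (approx-+ᶜ (∑ℂ N a) (a N) k)))
  where
  re-eq : ∀ k → seq (re (∑ℂ (suc N) a)) k ≡ seq (re (∑ℂ N a)) k + seq (re (a N)) k
  re-eq k = refl
  im-eq : ∀ k → seq (im (∑ℂ (suc N) a)) k ≡ seq (im (∑ℂ N a)) k + seq (im (a N)) k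
  im-eq k = refl

-- The two one-sided series in the definition of θ, each cut after N terms, together fill the window
-- -N ≤ n < N.
∑ℂ≈𝕊 : ∀ N (f : ℤ → ℂ) → ∑ℂ N (λ j → f (ℤ.+ j)) +ᶜ ∑ℂ N (λ j → f -[1+ j ]) ≈ 𝕊 N f
∑ℂ≈𝕊 zero    f = ℂ.+-identityʳ 0ℂ
∑ℂ≈𝕊 (suc N) f = begin
  ∑ℂ (suc N) (λ j → f (ℤ.+ j)) +ᶜ ∑ℂ (suc N) (λ j → f -[1+ j ])
                            ≈⟨ ℂ.+-cong (∑ℂ-suc N (λ j → f (ℤ.+ j))) (∑ℂ-suc N (λ j → f -[1+ j ])) ⟩
  (A +ᶜ a) +ᶜ (B +ᶜ b)      ≈⟨ interchange A a B b ⟩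
  (A +ᶜ B) +ᶜ (a +ᶜ b)      ≈⟨ ℂ.+-congʳ (∑ℂ≈𝕊 N f) ⟩
  𝕊 (suc N) f               ∎
  where
  open ≈-Reasoning
  open import Algebra.Properties.CommutativeSemigroup ℂ.+-commutativeSemigroup using (interchange)
  A B a b : ℂ
  A = ∑ℂ N (λ j → f (ℤ.+ j))
  B = ∑ℂ N (λ j → f -[1+ j ])
  a = f (ℤ.+ N)
  b = f -[1+ N ]

θ-partial : ℂ → ℚ → ℚ → ℕ → ℂ
θ-partial T ε ε′ N = 𝕊 N (λ n → Φ T (½ * (shift ε n * shift ε n)) (shift ε n * (½ * ε′)))

module _ (ε ε′ : ℚ) (τ : ℍ) where

  open θ-Convergence (fromℚ ε) (fromℚ ε′) 0ℂ τ using (re-cauchy; im-cauchy)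

  private
    term : ℤ → ℂ
    term = θ-term (fromℚ ε) (fromℚ ε′) 0ℂ (point τ)

    s⁺ s⁻ : ℕ → ℂ
    s⁺ N = ∑ℂ N (λ j → term (ℤ.+ j))
    s⁻ N = ∑ℂ N (λ j → term -[1+ j ])

    c⁺ : IsCauchyℂ s⁺
    c⁺ = re-cauchy ℤ.+_ +-large , im-cauchy ℤ.+_ +-large

    c⁻ : IsCauchyℂ s⁻
    c⁻ = re-cauchy -[1+_] neg-large , im-cauchy -[1+_] neg-large

    θ≈ : θ[ fromℚ ε ⨾ fromℚ ε′ ] τ ≈ limℂ s⁺ c⁺ +ᶜ limℂ s⁻ c⁻
    θ≈ = approx-≡ (λ k → trans (cong₂ _+i_ (re-eq k) (im-eq k)) (sym (approx-+ᶜ (limℂ s⁺ c⁺) (limℂ s⁻ c⁻) k)))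
      where
      re-eq : ∀ k → seq (re (θ[ fromℚ ε ⨾ fromℚ ε′ ] τ)) k ≡ seq (re (limℂ s⁺ c⁺)) k + seq (re (limℂ s⁻ c⁻)) k
      re-eq k = refl
      im-eq : ∀ k → seq (im (θ[ fromℚ ε ⨾ fromℚ ε′ ] τ)) k ≡ seq (im (limℂ s⁺ c⁺)) k + seq (im (limℂ s⁻ c⁻)) k
      im-eq k = refl

    term≈Φ : ∀ n → term n ≈ Φ (point τ) (½ * (shift ε n * shift ε n)) (shift ε n * (½ * ε′))
    term≈Φ n = approx-≡ eq
      where
      eq : ∀ k → approx (term n) k ≡ approx (Φ (point τ) (½ * (shift ε n * shift ε n)) (shift ε n * (½ * ε′))) k
      eq k = trans (cong (E k) (θ-exponent≡Φ-exponent (point τ) ε ε′ n k)) (sym (approx-Φ (point τ) (½ * (shift ε n * shift ε n)) (shift ε n * (½ * ε′)) k))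

  θ-partial-⟶ : θ-partial (point τ) ε ε′ ⟶ᶜ θ[ fromℚ ε ⨾ fromℚ ε′ ] τ
  θ-partial-⟶ = ⟶-resp-≈ʳ {θ-partial (point τ) ε ε′} (ℂ.sym θ≈)
    (⟶-resp-≈ (λ N → ℂ.trans (∑ℂ≈𝕊 N term) (𝕊-cong N term≈Φ)) (⟶-+ {s⁺} {s⁻} (⟶-limℂ s⁺ c⁺) (⟶-limℂ s⁻ c⁻)))

-- l + l = (s + s) - ((s + s) - (l + l)), and both parts are small for large N.
vanishing-limit : ∀ {s l} → s ⟶ᶜ l → (∀ ε → 0ℚ < ε → ∃ λ N₀ → ∀ N → N₀ ℕ.≤ N → (s N +ᶜ s N) ≼ ε) → l ≈ 0ℂ
vanishing-limit {s} {l} s→l small = ≈-intro (≼-resp-≈ (ℂ.trans (ℂ.+-congˡ ℂ-Properties.-0#≈0#) (ℂ.+-identityʳ l))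
  (≼-double (≼-limit λ ε 0<ε → subst ((l +ᶜ l) ≼_) (e ε) (l+l≼ ε 0<ε))))
  where
  e : ∀ ε → ½ * ε + ½ * ε ≡ 0ℚ + ε
  e = solve-∀ ℚ-ring
  open import Algebra.Properties.AbelianGroup ℂ.+-abelianGroup using (xyx⁻¹≈y)
  l+l≼ : ∀ ε → 0ℚ < ε → (l +ᶜ l) ≼ (½ * ε + ½ * ε)
  l+l≼ ε 0<ε =
    let N₁ , f = ⟶-+ {s} {s} s→l s→l (½ * ε) (half 0<ε)
        N₂ , g = small (½ * ε) (half 0<ε)
        N = N₁ ℕ.⊔ N₂
    in ≼-resp-≈ (eq (s N +ᶜ s N) (l +ᶜ l)) (≼-+ (g N (ℕ.m≤n⊔m N₁ N₂)) (≼-neg (f N (ℕ.m≤m⊔n N₁ N₂))))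
    where
    eq : ∀ x y → y ≈ x +ᶜ (-ᶜ (x -ᶜ y))
    eq x y = begin
      y                              ≈⟨ xyx⁻¹≈y x y ⟨
      (x +ᶜ y) -ᶜ x                  ≈⟨ ℂ.+-assoc x y (-ᶜ x) ⟩
      x +ᶜ (y -ᶜ x)                  ≈⟨ ℂ.+-congˡ (ℂ.+-congʳ (ℂ-Properties.-‿involutive y)) ⟨
      x +ᶜ (-ᶜ (-ᶜ y) -ᶜ x)          ≈⟨ ℂ.+-congˡ (ℂ.+-comm (-ᶜ (-ᶜ y)) (-ᶜ x)) ⟩
      x +ᶜ (-ᶜ x -ᶜ (-ᶜ y))          ≈⟨ ℂ.+-congˡ (ℂ-Properties.-‿+-comm x (-ᶜ y)) ⟩
      x +ᶜ (-ᶜ (x -ᶜ y))             ∎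
      where open ≈-Reasoning

-- Transfer to the ring operations of the statement

combination : (c₀ c₁ c₃ c₄ x₀ x₁ x₂ x₃ x₄ : ℂ) → ℂ
combination c₀ c₁ c₃ c₄ x₀ x₁ x₂ x₃ x₄ =
  c₀ *ᶜ pow 5 x₀ 1ℂ +ᶜ c₁ *ᶜ pow 5 x₁ 1ℂ +ᶜ pow 5 x₂ 1ℂ -ᶜ c₃ *ᶜ pow 5 x₃ 1ℂ -ᶜ c₄ *ᶜ pow 5 x₄ 1ℂ

infix 4 _≐_
-- Equality of all approximants, disregarding the Cauchy moduli. Since the operations act termwise,
-- their transparent and opaque versions are related by it.
_≐_ : ℂ → ℂ → Set
z ≐ w = ∀ k → approx z k ≡ approx w k

opaque
  unfolding _+ᶜ_ _*ᶜ_ -ᶜ_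

  ≐-+ : ∀ z z′ w w′ → z ≐ z′ → w ≐ w′ → z +ℂ w ≐ z′ +ᶜ w′
  ≐-+ z z′ w w′ p q k = cong₂ ℚ[i]._+_ (p k) (q k)

  ≐-neg : ∀ z z′ → z ≐ z′ → -ℂ z ≐ -ᶜ z′
  ≐-neg z z′ p k = cong ℚ[i].-_ (p k)

  ≐-* : ∀ z z′ w w′ → z ≐ z′ → w ≐ w′ → z *ℂ w ≐ z′ *ᶜ w′
  ≐-* z z′ w w′ p q k = cong₂ ℚ[i]._*_ (p k) (q k)

≐-sub : ∀ z z′ w w′ → z ≐ z′ → w ≐ w′ → z -ℂ w ≐ z′ -ᶜ w′
≐-sub z z′ w w′ p q k = ≐-+ z z′ (-ℂ w) (-ᶜ w′) p (≐-neg w w′ q) k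

≐-pow : ∀ n x → x ^ℂ n ≐ pow n x 1ℂ
≐-pow zero    x k = refl
≐-pow (suc n) x k = trans (cong₂ _+i_ re-eq im-eq) (≐-* x x (x ^ℂ n) (pow n x 1ℂ) (λ _ → refl) (≐-pow n x) k)
  where
  re-eq : seq (re (x ^ℂ suc n)) k ≡ seq (re (x *ℂ x ^ℂ n)) k
  re-eq = refl
  im-eq : seq (im (x ^ℂ suc n)) k ≡ seq (im (x *ℂ x ^ℂ n)) k
  im-eq = refl

≐-combination : ∀ c₀ c₁ c₃ c₄ x₀ x₁ x₂ x₃ x₄ →
  c₀ *ℂ x₀ ^ℂ 5 +ℂ c₁ *ℂ x₁ ^ℂ 5 +ℂ x₂ ^ℂ 5 -ℂ c₃ *ℂ x₃ ^ℂ 5 -ℂ c₄ *ℂ x₄ ^ℂ 5 ≐ combination c₀ c₁ c₃ c₄ x₀ x₁ x₂ x₃ x₄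
≐-combination c₀ c₁ c₃ c₄ x₀ x₁ x₂ x₃ x₄ =
  ≐-sub (m₀ +ℂ m₁ +ℂ x₂ ^ℂ 5 -ℂ m₃) (m₀′ +ᶜ m₁′ +ᶜ pow 5 x₂ 1ℂ -ᶜ m₃′) m₄ m₄′
    (≐-sub (m₀ +ℂ m₁ +ℂ x₂ ^ℂ 5) (m₀′ +ᶜ m₁′ +ᶜ pow 5 x₂ 1ℂ) m₃ m₃′
      (≐-+ (m₀ +ℂ m₁) (m₀′ +ᶜ m₁′) (x₂ ^ℂ 5) (pow 5 x₂ 1ℂ)
        (≐-+ m₀ m₀′ m₁ m₁′ (monomial c₀ x₀) (monomial c₁ x₁))
        (≐-pow 5 x₂))
      (monomial c₃ x₃))
    (monomial c₄ x₄)
  where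
  m₀ = c₀ *ℂ x₀ ^ℂ 5
  m₁ = c₁ *ℂ x₁ ^ℂ 5
  m₃ = c₃ *ℂ x₃ ^ℂ 5
  m₄ = c₄ *ℂ x₄ ^ℂ 5
  m₀′ = c₀ *ᶜ pow 5 x₀ 1ℂ
  m₁′ = c₁ *ᶜ pow 5 x₁ 1ℂ
  m₃′ = c₃ *ᶜ pow 5 x₃ 1ℂ
  m₄′ = c₄ *ᶜ pow 5 x₄ 1ℂ
  monomial : ∀ c x → c *ℂ x ^ℂ 5 ≐ c *ᶜ pow 5 x 1ℂ
  monomial c x = ≐-* c c (x ^ℂ 5) (pow 5 x 1ℂ) (λ _ → refl) (≐-pow 5 x)

≃0-≐ : ∀ z w → z ≐ w → w ≈ 0ℂ → z ≃ℂ 0ℂ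
≃0-≐ z w z≐w w≈0 = ≈0⇒≃0 {z} (ℂ.trans {z} {w} {0ℂ} (approx-≡ z≐w) w≈0)

rev/1 : ∀ n → rev n / 1 ≡ - 1ℚ - n / 1
rev/1 n = trans (cong (_/ 1) (rev≡ n)) (trans (/1-homo-+ -[1+ 0 ] (ℤ.- n)) (cong (λ x → - 1ℚ + x) (/1-homo-neg n)))

-- The equations separate the form in which a characteristic is computed, such as 2 - ⅕, from the
-- form in which it is stated, such as 9/5.
θ-limit : ∀ τ ε ε′ a b → a ≡ fromℚ ε → b ≡ fromℚ ε′ → θ-partial (point τ) ε ε′ ⟶ᶜ θ[ a ⨾ b ] τ
θ-limit τ ε ε′ _ _ refl refl = θ-partial-⟶ ε ε′ τ

-- Coefficients and the two relations

module Coefficients (T : ℂ) where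

  open Periods T

  pow-Φ : ∀ m y z → pow m (Φ T 0ℚ y) (Φ T 0ℚ z) ≈ Φ T 0ℚ (z + ι m * y)
  pow-Φ zero    y z = ℂ.reflexive (cong (Φ T 0ℚ) (e y z))
    where
    e : ∀ y z → z ≡ z + 0ℚ * y
    e = solve-∀ ℚ-ring
  pow-Φ (suc m) y z = begin
    Φ T 0ℚ y *ᶜ pow m (Φ T 0ℚ y) (Φ T 0ℚ z)     ≈⟨ ℂ.*-congˡ (pow-Φ m y z) ⟩
    Φ T 0ℚ y *ᶜ Φ T 0ℚ (z + ι m * y)            ≈⟨ Φ-+ T 0ℚ y 0ℚ (z + ι m * y) ⟨
    Φ T (0ℚ + 0ℚ) (y + (z + ι m * y))           ≡⟨ cong₂ (Φ T) (+-identityˡ 0ℚ) (e (ι m) y z) ⟩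
    Φ T 0ℚ (z + ι (suc m) * y)                  ∎
    where
    open ≈-Reasoning
    e : ∀ m y z → y + (z + m * y) ≡ z + (1ℚ + m) * y
    e = solve-∀ ℚ-ring

  -- Both sides are the negative of `Φ T 0ℚ ½`, by the value at ½ and by the antiperiod ½.
  1≈Φ : 1ℂ ≈ Φ T 0ℚ 0ℚ
  1≈Φ = begin
    1ℂ                        ≈⟨ ℂ-Properties.-‿involutive 1ℂ ⟨
    -ᶜ (-ᶜ 1ℂ)                ≈⟨ ℂ.-‿cong Φ-½ ⟨
    -ᶜ Φ T 0ℚ ½               ≡⟨ cong (λ r → -ᶜ Φ T 0ℚ r) (+-identityˡ ½) ⟨
    -ᶜ Φ T 0ℚ (0ℚ + ½)        ≈⟨ ℂ.-‿cong (antiperiod-½ 0ℚ 0ℚ) ⟩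
    -ᶜ (-ᶜ Φ T 0ℚ 0ℚ)         ≈⟨ ℂ-Properties.-‿involutive (Φ T 0ℚ 0ℚ) ⟩
    Φ T 0ℚ 0ℚ                 ∎
    where open ≈-Reasoning

  ζ₅^≈Φ : ∀ n → ζ₅ ^ℂ n ≈ Φ T 0ℚ (0ℚ + ι n * ⅕)
  ζ₅^≈Φ n = ℂ.trans (approx-≡ (≐-pow n ζ₅)) (ℂ.trans (pow-cong n (ζ₅≈Φ T) 1≈Φ) (pow-Φ n ⅕ 0ℚ))

module Assembly (τ : ℍ) (J : ℚ) (J-odd : ∀ y → Periods.Antiperiod (point τ) y → Periods.Antiperiod (point τ) (J * y)) where

  private
    T = point τ

  open Periods T
  open Coefficients T
  open Cancellation T J J-odd

  f-direct : ∀ N k ε → σ (ℤ.+ k) ≡ ½ * ε → Truncation.f N k ≈ θ-partial T ε (J * ⅕) N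
  f-direct N k ε σk≡ = 𝕊-cong N λ n → ℂ.reflexive (cong (λ s → Φ T (½ * (s * s)) (s * κ)) (trans (σ-at k n) (cong (n / 1 +_) σk≡)))

  -- Summing over -1 - n instead of n turns ε into 2 - ε, up to a root of unity.
  f-mirror : ∀ N k ε → σ (ℤ.+ k) ≡ 1ℚ - ½ * ε →
    Truncation.f N k ≈ θ-partial T ε (1ℚ + 1ℚ - J * ⅕) N *ᶜ Φ T 0ℚ (- (½ * ε))
  f-mirror N k ε σk≡ = begin
    𝕊 N (λ n → G (at k n))                                   ≈⟨ 𝕊-rev N (λ n → G (at k n)) ⟨
    𝕊 N (λ n → G (at k (rev n)))                             ≈⟨ 𝕊-cong N term ⟩
    𝕊 N (λ n → t n *ᶜ Φ T 0ℚ (- (½ * ε)))                    ≈⟨ 𝕊-* N t (Φ T 0ℚ (- (½ * ε))) ⟨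
    𝕊 N t *ᶜ Φ T 0ℚ (- (½ * ε))                              ∎
    where
    open ≈-Reasoning
    ε′ = 1ℚ + 1ℚ - J * ⅕
    t : ℤ → ℂ
    t n = Φ T (½ * (shift ε n * shift ε n)) (shift ε n * (½ * ε′))
    σ-rev-at : ∀ n → σ (at k (rev n)) ≡ - shift ε n
    σ-rev-at n = trans (σ-at k (rev n)) (trans (cong₂ _+_ (rev/1 n) σk≡) (e (n / 1) ε))
      where
      e : ∀ n ε → - 1ℚ - n + (1ℚ - ½ * ε) ≡ - (n + ½ * ε)
      e = solve-∀ ℚ-ring
    e₁ : ∀ s → ½ * (- s * - s) ≡ ½ * (s * s) + 0ℚ
    e₁ = solve-∀ ℚ-ring
    -- Passing from -s J/10 to s ε′/2 with ε′ = 2 - J/5 costs -s = -½ε - n; the integer part is a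
    -- period and drops out.
    e₂ : ∀ n ε J → - (n + ½ * ε) * (½ * (J * ⅕)) ≡ (n + ½ * ε) * (½ * (1ℚ + 1ℚ - J * ⅕)) + - (½ * ε) + - n
    e₂ = solve-∀ ℚ-ring
    term : ∀ n → G (at k (rev n)) ≈ t n *ᶜ Φ T 0ℚ (- (½ * ε))
    term n = begin
      G (at k (rev n))
        ≡⟨ cong (λ s → Φ T (½ * (s * s)) (s * κ)) (σ-rev-at n) ⟩
      Φ T (½ * (- shift ε n * - shift ε n)) (- shift ε n * κ)
        ≡⟨ cong₂ (Φ T) (e₁ (shift ε n)) (e₂ (n / 1) ε J) ⟩
      Φ T (½ * (shift ε n * shift ε n) + 0ℚ) (shift ε n * (½ * ε′) + - (½ * ε) + - (n / 1))
        ≈⟨ period-neg (period-ℤ n) _ _ ⟩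
      Φ T (½ * (shift ε n * shift ε n) + 0ℚ) (shift ε n * (½ * ε′) + - (½ * ε))
        ≈⟨ Φ-+ T _ _ 0ℚ (- (½ * ε)) ⟩
      t n *ᶜ Φ T 0ℚ (- (½ * ε)) ∎

  Direct : ℕ → ℂ → Set
  Direct k c = ∃ λ y → ∃ λ x → c ≈ Φ T 0ℚ y × Period x × weight (ℤ.+ k) ≡ y + x

  -- The fifth power of the root of unity in `f-mirror` contributes -5ε/2. The remainder is half an
  -- odd integer, hence an antiperiod: this is the origin of the minus signs in the relations.
  Mirror : ℕ → ℚ → ℂ → Set
  Mirror k ε c = ∃ λ y → ∃ λ x → c ≈ Φ T 0ℚ y × Antiperiod x × weight (ℤ.+ k) + ι 5 * - (½ * ε) ≡ y + x

  direct-term : ∀ N k ε c → σ (ℤ.+ k) ≡ ½ * ε → Direct k c →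
    pow 5 (Truncation.f N k) (w (ℤ.+ k)) ≈ c *ᶜ pow 5 (θ-partial T ε (J * ⅕) N) 1ℂ
  direct-term N k ε c σk≡ (y , x , c≈ , per-x , weight≡) = ℂ.trans (pow-cong 5 (f-direct N k ε σk≡) w≈c) (pow-1 5 (θ-partial T ε (J * ⅕) N) c)
    where
    w≈c : w (ℤ.+ k) ≈ c
    w≈c = ℂ.trans (ℂ.reflexive (cong (Φ T 0ℚ) weight≡)) (ℂ.trans (per-x 0ℚ y) (ℂ.sym c≈))

  mirror-term : ∀ N k ε c → σ (ℤ.+ k) ≡ 1ℚ - ½ * ε → Mirror k ε c →
    pow 5 (Truncation.f N k) (w (ℤ.+ k)) ≈ -ᶜ (c *ᶜ pow 5 (θ-partial T ε (1ℚ + 1ℚ - J * ⅕) N) 1ℂ)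
  mirror-term N k ε c σk≡ (y , x , c≈ , anti-x , weight≡) = begin
    pow 5 (Truncation.f N k) (w (ℤ.+ k))     ≈⟨ pow-cong 5 (f-mirror N k ε σk≡) ℂ.refl ⟩
    pow 5 (t *ᶜ u) (w (ℤ.+ k))               ≈⟨ pow-* 5 t u (w (ℤ.+ k)) ⟩
    pow 5 t (pow 5 u (w (ℤ.+ k)))            ≈⟨ pow-cong 5 ℂ.refl w≈c ⟩
    pow 5 t (-ᶜ c)                           ≈⟨ pow-1 5 t (-ᶜ c) ⟩
    (-ᶜ c) *ᶜ pow 5 t 1ℂ                     ≈⟨ ℂ-Properties.-‿distribˡ-* c (pow 5 t 1ℂ) ⟨
    -ᶜ (c *ᶜ pow 5 t 1ℂ)                     ∎
    where
    open ≈-Reasoning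
    t u : ℂ
    t = θ-partial T ε (1ℚ + 1ℚ - J * ⅕) N
    u = Φ T 0ℚ (- (½ * ε))
    w≈c : pow 5 u (w (ℤ.+ k)) ≈ -ᶜ c
    w≈c = begin
      pow 5 u (w (ℤ.+ k))                            ≈⟨ pow-Φ 5 (- (½ * ε)) (weight (ℤ.+ k)) ⟩
      Φ T 0ℚ (weight (ℤ.+ k) + ι 5 * - (½ * ε))      ≡⟨ cong (Φ T 0ℚ) weight≡ ⟩
      Φ T 0ℚ (y + x)                                 ≈⟨ anti-x 0ℚ y ⟩
      -ᶜ Φ T 0ℚ y                                    ≈⟨ ℂ.-‿cong c≈ ⟨
      -ᶜ c                                           ∎

  -- These are (2k + 1)/5 for k = 0, 1, 2; the classes k = 3 and k = 4 appear as 2 - ε₃ and 2 - ε₁.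
  ε₁ ε₃ ε₅ : ℚ
  ε₁ = ℤ.+ 1 / 5
  ε₃ = ℤ.+ 3 / 5
  ε₅ = ℤ.+ 1 / 1

  P≈combination : ∀ N c₀ c₁ c₃ c₄ → Direct 0 c₀ → Direct 1 c₁ → Direct 2 1ℂ → Mirror 3 ε₃ c₃ → Mirror 4 ε₁ c₄ →
    Truncation.P N ≈ combination c₀ c₁ c₃ c₄
      (θ-partial T ε₁ (J * ⅕) N) (θ-partial T ε₃ (J * ⅕) N) (θ-partial T ε₅ (J * ⅕) N)
      (θ-partial T ε₃ (1ℚ + 1ℚ - J * ⅕) N) (θ-partial T ε₁ (1ℚ + 1ℚ - J * ⅕) N)
  P≈combination N c₀ c₁ c₃ c₄ d₀ d₁ d₂ d₃ d₄ = ℂ.trans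
    (ℂ.+-cong (direct-term N 0 ε₁ c₀ refl d₀) (ℂ.+-cong (direct-term N 1 ε₃ c₁ refl d₁)
      (ℂ.+-cong (ℂ.trans (direct-term N 2 ε₅ 1ℂ refl d₂) (ℂ.*-identityˡ _))
        (ℂ.+-cong (mirror-term N 3 ε₃ c₃ refl d₃) (mirror-term N 4 ε₁ c₄ refl d₄)))))
    (reassociate _ _ _ _ _)
    where
    reassociate : ∀ a b c d e → a +ᶜ (b +ᶜ (c +ᶜ (d +ᶜ e))) ≈ a +ᶜ b +ᶜ c +ᶜ d +ᶜ e
    reassociate a b c d e = begin
      a +ᶜ (b +ᶜ (c +ᶜ (d +ᶜ e)))      ≈⟨ ℂ.+-assoc a b _ ⟨
      a +ᶜ b +ᶜ (c +ᶜ (d +ᶜ e))        ≈⟨ ℂ.+-assoc (a +ᶜ b) c _ ⟨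
      a +ᶜ b +ᶜ c +ᶜ (d +ᶜ e)          ≈⟨ ℂ.+-assoc (a +ᶜ b +ᶜ c) d e ⟨
      a +ᶜ b +ᶜ c +ᶜ d +ᶜ e            ∎
      where open ≈-Reasoning

  combination≈0 : ∀ c₀ c₁ c₃ c₄ {x₀ x₁ x₂ x₃ x₄} → Direct 0 c₀ → Direct 1 c₁ → Direct 2 1ℂ → Mirror 3 ε₃ c₃ → Mirror 4 ε₁ c₄ →
    θ-partial T ε₁ (J * ⅕) ⟶ᶜ x₀ → θ-partial T ε₃ (J * ⅕) ⟶ᶜ x₁ → θ-partial T ε₅ (J * ⅕) ⟶ᶜ x₂ →
    θ-partial T ε₃ (1ℚ + 1ℚ - J * ⅕) ⟶ᶜ x₃ → θ-partial T ε₁ (1ℚ + 1ℚ - J * ⅕) ⟶ᶜ x₄ →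
    combination c₀ c₁ c₃ c₄ x₀ x₁ x₂ x₃ x₄ ≈ 0ℂ
  combination≈0 c₀ c₁ c₃ c₄ {x₀} {x₁} {x₂} {x₃} {x₄} d₀ d₁ d₂ d₃ d₄ l₀ l₁ l₂ l₃ l₄ = vanishing-limit {Truncation.P}
    (⟶-resp-≈ (λ N → ℂ.sym (P≈combination N c₀ c₁ c₃ c₄ d₀ d₁ d₂ d₃ d₄))
      (⟶-+ (⟶-+ (⟶-+ (⟶-+ (monomial c₀ l₀) (monomial c₁ l₁)) (⟶-pow 5 1ℂ l₂)) (⟶-neg (monomial c₃ l₃))) (⟶-neg (monomial c₄ l₄))))
    (P-doubled-small τ J J-odd)
    where
    monomial : ∀ c {s x} → s ⟶ᶜ x → (λ N → c *ᶜ pow 5 (s N) 1ℂ) ⟶ᶜ c *ᶜ pow 5 x 1ℂ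
    monomial c {s} {x} s→x = ⟶-* {λ _ → c} {λ N → pow 5 (s N) 1ℂ} (⟶-const c) (⟶-pow 5 {s} 1ℂ s→x)

  relation≃0 : ∀ c₀ c₁ c₃ c₄ x₀ x₁ x₂ x₃ x₄ → Direct 0 c₀ → Direct 1 c₁ → Direct 2 1ℂ → Mirror 3 ε₃ c₃ → Mirror 4 ε₁ c₄ →
    θ-partial T ε₁ (J * ⅕) ⟶ᶜ x₀ → θ-partial T ε₃ (J * ⅕) ⟶ᶜ x₁ → θ-partial T ε₅ (J * ⅕) ⟶ᶜ x₂ →
    θ-partial T ε₃ (1ℚ + 1ℚ - J * ⅕) ⟶ᶜ x₃ → θ-partial T ε₁ (1ℚ + 1ℚ - J * ⅕) ⟶ᶜ x₄ →
    c₀ *ℂ x₀ ^ℂ 5 +ℂ c₁ *ℂ x₁ ^ℂ 5 +ℂ x₂ ^ℂ 5 -ℂ c₃ *ℂ x₃ ^ℂ 5 -ℂ c₄ *ℂ x₄ ^ℂ 5 ≃ℂ 0ℂ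
  relation≃0 c₀ c₁ c₃ c₄ x₀ x₁ x₂ x₃ x₄ d₀ d₁ d₂ d₃ d₄ l₀ l₁ l₂ l₃ l₄ = ≃0-≐
    (c₀ *ℂ x₀ ^ℂ 5 +ℂ c₁ *ℂ x₁ ^ℂ 5 +ℂ x₂ ^ℂ 5 -ℂ c₃ *ℂ x₃ ^ℂ 5 -ℂ c₄ *ℂ x₄ ^ℂ 5)
    (combination c₀ c₁ c₃ c₄ x₀ x₁ x₂ x₃ x₄)
    (≐-combination c₀ c₁ c₃ c₄ x₀ x₁ x₂ x₃ x₄)
    (combination≈0 c₀ c₁ c₃ c₄ d₀ d₁ d₂ d₃ d₄ l₀ l₁ l₂ l₃ l₄)

3ℚ : ℚ
3ℚ = ℤ.+ 3 / 1

theorem3p2 : (τ : ℍ) →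
    ( ζ₅ *ℂ θ[ 1 ⁄ 5 ⨾ 1 ⁄ 5 ] τ ^ℂ 5
    +ℂ ζ₅ ^ℂ 3 *ℂ θ[ 3 ⁄ 5 ⨾ 1 ⁄ 5 ] τ ^ℂ 5
    +ℂ θ[ 1 ⁄ 1 ⨾ 1 ⁄ 5 ] τ ^ℂ 5
    -ℂ ζ₅ ^ℂ 2 *ℂ θ[ 3 ⁄ 5 ⨾ 9 ⁄ 5 ] τ ^ℂ 5
    -ℂ ζ₅ ^ℂ 4 *ℂ θ[ 1 ⁄ 5 ⨾ 9 ⁄ 5 ] τ ^ℂ 5
    ≃ℂ 0ℂ )
    × ( ζ₅ ^ℂ 3 *ℂ θ[ 1 ⁄ 5 ⨾ 3 ⁄ 5 ] τ ^ℂ 5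
    +ℂ ζ₅ ^ℂ 4 *ℂ θ[ 3 ⁄ 5 ⨾ 3 ⁄ 5 ] τ ^ℂ 5
    +ℂ θ[ 1 ⁄ 1 ⨾ 3 ⁄ 5 ] τ ^ℂ 5
    -ℂ ζ₅ *ℂ θ[ 3 ⁄ 5 ⨾ 7 ⁄ 5 ] τ ^ℂ 5
    -ℂ ζ₅ ^ℂ 2 *ℂ θ[ 1 ⁄ 5 ⨾ 7 ⁄ 5 ] τ ^ℂ 5
    ≃ℂ 0ℂ )
theorem3p2 τ =
    Assembly.relation≃0 τ 1ℚ 1-odd ζ₅ (ζ₅ ^ℂ 3) (ζ₅ ^ℂ 2) (ζ₅ ^ℂ 4)
      (θ[ 1 ⁄ 5 ⨾ 1 ⁄ 5 ] τ) (θ[ 3 ⁄ 5 ⨾ 1 ⁄ 5 ] τ) (θ[ 1 ⁄ 1 ⨾ 1 ⁄ 5 ] τ) (θ[ 3 ⁄ 5 ⨾ 9 ⁄ 5 ] τ) (θ[ 1 ⁄ 5 ⨾ 9 ⁄ 5 ] τ)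
      -- Exponents for J = 1, split into that of the power of ζ₅ and a period or antiperiod: 1/5,
      -- 3/5, 1, then 7/5 - 3/2 = 2/5 - 1/2 and 9/5 - 1/2 = 4/5 + 1/2.
      (⅕ , ι 0 , ζ₅≈Φ T , period-ι 0 , refl)
      (0ℚ + ι 3 * ⅕ , ι 0 , ζ₅^≈Φ 3 , period-ι 0 , refl)
      (0ℚ , ι 1 , 1≈Φ , period-ι 1 , refl)
      (0ℚ + ι 2 * ⅕ , - ½ , ζ₅^≈Φ 2 , antiperiod-neg antiperiod-½ , refl)
      (0ℚ + ι 4 * ⅕ , ½ , ζ₅^≈Φ 4 , antiperiod-½ , refl)
      (θ-limit τ (ℤ.+ 1 / 5) (1ℚ * ⅕) (1 ⁄ 5) (1 ⁄ 5) refl refl)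
      (θ-limit τ (ℤ.+ 3 / 5) (1ℚ * ⅕) (3 ⁄ 5) (1 ⁄ 5) refl refl)
      (θ-limit τ (ℤ.+ 1 / 1) (1ℚ * ⅕) (1 ⁄ 1) (1 ⁄ 5) refl refl)
      (θ-limit τ (ℤ.+ 3 / 5) (1ℚ + 1ℚ - 1ℚ * ⅕) (3 ⁄ 5) (9 ⁄ 5) refl refl)
      (θ-limit τ (ℤ.+ 1 / 5) (1ℚ + 1ℚ - 1ℚ * ⅕) (1 ⁄ 5) (9 ⁄ 5) refl refl)
  , Assembly.relation≃0 τ 3ℚ 3-odd (ζ₅ ^ℂ 3) (ζ₅ ^ℂ 4) ζ₅ (ζ₅ ^ℂ 2)
      (θ[ 1 ⁄ 5 ⨾ 3 ⁄ 5 ] τ) (θ[ 3 ⁄ 5 ⨾ 3 ⁄ 5 ] τ) (θ[ 1 ⁄ 1 ⨾ 3 ⁄ 5 ] τ) (θ[ 3 ⁄ 5 ⨾ 7 ⁄ 5 ] τ) (θ[ 1 ⁄ 5 ⨾ 7 ⁄ 5 ] τ)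
      -- Exponents for J = 3: 3/5, 9/5 = 4/5 + 1, 3, then 21/5 - 3/2 = 1/5 + 5/2 and 27/5 - 1/2 =
      -- 2/5 + 9/2.
      (0ℚ + ι 3 * ⅕ , ι 0 , ζ₅^≈Φ 3 , period-ι 0 , refl)
      (0ℚ + ι 4 * ⅕ , ι 1 , ζ₅^≈Φ 4 , period-ι 1 , refl)
      (0ℚ , ι 3 , 1≈Φ , period-ι 3 , refl)
      (⅕ , ½ + ι 2 , ζ₅≈Φ T , antiperiod+period antiperiod-½ (period-ι 2) , refl)
      (0ℚ + ι 2 * ⅕ , ½ + ι 4 , ζ₅^≈Φ 2 , antiperiod+period antiperiod-½ (period-ι 4) , refl)
      (θ-limit τ (ℤ.+ 1 / 5) (3ℚ * ⅕) (1 ⁄ 5) (3 ⁄ 5) refl refl)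
      (θ-limit τ (ℤ.+ 3 / 5) (3ℚ * ⅕) (3 ⁄ 5) (3 ⁄ 5) refl refl)
      (θ-limit τ (ℤ.+ 1 / 1) (3ℚ * ⅕) (1 ⁄ 1) (3 ⁄ 5) refl refl)
      (θ-limit τ (ℤ.+ 3 / 5) (1ℚ + 1ℚ - 3ℚ * ⅕) (3 ⁄ 5) (7 ⁄ 5) refl refl)
      (θ-limit τ (ℤ.+ 1 / 5) (1ℚ + 1ℚ - 3ℚ * ⅕) (1 ⁄ 5) (7 ⁄ 5) refl refl)
  where
  T : ℂ
  T = point τ

  open Periods T
  open Coefficients T

  1-odd : ∀ y → Antiperiod y → Antiperiod (1ℚ * y)
  1-odd y anti-y = subst Antiperiod (sym (*-identityˡ y)) anti-y

  3-odd : ∀ y → Antiperiod y → Antiperiod (3ℚ * y)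
  3-odd y anti-y = subst Antiperiod (e y) (antiperiod+period anti-y (antiperiod+antiperiod anti-y anti-y))
    where
    e : ∀ y → y + (y + y) ≡ 3ℚ * y
    e = solve-∀ ℚ-ring
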